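{- Let $n>1$ be an integer, let $K$ be a number field of degree $n$, and let $p$ be a rational prime. Let $c_7(n) = \max_{0\le d\le n-1} \frac{d(n-1-d)}{n-1+d}$, the maximum being over all integers $d$ with $0\le d\le n-1$. Then: (1) The series $\tilde{\eta}_{K,p}(s)$ diverges for all $s\in\mathbb{C}$ such that $\operatorname{Re}(s)\le \frac{c_7(n)}{2}$. (2) The series $\tilde{\eta}_{K,p}(s)$ diverges for all $s\in\mathbb{C}$ such that $$\operatorname{Re}(s)\le \frac{(3-2\sqrt{2})(n-1)+1-\sqrt{2}}{2}.$$
   Context: Let $\mathcal{O}_K$ be the ring of integers of $K$. An order in $\mathcal{O}_K$ is a finite index subring of $\mathcal{O}_K$ containing the multiplicative identity. Let $\tilde{\eta}_K(s)=\sum_{\mathcal{O}}[\mathcal{O}_K:\mathcal{O}]^{ -s}$, the sum being over all orders $\mathcal{O}$ of $\mathcal{O}_K$. It has an Euler product $\tilde\eta_K(s)=\prod_p\tilde\eta_{K,p}(s)$ over rational primes, where $\tilde{\eta}_{K,p}(s)=\sum_{\mathcal{O}}[\mathcal{O}_K\otimes_{\mathbb{Z}}\mathbb{Z}_p:\mathcal{O}]^{ -s}$, the sum being over finite index unital $\mathbb{Z}_p$-subalgebras $\mathcal{O}$ of $\mathcal{O}_K\otimes_{\mathbb{Z}}\mathbb{Z}_p$; equivalently, $\tilde{\eta}_{K,p}(s)=\sum_{e\ge 0} N_{K}(p^e)p^{ -es}$, where $N_K(p^e)$ is the number of orders of index $p^e$ in $\mathcal{O}_K$. -}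

module Defs where

open import Algebra.Apartness.Bundles using (HeytingCommutativeRing; HeytingField)
open import Algebra.Bundles using (CommutativeRing)
open import Algebra.Morphism.Structures using (module RingMorphisms)
import Algebra.Properties.Monoid.Sum as Sum
import Algebra.Properties.Semiring.Exp as Exp
open import Data.Fin.Base as Fin using (Fin)
open import Data.Integer.Base as ℤ using (ℤ; +_)
import Data.Integer.Properties as ℤ
open import Data.List.Base using (map; upTo)
open import Data.Nat.Base as ℕ using (ℕ; zero; suc)
import Data.Nat.Properties as ℕ
open import Data.Product using (Σ-syntax; ∃-syntax; ∃!; _×_; _,_; proj₁; proj₂)
open import Data.Rational as ℚ
  using (ℚ; mkℚ; 0ℚ; 1ℚ; ½; _+_; _*_; _-_; -_; _/_; _≤_; _<_; ∣_∣)
import Data.Rational.Properties as ℚ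
open import Data.Rational.Solver using (module +-*-Solver)
import Data.Rational.Unnormalised as ℚᵘ
import Data.Rational.Unnormalised.Properties as ℚᵘ
open import Data.Sum using (inj₁; inj₂; [_,_]′)
open import Function.Base using (_on_)
open import Function.Bundles using (Bijection)
open import Level using (_⊔_)
open import Relation.Binary.Bundles using (DecTotalOrder; Setoid)
import Relation.Binary.Construct.On as On
open import Relation.Binary.PropositionalEquality as ≡
  using (_≡_; refl; sym; trans; cong; cong₂; subst)
open import Relation.Nullary using (¬_; Dec; yes; no)
open import Relation.Unary using (Pred; _⊆_; _≐_)
open import Relation.Unary.Relation.Binary.Equality using (≐-isEquivalence)

open import Data.List.Extrema (DecTotalOrder.totalOrder ℚ.≤-decTotalOrder) using (max)
open RingMorphisms using (IsRingHomomorphism)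
open +-*-Solver using (solve; _:+_; _:*_; _:-_; :-_; _:=_)

-- f m n → 0 as m, n → ∞ jointly.
Null : (ℕ → ℕ → ℚ) → Set
Null f = ∀ ε → 0ℚ < ε → ∃[ N ] ∀ m n → N ℕ.≤ m → N ℕ.≤ n → ∣ f m n ∣ ≤ ε

-- Real numbers are Cauchy sequences of rationals; they are compared by _≤ᴿ_
-- and _≃ᴿ_ below, not by _≡_.
record ℝ : Set where
  field
    seq    : ℕ → ℚ
    cauchy : Null (λ m n → seq m - seq n)
open ℝ public

1/suc : ℕ → ℚ
1/suc n = + 1 / suc n

≤-diff : ∀ {a b} → 0ℚ ≤ b - a → a ≤ b
≤-diff {a} {b} h = ℚ.≤-trans (ℚ.≤-reflexive (sym (ℚ.+-identityˡ a)))
  (ℚ.≤-trans (ℚ.+-monoˡ-≤ a h)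
    (ℚ.≤-reflexive (solve 2 (λ a b → (b :- a) :+ a := b) refl a b)))

diff-≥0 : ∀ {a b} → a ≤ b → 0ℚ ≤ b - a
diff-≥0 {a} {b} h = ℚ.≤-trans (ℚ.≤-reflexive (sym (ℚ.+-inverseʳ a))) (ℚ.+-monoˡ-≤ (- a) h)

0≤+ : ∀ {a b} → 0ℚ ≤ a → 0ℚ ≤ b → 0ℚ ≤ a + b
0≤+ = ℚ.+-mono-≤

*-monoˡ : ∀ {a b c} → 0ℚ ≤ c → a ≤ b → c * a ≤ c * b
*-monoˡ {c = c} h = ℚ.*-monoˡ-≤-nonNeg c {{ℚ.nonNegative h}}

*-monoʳ : ∀ {a b c} → 0ℚ ≤ c → a ≤ b → a * c ≤ b * c
*-monoʳ {c = c} h = ℚ.*-monoʳ-≤-nonNeg c {{ℚ.nonNegative h}}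

0≤* : ∀ {a b} → 0ℚ ≤ a → 0ℚ ≤ b → 0ℚ ≤ a * b
0≤* {a} h k = ℚ.≤-trans (ℚ.≤-reflexive (sym (ℚ.*-zeroʳ a))) (*-monoˡ h k)

*-mono : ∀ {a b c d} → 0ℚ ≤ c → 0ℚ ≤ b → a ≤ b → c ≤ d → a * c ≤ b * d
*-mono hc hb p q = ℚ.≤-trans (*-monoʳ hc p) (*-monoˡ hb q)

1/suc-nonNeg : ∀ n → 0ℚ ≤ 1/suc n
1/suc-nonNeg n = ℚ.nonNegative⁻¹ (1/suc n) {{ℚ.normalize-nonNeg 1 (suc n)}}

x≤∣x∣ : ∀ x → x ≤ ∣ x ∣
x≤∣x∣ x with ℚ.≤-total 0ℚ x
... | inj₁ h = ℚ.≤-reflexive (sym (ℚ.0≤p⇒∣p∣≡p h))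
... | inj₂ h = ℚ.≤-trans h (ℚ.0≤∣p∣ x)

∣-∣-swap : ∀ x y → ∣ x - y ∣ ≡ ∣ y - x ∣
∣-∣-swap x y = trans (sym (ℚ.∣-p∣≡∣p∣ (x - y)))
  (cong ∣_∣ (solve 2 (λ x y → :- (x :- y) := y :- x) refl x y))

∣-∣-tri : ∀ x y z → ∣ x - z ∣ ≤ ∣ x - y ∣ + ∣ y - z ∣
∣-∣-tri x y z = ℚ.≤-trans
  (ℚ.≤-reflexive (cong ∣_∣ (solve 3 (λ x y z → x :- z := (x :- y) :+ (y :- z)) refl x y z)))
  (ℚ.∣p+q∣≤∣p∣+∣q∣ (x - y) (y - z))

½-+ : ∀ ε → ½ * ε + ½ * ε ≡ ε
½-+ ε = trans (sym (ℚ.*-distribʳ-+ ε ½ ½)) (ℚ.*-identityˡ ε)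

0<½* : ∀ {ε} → 0ℚ < ε → 0ℚ < ½ * ε
0<½* {ε} h = ℚ.positive⁻¹ (½ * ε) {{ℚ.pos*pos⇒pos ½ ε {{ℚ.positive h}}}}

null-dom : ∀ {f g} → Null g → (M : ℕ) →
  (∀ m n → M ℕ.≤ m → M ℕ.≤ n → ∣ f m n ∣ ≤ g m n) → Null f
null-dom {f} {g} ng M h ε ε>0 with ng ε ε>0
... | N , b = M ℕ.+ N , λ m n p q →
  ℚ.≤-trans (h m n (ℕ.m+n≤o⇒m≤o M p) (ℕ.m+n≤o⇒m≤o M q))
    (ℚ.≤-trans (x≤∣x∣ (g m n)) (b m n (ℕ.m+n≤o⇒n≤o M p) (ℕ.m+n≤o⇒n≤o M q)))

null-+ : ∀ {f g} → Null f → Null g → Null (λ m n → f m n + g m n)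
null-+ {f} {g} nf ng ε ε>0 with nf (½ * ε) (0<½* ε>0) | ng (½ * ε) (0<½* ε>0)
... | M , a | N , b = M ℕ.+ N , λ m n p q →
  ℚ.≤-trans (ℚ.∣p+q∣≤∣p∣+∣q∣ (f m n) (g m n))
    (ℚ.≤-trans (ℚ.+-mono-≤ (a m n (ℕ.m+n≤o⇒m≤o M p) (ℕ.m+n≤o⇒m≤o M q))
                           (b m n (ℕ.m+n≤o⇒n≤o M p) (ℕ.m+n≤o⇒n≤o M q)))
      (ℚ.≤-reflexive (½-+ ε)))

null-∣∣ : ∀ {f} → Null f → Null (λ m n → ∣ f m n ∣)
null-∣∣ {f} nf ε ε>0 with nf ε ε>0
... | N , b = N , λ m n p q → ℚ.≤-trans (ℚ.≤-reflexive (ℚ.∣∣p∣∣≡∣p∣ (f m n))) (b m n p q)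

null-scale : ∀ C {f} → Null f → Null (λ m n → C * f m n)
null-scale C {f} nf ε ε>0 = N , λ m n p q →
    ℚ.≤-trans (ℚ.≤-reflexive (ℚ.∣p*q∣≡∣p∣*∣q∣ C (f m n)))
      (ℚ.≤-trans (*-mono (ℚ.0≤∣p∣ (f m n)) (ℚ.<⇒≤ D>0) C≤D (b m n p q))
        (ℚ.≤-reflexive (trans (sym (ℚ.*-assoc D (ℚ.1/ D) ε))
          (trans (cong (_* ε) (ℚ.*-inverseʳ D)) (ℚ.*-identityˡ ε)))))
  where
  D : ℚ
  D = 1ℚ + ∣ C ∣
  D>0 : 0ℚ < D
  D>0 = ℚ.+-mono-<-≤ {0ℚ} {1ℚ} {0ℚ} {∣ C ∣} (ℚ.positive⁻¹ 1ℚ) (ℚ.0≤∣p∣ C)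
  C≤D : ∣ C ∣ ≤ D
  C≤D = ≤-diff (ℚ.≤-trans (ℚ.<⇒≤ (ℚ.positive⁻¹ 1ℚ))
    (ℚ.≤-reflexive (solve 2 (λ o c → o := (o :+ c) :- c) refl 1ℚ ∣ C ∣)))
  instance
    D⁺ : ℚ.Positive D
    D⁺ = ℚ.positive D>0
    D≢0 : ℚ.NonZero D
    D≢0 = ℚ.pos⇒nonZero D
  ε′>0 : 0ℚ < ℚ.1/ D * ε
  ε′>0 = ℚ.positive⁻¹ (ℚ.1/ D * ε)
    {{ℚ.pos*pos⇒pos (ℚ.1/ D) {{ℚ.1/pos⇒pos D}} ε {{ℚ.positive ε>0}}}}
  N : ℕ
  N = proj₁ (nf (ℚ.1/ D * ε) ε′>0)
  b : ∀ m n → N ℕ.≤ m → N ℕ.≤ n → ∣ f m n ∣ ≤ ℚ.1/ D * ε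
  b = proj₂ (nf (ℚ.1/ D * ε) ε′>0)

1/suc-small : ∀ ε → 0ℚ < ε → ∃[ N ] ∀ n → N ℕ.≤ n → 1/suc n ≤ ε
1/suc-small (mkℚ (+ zero) d c) (ℚ.*<* h) = contra h
  where
  contra : ∀ {A : Set} → (+ 0 ℤ.* + suc d) ℤ.< (+ 0 ℤ.* + 1) → A
  contra (ℤ.+<+ ())
1/suc-small (mkℚ ℤ.-[1+ a ] d c) (ℚ.*<* ())
1/suc-small ε@(mkℚ (+ suc a) d c) _ = d , λ n d≤n →
  ℚ.toℚᵘ-cancel-≤ (ℚᵘ.≤-respˡ-≃ (ℚᵘ.≃-sym (ℚ.toℚᵘ-fromℚᵘ (ℚᵘ.mkℚᵘ (+ 1) n)))
    (ℚᵘ.*≤* (ℤ.+≤+ (ℕ.≤-trans (ℕ.≤-reflexive (ℕ.*-identityˡ (suc d)))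
      (ℕ.≤-trans (ℕ.s≤s d≤n) (ℕ.m≤m+n (suc n) (a ℕ.* suc n)))))))

null-1/ˡ : Null (λ m _ → 1/suc m)
null-1/ˡ ε ε>0 with 1/suc-small ε ε>0
... | N , b = N , λ m n p q →
  ℚ.≤-trans (ℚ.≤-reflexive (ℚ.0≤p⇒∣p∣≡p (1/suc-nonNeg m))) (b m p)

null-swap : ∀ {f} → Null f → Null (λ m n → f n m)
null-swap nf ε ε>0 with nf ε ε>0
... | N , b = N , λ m n p q → b n m q p

eventually-bounded : (x : ℝ) → ∃[ B ] ∃[ N ] (0ℚ ≤ B) × (∀ n → N ℕ.≤ n → ∣ seq x n ∣ ≤ B)
eventually-bounded x with cauchy x 1ℚ (ℚ.positive⁻¹ 1ℚ)
... | N , b = 1ℚ + ∣ seq x N ∣ , N , 0≤+ {1ℚ} (ℚ.nonNegative⁻¹ 1ℚ) (ℚ.0≤∣p∣ (seq x N)) , λ n p →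
  ℚ.≤-trans (ℚ.≤-reflexive (cong ∣_∣
      (solve 2 (λ a c → a := (a :- c) :+ c) refl (seq x n) (seq x N))))
    (ℚ.≤-trans (ℚ.∣p+q∣≤∣p∣+∣q∣ (seq x n - seq x N) (seq x N))
      (ℚ.+-monoˡ-≤ ∣ seq x N ∣ (b n N p ℕ.≤-refl)))

infixl 6 _+ᴿ_ _-ᴿ_
infixl 7 _*ᴿ_
infix  8 -ᴿ_
infix  4 _≤ᴿ_ _≃ᴿ_

fromℚ : ℚ → ℝ
fromℚ q = record
  { seq    = λ _ → q
  ; cauchy = λ ε ε>0 → 0 , λ _ _ _ _ →
      ℚ.≤-trans (ℚ.≤-reflexive (cong ∣_∣ (ℚ.+-inverseʳ q))) (ℚ.<⇒≤ ε>0)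
  }

fromℕ : ℕ → ℝ
fromℕ n = fromℚ (+ n / 1)

_+ᴿ_ : ℝ → ℝ → ℝ
x +ᴿ y = record
  { seq    = λ n → seq x n + seq y n
  ; cauchy = null-dom (null-+ (null-∣∣ (cauchy x)) (null-∣∣ (cauchy y))) 0 λ m n _ _ →
      ℚ.≤-trans (ℚ.≤-reflexive (cong ∣_∣ (solve 4
          (λ a b c d → (a :+ b) :- (c :+ d) := (a :- c) :+ (b :- d)) refl
          (seq x m) (seq y m) (seq x n) (seq y n))))
        (ℚ.∣p+q∣≤∣p∣+∣q∣ (seq x m - seq x n) (seq y m - seq y n))
  }

-ᴿ_ : ℝ → ℝ
-ᴿ x = record
  { seq    = λ n → - seq x n
  ; cauchy = null-dom (null-∣∣ (null-swap (cauchy x))) 0 λ m n _ _ →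
      ℚ.≤-reflexive (cong ∣_∣ (solve 2 (λ a b → :- a :- :- b := b :- a) refl (seq x m) (seq x n)))
  }

_-ᴿ_ : ℝ → ℝ → ℝ
x -ᴿ y = x +ᴿ (-ᴿ y)

*-cauchy : (x y : ℝ) → Null (λ m n → seq x m * seq y m - seq x n * seq y n)
*-cauchy x y = bounds (eventually-bounded x) (eventually-bounded y)
  where
  bounds : ∃[ B ] ∃[ N ] (0ℚ ≤ B) × (∀ n → N ℕ.≤ n → ∣ seq x n ∣ ≤ B) →
           ∃[ B ] ∃[ N ] (0ℚ ≤ B) × (∀ n → N ℕ.≤ n → ∣ seq y n ∣ ≤ B) →
           Null (λ m n → seq x m * seq y m - seq x n * seq y n)
  bounds (B , M , _ , b) (C , N , _ , c) = null-dom
    {g = λ m n → B * ∣ seq y m - seq y n ∣ + C * ∣ seq x m - seq x n ∣}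
    (null-+ (null-scale B (null-∣∣ (cauchy y))) (null-scale C (null-∣∣ (cauchy x))))
    (M ℕ.+ N) step
    where
    step : ∀ m n → M ℕ.+ N ℕ.≤ m → M ℕ.+ N ℕ.≤ n →
      ∣ seq x m * seq y m - seq x n * seq y n ∣
        ≤ B * ∣ seq y m - seq y n ∣ + C * ∣ seq x m - seq x n ∣
    step m n p q = begin
      ∣ x₁ * y₁ - x₂ * y₂ ∣
        ≡⟨ cong ∣_∣ (solve 4 (λ a b c d → a :* b :- c :* d := a :* (b :- d) :+ d :* (a :- c))
             refl x₁ y₁ x₂ y₂) ⟩
      ∣ x₁ * (y₁ - y₂) + y₂ * (x₁ - x₂) ∣
        ≤⟨ ℚ.∣p+q∣≤∣p∣+∣q∣ (x₁ * (y₁ - y₂)) (y₂ * (x₁ - x₂)) ⟩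
      ∣ x₁ * (y₁ - y₂) ∣ + ∣ y₂ * (x₁ - x₂) ∣
        ≡⟨ cong₂ _+_ (ℚ.∣p*q∣≡∣p∣*∣q∣ x₁ (y₁ - y₂)) (ℚ.∣p*q∣≡∣p∣*∣q∣ y₂ (x₁ - x₂)) ⟩
      ∣ x₁ ∣ * ∣ y₁ - y₂ ∣ + ∣ y₂ ∣ * ∣ x₁ - x₂ ∣
        ≤⟨ ℚ.+-mono-≤ (*-monoʳ (ℚ.0≤∣p∣ (y₁ - y₂)) (b m (ℕ.m+n≤o⇒m≤o M p)))
                      (*-monoʳ (ℚ.0≤∣p∣ (x₁ - x₂)) (c n (ℕ.m+n≤o⇒n≤o M q))) ⟩
      B * ∣ y₁ - y₂ ∣ + C * ∣ x₁ - x₂ ∣ ∎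
      where
      open ℚ.≤-Reasoning
      x₁ x₂ y₁ y₂ : ℚ
      x₁ = seq x m
      x₂ = seq x n
      y₁ = seq y m
      y₂ = seq y n

_*ᴿ_ : ℝ → ℝ → ℝ
x *ᴿ y = record { seq = λ n → seq x n * seq y n ; cauchy = *-cauchy x y }

_≤ᴿ_ : ℝ → ℝ → Set
x ≤ᴿ y = ∀ ε → 0ℚ < ε → ∃[ N ] ∀ n → N ℕ.≤ n → seq x n ≤ seq y n + ε

_≃ᴿ_ : ℝ → ℝ → Set
x ≃ᴿ y = (x ≤ᴿ y) × (y ≤ᴿ x)

-- term x k = xᵏ / k!
term : ℚ → ℕ → ℚ
term x zero    = 1ℚ
term x (suc k) = term x k * (x * 1/suc k)

-- series c x k = Σ_{j ≤ k} c j · xʲ / j!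
series : (ℕ → ℚ) → ℚ → ℕ → ℚ
series c x zero    = c 0 * term x 0
series c x (suc k) = series c x k + c (suc k) * term x (suc k)

ℕ→ℚ : ℕ → ℚ
ℕ→ℚ n = + n / 1

/-toℚᵘ : ∀ i d → ℚ.toℚᵘ (i / suc d) ℚᵘ.≃ ℚᵘ.mkℚᵘ i d
/-toℚᵘ i d = ℚ.toℚᵘ-fromℚᵘ (ℚᵘ.mkℚᵘ i d)

suc*1/suc : ∀ k → ℕ→ℚ (suc k) * 1/suc k ≡ 1ℚ
suc*1/suc k = ℚ.toℚᵘ-injective (ℚᵘ.≃-trans (ℚ.toℚᵘ-homo-* (ℕ→ℚ (suc k)) (1/suc k))
  (ℚᵘ.≃-trans (ℚᵘ.*-cong (/-toℚᵘ (+ suc k) 0) (/-toℚᵘ (+ 1) k))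
    (ℚᵘ.*≡* (cong +_ (trans (ℕ.*-identityʳ _) (trans (ℕ.*-identityʳ _)
      (sym (trans (ℕ.*-identityˡ _) (ℕ.*-identityˡ (suc k))))))))))

ℕ→ℚ-suc : ∀ k → ℕ→ℚ (suc k) ≡ 1ℚ + ℕ→ℚ k
ℕ→ℚ-suc k = ℚ.toℚᵘ-injective (ℚᵘ.≃-sym (ℚᵘ.≃-trans (ℚ.toℚᵘ-homo-+ 1ℚ (ℕ→ℚ k))
  (ℚᵘ.≃-trans (ℚᵘ.+-congʳ ℚᵘ.1ℚᵘ (/-toℚᵘ (+ k) 0))
    (ℚᵘ.≃-trans (ℚᵘ.*≡* (cong (ℤ._* + 1) (cong (λ z → + 1 ℤ.+ z) (ℤ.*-identityʳ (+ k)))))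
      (ℚᵘ.≃-sym (/-toℚᵘ (+ suc k) 0))))))

ℕ→ℚ-nonNeg : ∀ n → 0ℚ ≤ ℕ→ℚ n
ℕ→ℚ-nonNeg n = ℚ.nonNegative⁻¹ (ℕ→ℚ n) {{ℚ.normalize-nonNeg n 1}}

≤-+ʳ : ∀ {a b} → 0ℚ ≤ b → a ≤ a + b
≤-+ʳ {a} {b} h = ℚ.≤-trans (ℚ.≤-reflexive (sym (ℚ.+-identityʳ a))) (ℚ.+-monoʳ-≤ a h)

≤-+ˡ : ∀ {a b} → 0ℚ ≤ a → b ≤ a + b
≤-+ˡ {a} {b} h = ℚ.≤-trans (ℚ.≤-reflexive (sym (ℚ.+-identityˡ b))) (ℚ.+-monoˡ-≤ b h)

-- Estimates on ∣ x ∣ ≤ B, where T k = Σ_{j ≤ k} Bʲ/j! majorises every series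
-- with coefficients of modulus at most 1.  From N₀ on, the terms of T at least
-- halve, so U is antitone there and T ≤ C.
module Bound (B : ℚ) (B≥0 : 0ℚ ≤ B) where
  open ℚ.≤-Reasoning

  t T U : ℕ → ℚ
  t = term B
  T zero    = t 0
  T (suc k) = T k + t (suc k)
  U k = T k + t k

  t≥0 : ∀ k → 0ℚ ≤ t k
  t≥0 zero    = ℚ.nonNegative⁻¹ 1ℚ
  t≥0 (suc k) = 0≤* (t≥0 k) (0≤* B≥0 (1/suc-nonNeg k))

  T-mono : ∀ j k → T k ≤ T (j ℕ.+ k)
  T-mono zero    k = ℚ.≤-refl
  T-mono (suc j) k = ℚ.≤-trans (T-mono j k) (≤-+ʳ (t≥0 (suc (j ℕ.+ k))))

  term-bound : ∀ {x} → ∣ x ∣ ≤ B → ∀ k → ∣ term x k ∣ ≤ t k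
  term-bound {x} h zero    = ℚ.≤-refl
  term-bound {x} h (suc k) = begin
    ∣ term x k * (x * 1/suc k) ∣     ≡⟨ ℚ.∣p*q∣≡∣p∣*∣q∣ (term x k) (x * 1/suc k) ⟩
    ∣ term x k ∣ * ∣ x * 1/suc k ∣   ≡⟨ cong (∣ term x k ∣ *_) (ℚ.∣p*q∣≡∣p∣*∣q∣ x (1/suc k)) ⟩
    ∣ term x k ∣ * (∣ x ∣ * ∣ 1/suc k ∣)
      ≡⟨ cong (λ i → ∣ term x k ∣ * (∣ x ∣ * i)) (ℚ.0≤p⇒∣p∣≡p (1/suc-nonNeg k)) ⟩
    ∣ term x k ∣ * (∣ x ∣ * 1/suc k)
      ≤⟨ *-mono (0≤* (ℚ.0≤∣p∣ x) (1/suc-nonNeg k)) (t≥0 k)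
           (term-bound h k) (*-monoʳ (1/suc-nonNeg k) h) ⟩
    t k * (B * 1/suc k)              ∎

  t-shift : ∀ k → t k * B ≡ t (suc k) * ℕ→ℚ (suc k)
  t-shift k = sym (begin-equality
    t k * (B * 1/suc k) * ℕ→ℚ (suc k)
      ≡⟨ solve 4 (λ a b i n → a :* (b :* i) :* n := a :* b :* (n :* i))
           refl (t k) B (1/suc k) (ℕ→ℚ (suc k)) ⟩
    t k * B * (ℕ→ℚ (suc k) * 1/suc k)   ≡⟨ cong (t k * B *_) (suc*1/suc k) ⟩
    t k * B * 1ℚ                        ≡⟨ ℚ.*-identityʳ (t k * B) ⟩
    t k * B                             ∎)

  term-lip : ∀ {x y} → ∣ x ∣ ≤ B → ∣ y ∣ ≤ B → ∀ k →
    ∣ term x (suc k) - term y (suc k) ∣ ≤ t k * ∣ x - y ∣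
  term-lip {x} {y} hx hy zero = ℚ.≤-reflexive (begin-equality
    ∣ 1ℚ * (x * 1/suc 0) - 1ℚ * (y * 1/suc 0) ∣
      ≡⟨ cong ∣_∣ (cong₂ _-_ (trans (ℚ.*-identityˡ _) (ℚ.*-identityʳ x))
                            (trans (ℚ.*-identityˡ _) (ℚ.*-identityʳ y))) ⟩
    ∣ x - y ∣         ≡⟨ ℚ.*-identityˡ ∣ x - y ∣ ⟨
    1ℚ * ∣ x - y ∣    ∎)
  term-lip {x} {y} hx hy (suc k) = begin
    ∣ u * (x * i) - v * (y * i) ∣
      ≡⟨ cong ∣_∣ (solve 5 (λ u v x y i →
           u :* (x :* i) :- v :* (y :* i) := i :* (u :* (x :- y) :+ (u :- v) :* y))
           refl u v x y i) ⟩
    ∣ i * (u * (x - y) + (u - v) * y) ∣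
      ≡⟨ ℚ.∣p*q∣≡∣p∣*∣q∣ i (u * (x - y) + (u - v) * y) ⟩
    ∣ i ∣ * ∣ u * (x - y) + (u - v) * y ∣
      ≡⟨ cong (_* ∣ u * (x - y) + (u - v) * y ∣) (ℚ.0≤p⇒∣p∣≡p i≥0) ⟩
    i * ∣ u * (x - y) + (u - v) * y ∣
      ≤⟨ *-monoˡ i≥0 (ℚ.∣p+q∣≤∣p∣+∣q∣ (u * (x - y)) ((u - v) * y)) ⟩
    i * (∣ u * (x - y) ∣ + ∣ (u - v) * y ∣)
      ≡⟨ cong (i *_) (cong₂ _+_ (ℚ.∣p*q∣≡∣p∣*∣q∣ u (x - y)) (ℚ.∣p*q∣≡∣p∣*∣q∣ (u - v) y)) ⟩
    i * (∣ u ∣ * δ + ∣ u - v ∣ * ∣ y ∣)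
      ≤⟨ *-monoˡ i≥0 (ℚ.+-mono-≤ (*-monoʳ δ≥0 (term-bound hx (suc k)))
           (*-mono (ℚ.0≤∣p∣ y) (0≤* (t≥0 k) δ≥0) (term-lip hx hy k) hy)) ⟩
    i * (t (suc k) * δ + t k * δ * B)
      ≡⟨ solve 5 (λ i s d a b → i :* (s :* d :+ a :* d :* b) := i :* ((s :+ a :* b) :* d))
           refl i (t (suc k)) δ (t k) B ⟩
    i * ((t (suc k) + t k * B) * δ)
      ≡⟨ cong (λ z → i * ((t (suc k) + z) * δ)) (t-shift k) ⟩
    i * ((t (suc k) + t (suc k) * n) * δ)
      ≡⟨ cong (λ z → i * ((z + t (suc k) * n) * δ)) (sym (ℚ.*-identityʳ (t (suc k)))) ⟩
    i * ((t (suc k) * 1ℚ + t (suc k) * n) * δ)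
      ≡⟨ solve 5 (λ i s o n d → i :* ((s :* o :+ s :* n) :* d) := (o :+ n) :* i :* (s :* d))
           refl i (t (suc k)) 1ℚ n δ ⟩
    (1ℚ + n) * i * (t (suc k) * δ)
      ≡⟨ cong (λ z → z * i * (t (suc k) * δ)) (sym (ℕ→ℚ-suc (suc k))) ⟩
    ℕ→ℚ (suc (suc k)) * i * (t (suc k) * δ)
      ≡⟨ cong (_* (t (suc k) * δ)) (suc*1/suc (suc k)) ⟩
    1ℚ * (t (suc k) * δ)   ≡⟨ ℚ.*-identityˡ (t (suc k) * δ) ⟩
    t (suc k) * δ          ∎
    where
    u v i n δ : ℚ
    u = term x (suc k)
    v = term y (suc k)
    i = 1/suc (suc k)
    n = ℕ→ℚ (suc k)
    δ = ∣ x - y ∣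
    i≥0 : 0ℚ ≤ i
    i≥0 = 1/suc-nonNeg (suc k)
    δ≥0 : 0ℚ ≤ δ
    δ≥0 = ℚ.0≤∣p∣ (x - y)

  small-null : Null (λ m _ → B * 1/suc m)
  small-null = null-scale B null-1/ˡ

  small : ∃[ N ] ∀ k → N ℕ.≤ k → B * 1/suc k ≤ ½
  small = go (small-null ½ (ℚ.positive⁻¹ ½))
    where
    go : ∃[ N ] (∀ m n → N ℕ.≤ m → N ℕ.≤ n → ∣ B * 1/suc m ∣ ≤ ½) →
         ∃[ N ] ∀ k → N ℕ.≤ k → B * 1/suc k ≤ ½
    go (N , h) = N , λ k p → ℚ.≤-trans (x≤∣x∣ (B * 1/suc k)) (h k k p p)

  N₀ : ℕ
  N₀ = proj₁ small

  t-half : ∀ k → N₀ ℕ.≤ k → t (suc k) + t (suc k) ≤ t k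
  t-half k p = begin
    t (suc k) + t (suc k)   ≤⟨ ℚ.+-mono-≤ h h ⟩
    ½ * t k + ½ * t k       ≡⟨ ½-+ (t k) ⟩
    t k                     ∎
    where
    h : t (suc k) ≤ ½ * t k
    h = ℚ.≤-trans (*-monoˡ (t≥0 k) (proj₂ small k p)) (ℚ.≤-reflexive (ℚ.*-comm (t k) ½))

  t≤t₀ : ∀ j → t (j ℕ.+ N₀) ≤ t N₀
  t≤t₀ zero    = ℚ.≤-refl
  t≤t₀ (suc j) = ℚ.≤-trans (≤-+ʳ (t≥0 (suc (j ℕ.+ N₀))))
    (ℚ.≤-trans (t-half (j ℕ.+ N₀) (ℕ.m≤n+m N₀ j)) (t≤t₀ j))

  U-anti : ∀ j k → N₀ ℕ.≤ k → U (j ℕ.+ k) ≤ U k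
  U-anti zero    k p = ℚ.≤-refl
  U-anti (suc j) k p = begin
    T m + t (suc m) + t (suc m)     ≡⟨ ℚ.+-assoc (T m) (t (suc m)) (t (suc m)) ⟩
    T m + (t (suc m) + t (suc m))   ≤⟨ ℚ.+-monoʳ-≤ (T m) (t-half m (ℕ.≤-trans p (ℕ.m≤n+m k j))) ⟩
    T m + t m                       ≤⟨ U-anti j k p ⟩
    U k                             ∎
    where
    m : ℕ
    m = j ℕ.+ k

  C : ℚ
  C = U N₀

  T≤C : ∀ k → T k ≤ C
  T≤C k = begin
    T k                       ≤⟨ T-mono N₀ k ⟩
    T (N₀ ℕ.+ k)              ≡⟨ cong T (ℕ.+-comm N₀ k) ⟩
    T (k ℕ.+ N₀)              ≤⟨ ≤-+ʳ (t≥0 (k ℕ.+ N₀)) ⟩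
    U (k ℕ.+ N₀)              ≤⟨ U-anti k N₀ ℕ.≤-refl ⟩
    C                         ∎

  C≥0 : 0ℚ ≤ C
  C≥0 = ℚ.≤-trans (t≥0 0) (T≤C 0)

  T-diff : ∀ j k → N₀ ℕ.≤ k → ∣ T (j ℕ.+ k) - T k ∣ ≤ t k
  T-diff j k p = begin
    ∣ T (j ℕ.+ k) - T k ∣  ≡⟨ ℚ.0≤p⇒∣p∣≡p (diff-≥0 (T-mono j k)) ⟩
    T (j ℕ.+ k) - T k      ≤⟨ ℚ.+-monoˡ-≤ (- T k)
                                (ℚ.≤-trans (≤-+ʳ {T (j ℕ.+ k)} (t≥0 (j ℕ.+ k))) (U-anti j k p)) ⟩
    T k + t k - T k        ≡⟨ solve 2 (λ a b → a :+ b :- a := b) refl (T k) (t k) ⟩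
    t k                    ∎

  t-suc : ∀ k → N₀ ℕ.≤ k → t (suc k) ≤ t N₀ * B * 1/suc k
  t-suc k p = begin
    t k * (B * 1/suc k)    ≤⟨ *-monoʳ (0≤* B≥0 (1/suc-nonNeg k)) t≤ ⟩
    t N₀ * (B * 1/suc k)   ≡⟨ ℚ.*-assoc (t N₀) B (1/suc k) ⟨
    t N₀ * B * 1/suc k     ∎
    where
    t≤ : t k ≤ t N₀
    t≤ = subst (λ m → t m ≤ t N₀) (ℕ.m∸n+n≡m p) (t≤t₀ (k ℕ.∸ N₀))

  T-null : Null (λ m n → T (suc m) - T (suc n))
  T-null = null-dom {g = λ m n → t N₀ * B * 1/suc m + t N₀ * B * 1/suc n}
      (null-+ (null-scale (t N₀ * B) null-1/ˡ) (null-scale (t N₀ * B) (null-swap null-1/ˡ)))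
      N₀ bound
    where
    E≥0 : ∀ k → 0ℚ ≤ t N₀ * B * 1/suc k
    E≥0 k = 0≤* (0≤* (t≥0 N₀) B≥0) (1/suc-nonNeg k)
    ordered : ∀ m n → n ℕ.≤ m → N₀ ℕ.≤ n → ∣ T (suc m) - T (suc n) ∣ ≤ t N₀ * B * 1/suc n
    ordered m n q p = ℚ.≤-trans
      (subst (λ k → ∣ T k - T (suc n) ∣ ≤ t (suc n)) (ℕ.m∸n+n≡m (ℕ.s≤s q))
        (T-diff (suc m ℕ.∸ suc n) (suc n) (ℕ.m≤n⇒m≤1+n p)))
      (t-suc n p)
    bound : ∀ m n → N₀ ℕ.≤ m → N₀ ℕ.≤ n →
      ∣ T (suc m) - T (suc n) ∣ ≤ t N₀ * B * 1/suc m + t N₀ * B * 1/suc n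
    bound m n p q = [ above , below ]′ (ℕ.≤-total n m)
      where
      above : n ℕ.≤ m → ∣ T (suc m) - T (suc n) ∣ ≤ t N₀ * B * 1/suc m + t N₀ * B * 1/suc n
      above n≤m = ℚ.≤-trans (ordered m n n≤m q) (≤-+ˡ (E≥0 m))
      below : m ℕ.≤ n → ∣ T (suc m) - T (suc n) ∣ ≤ t N₀ * B * 1/suc m + t N₀ * B * 1/suc n
      below m≤n = ℚ.≤-trans (ℚ.≤-reflexive (∣-∣-swap (T (suc m)) (T (suc n))))
        (ℚ.≤-trans (ordered n m m≤n p) (≤-+ʳ (E≥0 n)))

  module Coeffs (c : ℕ → ℚ) (c≤1 : ∀ k → ∣ c k ∣ ≤ 1ℚ) where

    c*≤ : ∀ k z → ∣ c k * z ∣ ≤ ∣ z ∣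
    c*≤ k z = begin
      ∣ c k * z ∣         ≡⟨ ℚ.∣p*q∣≡∣p∣*∣q∣ (c k) z ⟩
      ∣ c k ∣ * ∣ z ∣     ≤⟨ *-monoʳ (ℚ.0≤∣p∣ z) (c≤1 k) ⟩
      1ℚ * ∣ z ∣          ≡⟨ ℚ.*-identityˡ ∣ z ∣ ⟩
      ∣ z ∣               ∎

    series-tail : ∀ {x} → ∣ x ∣ ≤ B → ∀ j k →
      ∣ series c x (j ℕ.+ k) - series c x k ∣ ≤ T (j ℕ.+ k) - T k
    series-tail {x} h zero k = ℚ.≤-reflexive
      (trans (cong ∣_∣ (ℚ.+-inverseʳ (series c x k))) (sym (ℚ.+-inverseʳ (T k))))
    series-tail {x} h (suc j) k = begin
      ∣ S + e - S₀ ∣         ≡⟨ cong ∣_∣ (solve 3 (λ s e z → s :+ e :- z := s :- z :+ e) refl S e S₀) ⟩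
      ∣ S - S₀ + e ∣         ≤⟨ ℚ.∣p+q∣≤∣p∣+∣q∣ (S - S₀) e ⟩
      ∣ S - S₀ ∣ + ∣ e ∣     ≤⟨ ℚ.+-mono-≤ (series-tail h j k)
                                  (ℚ.≤-trans (c*≤ (suc m) (term x (suc m))) (term-bound h (suc m))) ⟩
      T m - T k + t (suc m)  ≡⟨ solve 3 (λ s e z → s :- z :+ e := s :+ e :- z)
                                  refl (T m) (t (suc m)) (T k) ⟩
      T m + t (suc m) - T k  ∎
      where
      m : ℕ
      m = j ℕ.+ k
      S S₀ e : ℚ
      S = series c x m
      S₀ = series c x k
      e = c (suc m) * term x (suc m)

    series-diff : ∀ {x} → ∣ x ∣ ≤ B → ∀ m n →
      ∣ series c x m - series c x n ∣ ≤ ∣ T m - T n ∣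
    series-diff {x} h m n with ℕ.≤-total n m
    ... | inj₁ n≤m = ℚ.≤-trans
      (subst (λ k → ∣ series c x k - series c x n ∣ ≤ T k - T n) (ℕ.m∸n+n≡m n≤m)
        (series-tail h (m ℕ.∸ n) n))
      (x≤∣x∣ (T m - T n))
    ... | inj₂ m≤n = begin
      ∣ series c x m - series c x n ∣  ≡⟨ ∣-∣-swap (series c x m) (series c x n) ⟩
      ∣ series c x n - series c x m ∣
        ≤⟨ subst (λ k → ∣ series c x k - series c x m ∣ ≤ T k - T m) (ℕ.m∸n+n≡m m≤n)
             (series-tail h (n ℕ.∸ m) m) ⟩
      T n - T m                        ≤⟨ x≤∣x∣ (T n - T m) ⟩
      ∣ T n - T m ∣                    ≡⟨ ∣-∣-swap (T n) (T m) ⟩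
      ∣ T m - T n ∣                    ∎

    series-lip′ : ∀ {x y} → ∣ x ∣ ≤ B → ∣ y ∣ ≤ B → ∀ k →
      ∣ series c x (suc k) - series c y (suc k) ∣ ≤ T k * ∣ x - y ∣
    series-lip′ {x} {y} hx hy k = begin
      ∣ S + d * u - (S′ + d * v) ∣
        ≡⟨ cong ∣_∣ (solve 5 (λ s z d u v → s :+ d :* u :- (z :+ d :* v) := (s :- z) :+ d :* (u :- v))
             refl S S′ d u v) ⟩
      ∣ (S - S′) + d * (u - v) ∣        ≤⟨ ℚ.∣p+q∣≤∣p∣+∣q∣ (S - S′) (d * (u - v)) ⟩
      ∣ S - S′ ∣ + ∣ d * (u - v) ∣
        ≤⟨ ℚ.+-mono-≤ (rest k) (ℚ.≤-trans (c*≤ (suc k) (u - v)) (term-lip hx hy k)) ⟩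
      T⁻ k * ∣ x - y ∣ + t k * ∣ x - y ∣  ≡⟨ ℚ.*-distribʳ-+ ∣ x - y ∣ (T⁻ k) (t k) ⟨
      (T⁻ k + t k) * ∣ x - y ∣            ≡⟨ cong (_* ∣ x - y ∣) (T⁻-t k) ⟩
      T k * ∣ x - y ∣                   ∎
      where
      S S′ d u v : ℚ
      S = series c x k
      S′ = series c y k
      d = c (suc k)
      u = term x (suc k)
      v = term y (suc k)
      T⁻ : ℕ → ℚ
      T⁻ zero    = 0ℚ
      T⁻ (suc k) = T k
      T⁻-t : ∀ k → T⁻ k + t k ≡ T k
      T⁻-t zero    = refl
      T⁻-t (suc k) = refl
      rest : ∀ k → ∣ series c x k - series c y k ∣ ≤ T⁻ k * ∣ x - y ∣
      rest zero = ℚ.≤-reflexive (trans (cong ∣_∣ (ℚ.+-inverseʳ (c 0 * 1ℚ)))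
        (sym (ℚ.*-zeroˡ ∣ x - y ∣)))
      rest (suc k) = series-lip′ hx hy k

    series-lip : ∀ {x y} → ∣ x ∣ ≤ B → ∣ y ∣ ≤ B → ∀ k →
      ∣ series c x (suc k) - series c y (suc k) ∣ ≤ C * ∣ x - y ∣
    series-lip {x} {y} hx hy k =
      ℚ.≤-trans (series-lip′ hx hy k) (*-monoʳ (ℚ.0≤∣p∣ (x - y)) (T≤C k))

series-cauchy : (c : ℕ → ℚ) → (∀ k → ∣ c k ∣ ≤ 1ℚ) → (x : ℝ) →
  Null (λ m n → series c (seq x m) (suc m) - series c (seq x n) (suc n))
series-cauchy c c≤1 x = go (eventually-bounded x)
  where
  go : ∃[ B ] ∃[ N ] (0ℚ ≤ B) × (∀ n → N ℕ.≤ n → ∣ seq x n ∣ ≤ B) →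
       Null (λ m n → series c (seq x m) (suc m) - series c (seq x n) (suc n))
  go (B , N , B≥0 , b) = null-dom
      {g = λ m n → ∣ T (suc m) - T (suc n) ∣ + C * ∣ seq x m - seq x n ∣}
      (null-+ (null-∣∣ T-null) (null-scale C (null-∣∣ (cauchy x)))) N λ m n p q →
        ℚ.≤-trans (∣-∣-tri (series c (seq x m) (suc m)) (series c (seq x m) (suc n))
                           (series c (seq x n) (suc n)))
          (ℚ.+-mono-≤ (series-diff (b m p) (suc m) (suc n)) (series-lip (b m p) (b n q) n))
    where
    open Bound B B≥0
    open Coeffs c c≤1

-- x ↦ Σ_j c j · xʲ / j!, by the diagonal sequence of partial sums.  The partial
-- sum is taken one step further than the approximation of x so that the
-- degree 1 term is always present, which log relies on.
powerSeries : (c : ℕ → ℚ) → (∀ k → ∣ c k ∣ ≤ 1ℚ) → ℝ → ℝ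
powerSeries c c≤1 x = record
  { seq    = λ k → series c (seq x k) (suc k)
  ; cauchy = series-cauchy c c≤1 x
  }

-- 1, 0, -1, 0, 1, … and 0, 1, 0, -1, 0, …
cosCoeff sinCoeff : ℕ → ℚ
cosCoeff zero          = 1ℚ
cosCoeff (suc zero)    = 0ℚ
cosCoeff (suc (suc k)) = - cosCoeff k
sinCoeff zero    = 0ℚ
sinCoeff (suc k) = cosCoeff k

cosCoeff≤1 : ∀ k → ∣ cosCoeff k ∣ ≤ 1ℚ
cosCoeff≤1 zero          = ℚ.≤-refl
cosCoeff≤1 (suc zero)    = ℚ.nonNegative⁻¹ 1ℚ
cosCoeff≤1 (suc (suc k)) =
  ℚ.≤-trans (ℚ.≤-reflexive (ℚ.∣-p∣≡∣p∣ (cosCoeff k))) (cosCoeff≤1 k)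

sinCoeff≤1 : ∀ k → ∣ sinCoeff k ∣ ≤ 1ℚ
sinCoeff≤1 zero    = ℚ.nonNegative⁻¹ 1ℚ
sinCoeff≤1 (suc k) = cosCoeff≤1 k

expᴿ cosᴿ sinᴿ : ℝ → ℝ
expᴿ = powerSeries (λ _ → 1ℚ) (λ _ → ℚ.≤-refl)
cosᴿ = powerSeries cosCoeff cosCoeff≤1
sinᴿ = powerSeries sinCoeff sinCoeff≤1

grid-top : ∀ b k → ℕ→ℚ (b ℕ.* suc k) * 1/suc k ≡ ℕ→ℚ b
grid-top b k = ℚ.toℚᵘ-injective
  (ℚᵘ.≃-trans (ℚ.toℚᵘ-homo-* (ℕ→ℚ (b ℕ.* suc k)) (1/suc k))
    (ℚᵘ.≃-trans (ℚᵘ.*-cong (/-toℚᵘ (+ (b ℕ.* suc k)) 0) (/-toℚᵘ (+ 1) k))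
      (ℚᵘ.≃-trans (ℚᵘ.*≡* cross) (ℚᵘ.≃-sym (/-toℚᵘ (+ b) 0)))))
  where
  cross : + (b ℕ.* suc k) ℤ.* + 1 ℤ.* + 1 ≡ + b ℤ.* + (1 ℕ.* suc k)
  cross = trans (ℤ.*-identityʳ _) (trans (ℤ.*-identityʳ _)
    (trans (ℤ.pos-* b (suc k)) (cong (λ m → + b ℤ.* + m) (sym (ℕ.*-identityˡ (suc k))))))

-- Solves lim F k x = y for x in [0, b], given that each F k is Lipschitz and
-- expands distances: r k solves F k x = y up to C/(k+1), with r k a multiple
-- of 1/(k+1).
module Inverse
  (F : ℕ → ℚ → ℚ) (y C : ℚ) (b : ℕ) (C≥0 : 0ℚ ≤ C)
  (F[0]≤y : ∀ k → F k 0ℚ ≤ y)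
  (y≤F[b] : ∀ k → y ≤ F k (ℕ→ℚ b))
  (expand : ∀ k {u v} → 0ℚ ≤ u → u ≤ v → v - u ≤ F k v - F k u)
  (lip    : ∀ k {u v} → 0ℚ ≤ u → u ≤ v → v ≤ ℕ→ℚ b → F k v - F k u ≤ C * (v - u))
  (g : ℕ → ℕ → ℚ) (g-null : Null g)
  (unif   : ∀ j k {u} → 0ℚ ≤ u → u ≤ ℕ→ℚ b → ∣ F j u - F k u ∣ ≤ g j k)
  where
  open ℚ.≤-Reasoning

  Approx : ℕ → Set
  Approx k = ∃[ r ] (0ℚ ≤ r) × (r ≤ ℕ→ℚ b) × (∣ F k r - y ∣ ≤ C * 1/suc k)

  grid : ℕ → ℕ → ℚ
  grid k i = ℕ→ℚ i * 1/suc k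

  grid-suc : ∀ k i → grid k (suc i) ≡ 1/suc k + grid k i
  grid-suc k i = begin-equality
    ℕ→ℚ (suc i) * 1/suc k             ≡⟨ cong (_* 1/suc k) (ℕ→ℚ-suc i) ⟩
    (1ℚ + ℕ→ℚ i) * 1/suc k            ≡⟨ ℚ.*-distribʳ-+ (1/suc k) 1ℚ (ℕ→ℚ i) ⟩
    1ℚ * 1/suc k + ℕ→ℚ i * 1/suc k    ≡⟨ cong (_+ grid k i) (ℚ.*-identityˡ (1/suc k)) ⟩
    1/suc k + grid k i                ∎

  grid-mono : ∀ k i → grid k i ≤ grid k (suc i)
  grid-mono k i = ℚ.≤-trans (≤-+ˡ (1/suc-nonNeg k)) (ℚ.≤-reflexive (sym (grid-suc k i)))

  grid≥0 : ∀ k i → 0ℚ ≤ grid k i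
  grid≥0 k i = 0≤* (ℕ→ℚ-nonNeg i) (1/suc-nonNeg k)

  search : ∀ k i → grid k i ≤ ℕ→ℚ b → y ≤ F k (grid k i) → Approx k
  search k zero _ h = 0ℚ , ℚ.≤-refl , ℕ→ℚ-nonNeg b , ℚ.≤-trans
    (ℚ.≤-reflexive (trans (cong (λ z → ∣ z - y ∣) F≡y) (cong ∣_∣ (ℚ.+-inverseʳ y))))
    (0≤* C≥0 (1/suc-nonNeg k))
    where
    F≡y : F k 0ℚ ≡ y
    F≡y = ℚ.≤-antisym (F[0]≤y k) (subst (λ z → y ≤ F k z) (ℚ.*-zeroˡ (1/suc k)) h)
  search k (suc i) top h = decide (F k (grid k i) ℚ.≤? y)
    where
    step : grid k (suc i) - grid k i ≡ 1/suc k
    step = trans (cong (_- grid k i) (grid-suc k i))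
      (solve 2 (λ a b → a :+ b :- b := a) refl (1/suc k) (grid k i))
    decide : Dec (F k (grid k i) ≤ y) → Approx k
    decide (no ¬p) = search k i (ℚ.≤-trans (grid-mono k i) top) (ℚ.<⇒≤ (ℚ.≰⇒> ¬p))
    decide (yes p) = grid k i , grid≥0 k i , ℚ.≤-trans (grid-mono k i) top , (begin
      ∣ F k (grid k i) - y ∣                  ≡⟨ ∣-∣-swap (F k (grid k i)) y ⟩
      ∣ y - F k (grid k i) ∣                  ≡⟨ ℚ.0≤p⇒∣p∣≡p (diff-≥0 p) ⟩
      y - F k (grid k i)                      ≤⟨ ℚ.+-monoˡ-≤ (- F k (grid k i)) h ⟩
      F k (grid k (suc i)) - F k (grid k i)   ≤⟨ lip k (grid≥0 k i) (grid-mono k i) top ⟩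
      C * (grid k (suc i) - grid k i)         ≡⟨ cong (C *_) step ⟩
      C * 1/suc k                             ∎)

  approx : ∀ k → Approx k
  approx k = search k (b ℕ.* suc k) (ℚ.≤-reflexive (grid-top b k))
    (ℚ.≤-trans (y≤F[b] k) (ℚ.≤-reflexive (cong (F k) (sym (grid-top b k)))))

  r : ℕ → ℚ
  r k = proj₁ (approx k)

  r≥0 : ∀ k → 0ℚ ≤ r k
  r≥0 k = proj₁ (proj₂ (approx k))

  r≤b : ∀ k → r k ≤ ℕ→ℚ b
  r≤b k = proj₁ (proj₂ (proj₂ (approx k)))

  F-r : ∀ k → ∣ F k (r k) - y ∣ ≤ C * 1/suc k
  F-r k = proj₂ (proj₂ (proj₂ (approx k)))

  expand-∣∣ : ∀ k {u v} → 0ℚ ≤ u → 0ℚ ≤ v → ∣ u - v ∣ ≤ ∣ F k u - F k v ∣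
  expand-∣∣ k {u} {v} hu hv = [ below , above ]′ (ℚ.≤-total u v)
    where
    ordered : ∀ {u v} → 0ℚ ≤ u → u ≤ v → ∣ v - u ∣ ≤ ∣ F k v - F k u ∣
    ordered {u} {v} h p = ℚ.≤-trans (ℚ.≤-reflexive (ℚ.0≤p⇒∣p∣≡p (diff-≥0 p)))
      (ℚ.≤-trans (expand k h p) (x≤∣x∣ (F k v - F k u)))
    above : v ≤ u → ∣ u - v ∣ ≤ ∣ F k u - F k v ∣
    above p = ordered hv p
    below : u ≤ v → ∣ u - v ∣ ≤ ∣ F k u - F k v ∣
    below p = ℚ.≤-trans (ℚ.≤-reflexive (∣-∣-swap u v))
      (ℚ.≤-trans (ordered hu p) (ℚ.≤-reflexive (∣-∣-swap (F k v) (F k u))))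

  r-cauchy : Null (λ m n → r m - r n)
  r-cauchy = null-dom {g = λ m n → g n m + (C * 1/suc m + C * 1/suc n)}
    (null-+ (null-swap g-null)
      (null-+ (null-scale C null-1/ˡ) (null-scale C (null-swap null-1/ˡ))))
    0 λ m n _ _ → begin
      ∣ r m - r n ∣                           ≤⟨ expand-∣∣ n (r≥0 m) (r≥0 n) ⟩
      ∣ F n (r m) - F n (r n) ∣               ≤⟨ ∣-∣-tri (F n (r m)) (F m (r m)) (F n (r n)) ⟩
      ∣ F n (r m) - F m (r m) ∣ + ∣ F m (r m) - F n (r n) ∣
        ≤⟨ ℚ.+-mono-≤ (unif n m (r≥0 m) (r≤b m)) (∣-∣-tri (F m (r m)) y (F n (r n))) ⟩
      g n m + (∣ F m (r m) - y ∣ + ∣ y - F n (r n) ∣)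
        ≤⟨ ℚ.+-monoʳ-≤ (g n m) (ℚ.+-mono-≤ (F-r m)
             (ℚ.≤-trans (ℚ.≤-reflexive (∣-∣-swap y (F n (r n)))) (F-r n))) ⟩
      g n m + (C * 1/suc m + C * 1/suc n)     ∎

  root : ℝ
  root = record { seq = r ; cauchy = r-cauchy }

  F-null : Null (λ m _ → F m (r m) - y)
  F-null = null-dom {g = λ m _ → C * 1/suc m} (null-scale C null-1/ˡ) 0 λ m _ _ _ → F-r m

null⇒≃ : (x : ℝ) (y : ℚ) → Null (λ m _ → seq x m - y) → x ≃ᴿ fromℚ y
null⇒≃ x y h = le , ge
  where
  le : x ≤ᴿ fromℚ y
  le ε ε>0 = proj₁ (h ε ε>0) , λ n p → ≤-diff (ℚ.≤-trans
    (diff-≥0 (ℚ.≤-trans (x≤∣x∣ (seq x n - y)) (proj₂ (h ε ε>0) n n p p)))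
    (ℚ.≤-reflexive (solve 3 (λ e a b → e :- (a :- b) := b :+ e :- a) refl ε (seq x n) y)))
  ge : fromℚ y ≤ᴿ x
  ge ε ε>0 = proj₁ (h ε ε>0) , λ n p → ≤-diff (ℚ.≤-trans
    (diff-≥0 (ℚ.≤-trans (ℚ.≤-trans (x≤∣x∣ (y - seq x n)) (ℚ.≤-reflexive (∣-∣-swap y (seq x n))))
      (proj₂ (h ε ε>0) n n p p)))
    (ℚ.≤-reflexive (solve 3 (λ e a b → e :- (b :- a) := a :+ e :- b) refl ε (seq x n) y)))

-- E k is the partial sum of exp of degree k + 1.
module Log (p : ℕ) (p≥1 : 1ℚ ≤ ℕ→ℚ p) where

  open Bound (ℕ→ℚ p) (ℕ→ℚ-nonNeg p)
  open Coeffs (λ _ → 1ℚ) (λ _ → ℚ.≤-refl)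

  E : ℕ → ℚ → ℚ
  E k u = series (λ _ → 1ℚ) u (suc k)

  series-0 : ∀ k → series (λ _ → 1ℚ) 0ℚ k ≡ 1ℚ
  series-0 zero    = refl
  series-0 (suc k) = trans
    (cong₂ _+_ (series-0 k) (trans (ℚ.*-identityˡ (term 0ℚ (suc k)))
      (trans (cong (term 0ℚ k *_) (ℚ.*-zeroˡ (1/suc k))) (ℚ.*-zeroʳ (term 0ℚ k)))))
    (ℚ.+-identityʳ 1ℚ)

  term≥0 : ∀ {u} → 0ℚ ≤ u → ∀ k → 0ℚ ≤ term u k
  term≥0 h zero    = ℚ.nonNegative⁻¹ 1ℚ
  term≥0 h (suc k) = 0≤* (term≥0 h k) (0≤* h (1/suc-nonNeg k))

  term-mono : ∀ {u v} → 0ℚ ≤ u → u ≤ v → ∀ k → term u k ≤ term v k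
  term-mono h p zero    = ℚ.≤-refl
  term-mono h p (suc k) = *-mono (0≤* h (1/suc-nonNeg k)) (term≥0 (ℚ.≤-trans h p) k)
    (term-mono h p k) (*-monoʳ (1/suc-nonNeg k) p)

  expand : ∀ k {u v} → 0ℚ ≤ u → u ≤ v → v - u ≤ E k v - E k u
  expand zero {u} {v} h p = ℚ.≤-reflexive (sym (trans (cong₂ _-_ (E₀ v) (E₀ u))
    (solve 3 (λ o a b → o :+ a :- (o :+ b) := a :- b) refl 1ℚ v u)))
    where
    E₀ : ∀ u → E 0 u ≡ 1ℚ + u
    E₀ u = cong (λ z → 1ℚ + z) (trans (ℚ.*-identityˡ (1ℚ * (u * 1ℚ)))
      (trans (ℚ.*-identityˡ (u * 1ℚ)) (ℚ.*-identityʳ u)))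
  expand (suc k) {u} {v} h p = ℚ.≤-trans (expand k h p) (ℚ.≤-trans
    (≤-+ʳ (diff-≥0 (*-monoˡ (ℚ.nonNegative⁻¹ 1ℚ) (term-mono h p (suc (suc k))))))
    (ℚ.≤-reflexive (solve 4 (λ a b c d → (a :- b) :+ (c :- d) := a :+ c :- (b :+ d)) refl
      (E k v) (E k u) (1ℚ * term v (suc (suc k))) (1ℚ * term u (suc (suc k))))))

  abs : ∀ {u} → 0ℚ ≤ u → u ≤ ℕ→ℚ p → ∣ u ∣ ≤ ℕ→ℚ p
  abs h q = ℚ.≤-trans (ℚ.≤-reflexive (ℚ.0≤p⇒∣p∣≡p h)) q

  lip : ∀ k {u v} → 0ℚ ≤ u → u ≤ v → v ≤ ℕ→ℚ p → E k v - E k u ≤ C * (v - u)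
  lip k {u} {v} h q top = ℚ.≤-trans (x≤∣x∣ (E k v - E k u)) (ℚ.≤-trans
    (series-lip (abs (ℚ.≤-trans h q) top) (abs h (ℚ.≤-trans q top)) k)
    (ℚ.≤-reflexive (cong (C *_) (ℚ.0≤p⇒∣p∣≡p (diff-≥0 q)))))

  p≤E : ∀ k → ℕ→ℚ p ≤ E k (ℕ→ℚ p)
  p≤E k = ≤-diff (ℚ.≤-trans (diff-≥0 (ℚ.≤-trans (expand k ℚ.≤-refl (ℕ→ℚ-nonNeg p))
      (ℚ.+-monoʳ-≤ (E k (ℕ→ℚ p)) (ℚ.neg-antimono-≤ E0≥0))))
    (ℚ.≤-reflexive (solve 3 (λ a b z → (a :- z) :- (b :- z) := a :- b) refl
      (E k (ℕ→ℚ p)) (ℕ→ℚ p) 0ℚ)))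
    where
    E0≥0 : 0ℚ ≤ E k 0ℚ
    E0≥0 = ℚ.≤-trans (ℚ.nonNegative⁻¹ 1ℚ) (ℚ.≤-reflexive (sym (series-0 (suc k))))

  open Inverse E (ℕ→ℚ p) C p C≥0
    (λ k → ℚ.≤-trans (ℚ.≤-reflexive (series-0 (suc k))) p≥1) p≤E expand lip
    (λ m n → ∣ T (suc m) - T (suc n) ∣) (null-∣∣ T-null)
    (λ j k h q → series-diff (abs h q) (suc j) (suc k)) public

1≤ : ∀ p .{{_ : ℕ.NonZero p}} → 1ℚ ≤ ℕ→ℚ p
1≤ (suc p) = ℚ.≤-trans (≤-+ʳ (ℕ→ℚ-nonNeg p)) (ℚ.≤-reflexive (sym (ℕ→ℚ-suc p)))

-- The natural logarithm, as the solution of exp x = p in [0, p].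
log : (p : ℕ) .{{_ : ℕ.NonZero p}} → ℝ
log p = Log.root p (1≤ p)

exp-log : (p : ℕ) .{{_ : ℕ.NonZero p}} → expᴿ (log p) ≃ᴿ fromℕ p
exp-log p = null⇒≃ (expᴿ (log p)) (ℕ→ℚ p) (Log.F-null p (1≤ p))

module Sqrt2 where

  sq : ℕ → ℚ → ℚ
  sq _ u = (1ℚ + u) * (1ℚ + u)

  sq-diff : ∀ u v → (v - u) * (1ℚ + 1ℚ + u + v) ≡ sq 0 v - sq 0 u
  sq-diff u v = solve 3 (λ o u v →
    (v :- u) :* (o :+ o :+ u :+ v) := (o :+ v) :* (o :+ v) :- (o :+ u) :* (o :+ u)) refl 1ℚ u v

  expand : ℕ → ∀ {u v} → 0ℚ ≤ u → u ≤ v → v - u ≤ sq 0 v - sq 0 u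
  expand _ {u} {v} h p = ℚ.≤-trans (ℚ.≤-reflexive (sym (ℚ.*-identityʳ (v - u))))
    (ℚ.≤-trans (*-monoˡ (diff-≥0 p) one≤) (ℚ.≤-reflexive (sq-diff u v)))
    where
    one≤ : 1ℚ ≤ 1ℚ + 1ℚ + u + v
    one≤ = ℚ.≤-trans (ℚ.≤ᵇ⇒≤ {1ℚ} {1ℚ + 1ℚ} _)
      (ℚ.≤-trans (≤-+ʳ {1ℚ + 1ℚ} h) (≤-+ʳ {1ℚ + 1ℚ + u} (ℚ.≤-trans h p)))

  lip : ℕ → ∀ {u v} → 0ℚ ≤ u → u ≤ v → v ≤ 1ℚ → sq 0 v - sq 0 u ≤ ℕ→ℚ 4 * (v - u)
  lip _ {u} {v} h p q = ℚ.≤-trans (ℚ.≤-reflexive (sym (sq-diff u v)))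
    (ℚ.≤-trans (*-monoˡ (diff-≥0 p)
        (ℚ.+-mono-≤ {1ℚ + 1ℚ + u} {1ℚ + 1ℚ + 1ℚ} (ℚ.+-monoʳ-≤ (1ℚ + 1ℚ) (ℚ.≤-trans p q)) q))
      (ℚ.≤-reflexive (ℚ.*-comm (v - u) (ℕ→ℚ 4))))

  null-0 : Null (λ _ _ → 0ℚ)
  null-0 ε ε>0 = 0 , λ _ _ _ _ → ℚ.<⇒≤ ε>0

  open Inverse sq (ℕ→ℚ 2) (ℕ→ℚ 4) 1 (ℚ.≤ᵇ⇒≤ _) (λ _ → ℚ.≤ᵇ⇒≤ _) (λ _ → ℚ.≤ᵇ⇒≤ _) expand lip
    (λ _ _ → 0ℚ) null-0 (λ _ _ {u} _ _ → ℚ.≤-reflexive (cong ∣_∣ (ℚ.+-inverseʳ (sq 0 u)))) public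

-- 1 + u, where u solves (1 + u)² = 2 in [0, 1].
√2 : ℝ
√2 = fromℚ 1ℚ +ᴿ Sqrt2.root

√2*√2 : √2 *ᴿ √2 ≃ᴿ fromℕ 2
√2*√2 = null⇒≃ (√2 *ᴿ √2) (ℕ→ℚ 2) Sqrt2.F-null

record ℂ : Set where
  constructor _+i_
  field
    re im : ℝ
open ℂ public

infixl 6 _+ᶜ_ _-ᶜ_
infixl 7 _*ᶜ_
infix  8 -ᶜ_
infixr 8 _^ᶜ_
infix  4 _⟶_

fromℝ : ℝ → ℂ
fromℝ x = x +i fromℕ 0

fromℕᶜ : ℕ → ℂ
fromℕᶜ n = fromℝ (fromℕ n)

_+ᶜ_ _-ᶜ_ _*ᶜ_ : ℂ → ℂ → ℂ
z +ᶜ w = (re z +ᴿ re w) +i (im z +ᴿ im w)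
z -ᶜ w = (re z -ᴿ re w) +i (im z -ᴿ im w)
z *ᶜ w = (re z *ᴿ re w -ᴿ im z *ᴿ im w) +i (re z *ᴿ im w +ᴿ im z *ᴿ re w)

-ᶜ_ : ℂ → ℂ
-ᶜ z = (-ᴿ re z) +i (-ᴿ im z)

∣_∣² : ℂ → ℝ
∣ z ∣² = re z *ᴿ re z +ᴿ im z *ᴿ im z

expᶜ : ℂ → ℂ
expᶜ z = (expᴿ (re z) *ᴿ cosᴿ (im z)) +i (expᴿ (re z) *ᴿ sinᴿ (im z))

-- p^z = exp (z log p)
_^ᶜ_ : (p : ℕ) .{{_ : ℕ.NonZero p}} → ℂ → ℂ
p ^ᶜ z = expᶜ (z *ᶜ fromℝ (log p))

partialSum : (ℕ → ℂ) → ℕ → ℂ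
partialSum a zero    = fromℕᶜ 0
partialSum a (suc k) = partialSum a k +ᶜ a k

-- The bound ∣ z k - l ∣ ≤ ε, squared on both sides.
_⟶_ : (ℕ → ℂ) → ℂ → Set
z ⟶ l = ∀ ε → 0ℚ < ε → ∃[ N ] ∀ k → N ℕ.≤ k → ∣ z k -ᶜ l ∣² ≤ᴿ fromℚ (ε * ε)

Converges Diverges : (ℕ → ℂ) → Set
Converges a = ∃[ l ] (partialSum a ⟶ l)
Diverges a  = ¬ Converges a

-- A field with a ℚ-basis indexed by Fin n.  Such a basis makes equality
-- decidable, so the apartness of a Heyting field is then just _≉_ and every
-- element other than 0 is invertible.
record NumberField c ℓ₁ ℓ₂ (n : ℕ) : Set (Level.suc (c ⊔ ℓ₁ ⊔ ℓ₂)) where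
  field
    heytingField : HeytingField c ℓ₁ ℓ₂

  open HeytingField heytingField public
    using (Carrier; _≈_; heytingCommutativeRing)
    renaming (_+_ to _+ᴷ_; _*_ to _*ᴷ_; _-_ to _-ᴷ_; 0# to 0ᴷ; 1# to 1ᴷ)

  open HeytingCommutativeRing heytingCommutativeRing public
    using (commutativeRing)

  open CommutativeRing commutativeRing public
    using (semiring; rawRing; +-monoid)

  open Exp semiring public
    using () renaming (_^_ to _^ᴷ_)

  open Sum +-monoid public
    using (sum)

  field
    ι                    : ℚ → Carrier
    ι-isRingHomomorphism : IsRingHomomorphism ℚ.+-*-rawRing rawRing ι

  combine : {m : ℕ} → (Fin m → ℚ) → (Fin m → Carrier) → Carrier
  combine q b = sum (λ i → ι (q i) *ᴷ b i)

  field
    basis       : Fin n → Carrier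
    spanning    : ∀ x → ∃[ q ] x ≈ combine q basis
    independent : ∀ q → combine q basis ≈ 0ᴷ → ∀ i → q i ≡ 0ℚ

module _ {c ℓ₁ ℓ₂ n} (K : NumberField c ℓ₁ ℓ₂ n) where
  open NumberField K

  -- The ring of integers of K: the roots of monic integer polynomials
  -- Xᵐ + Σ_{i < m} aᵢ Xⁱ.
  𝒪 : Pred Carrier ℓ₁
  𝒪 x = Σ[ m ∈ ℕ ] Σ[ a ∈ (Fin m → ℤ) ]
    x ^ᴷ m +ᴷ combine (λ i → a i / 1) (λ i → x ^ᴷ Fin.toℕ i) ≈ 0ᴷ

  record IsUnitalSubring (O : Pred Carrier ℓ₁) : Set (c ⊔ ℓ₁) where
    field
      resp : ∀ {x y} → x ≈ y → O x → O y
      ⊆𝒪   : O ⊆ 𝒪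
      1∈   : O 1ᴷ
      -∈   : ∀ {x y} → O x → O y → O (x -ᴷ y)
      *∈   : ∀ {x y} → O x → O y → O (x *ᴷ y)

  -- [𝒪 : O] = m, witnessed by representatives of the m additive cosets.
  HasIndex : Pred Carrier ℓ₁ → ℕ → Set (c ⊔ ℓ₁)
  HasIndex O m = Σ[ rep ∈ (Fin m → Carrier) ]
    (∀ i → 𝒪 (rep i)) × (∀ x → 𝒪 x → ∃! _≡_ λ i → O (x -ᴷ rep i))

  record Order (m : ℕ) : Set (c ⊔ Level.suc ℓ₁) where
    field
      ⟦_⟧             : Pred Carrier ℓ₁
      isUnitalSubring : IsUnitalSubring ⟦_⟧
      hasIndex        : HasIndex ⟦_⟧ m

  -- Two orders are identified when they have the same elements.
  orderSetoid : ℕ → Setoid (c ⊔ Level.suc ℓ₁) (c ⊔ ℓ₁)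
  orderSetoid m = record
    { Carrier       = Order m
    ; _≈_           = _≐_ on Order.⟦_⟧
    ; isEquivalence = On.isEquivalence Order.⟦_⟧ ≐-isEquivalence
    }

  -- N m is the number of orders of index m, for every m (there are none of
  -- index 0).
  IsOrderCount : (ℕ → ℕ) → Set (c ⊔ Level.suc ℓ₁)
  IsOrderCount N = ∀ m → Bijection (≡.setoid (Fin (N m))) (orderSetoid m)

-- The e-th term N(pᵉ) p^(-es) of η̃_{K,p}(s), when N counts the orders of K.
η̃-term : (N : ℕ → ℕ) (p : ℕ) .{{_ : ℕ.NonZero p}} → ℂ → ℕ → ℂ
η̃-term N p s e = fromℕᶜ (N (p ℕ.^ e)) *ᶜ p ^ᶜ (-ᶜ (fromℕᶜ e *ᶜ s))

-- d (n-1-d) / (n-1+d); the truncated n-1-d is only used for d ≤ n-1.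
ratio : (n : ℕ) .{{_ : ℕ.NonTrivial n}} → ℕ → ℚ
ratio n@(suc (suc _)) d = + (d ℕ.* (n ℕ.∸ 1 ℕ.∸ d)) / (n ℕ.∸ 1 ℕ.+ d)

-- The first argument of max is a default for the empty list; here it is also a
-- member of the list.
c₇ : (n : ℕ) .{{_ : ℕ.NonTrivial n}} → ℚ
c₇ n = max (ratio n 0) (map (ratio n) (upTo n))

{-# OPTIONS --safe #-}

-- Let m = n − 1 and 0 ≤ d ≤ m.  Modulo ℤ, 𝒪 is free of rank m; write the
-- coordinates of x in 𝒪/ℤ as (y, z) with z of length d.  For P = pᵏ and a
-- d × (m − d) matrix A over ℤ/P, the x with y ≡ 0 mod P and z ≡ A y mod P² form
-- an order, because it lies between ℤ + P²𝒪 and ℤ + P𝒪.  Its index is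
-- p^(k (m + d)), and distinct A give distinct orders, whence
-- N(p^(k (m + d))) ≥ p^(k d (m − d)).  So for Re s ≤ d (m − d)/(m + d) the terms of
-- η̃ do not tend to 0, which is more than both parts ask for: in the first there
-- is a factor 1/2 to spare, and d = ⌈(m − 1)/2⌉ suffices for the second.
--
-- That 𝒪/ℤ ≅ ℤᵐ needs the trace form.  To stay constructive, integrality of x is
-- handled as boundedness of the denominators of the powers of x, and the
-- existence of bases is proved under a double negation, since divergence is a
-- negative statement.
module Submission where

open import Defs
open import Algebra.Apartness.Bundles using (HeytingField)
open import Algebra.Bundles using (CommutativeRing)
open import Algebra.Morphism.Structures using (module RingMorphisms)
import Algebra.Properties.CommutativeSemiring.Exp as CExp
import Algebra.Properties.Semiring.Exp as Exp
import Algebra.Properties.Semiring.Sum as SemiringSum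
import Algebra.Solver.Ring as RingSolver
open import Algebra.Solver.Ring.AlmostCommutativeRing using (fromCommutativeRing; _-Raw-AlmostCommutative⟶_)
open import Data.Empty using (⊥)
open import Data.Fin.Base as Fin using (Fin; zero; suc)
import Data.Fin.Properties as Fin
open import Data.Integer.Base as ℤ using (ℤ; +_; 0ℤ; 1ℤ)
open import Data.Integer.Divisibility.Signed using (_∣_; divides; quotient; _∣?_; ∣ᵤ⇒∣; ∣⇒∣ᵤ)
import Data.Integer.DivMod as ℤ
import Data.Integer.Properties as ℤ
open import Data.Integer.Solver renaming (module +-*-Solver to ℤ-Solver)
open import Data.List.Base using (map; upTo)
open import Data.List.Membership.Propositional using (_∈_)
open import Data.List.Membership.Propositional.Properties using (∈-map⁻; ∈-upTo⁻)
open import Data.Maybe.Base using (Maybe; just; nothing)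
open import Data.Nat.Base as ℕ using (ℕ; zero; suc; NonTrivial; _∸_)
import Data.Nat.Coprimality as ℕ
import Data.Nat.Divisibility as ℕ
open import Data.Nat.Induction using (<-wellFounded)
open import Data.Nat.Primality using (Prime; prime⇒nonZero)
import Data.Nat.Properties as ℕ
open import Data.Nat.Solver renaming (module +-*-Solver to ℕ-Solver)
open import Data.Product using (Σ-syntax; ∃-syntax; _×_; _,_; proj₁; proj₂)
open import Data.Rational as ℚ
  using (ℚ; mkℚ; 0ℚ; 1ℚ; ½; _+_; _*_; _-_; -_; _/_; _≤_; _<_; ∣_∣; ↥_; ↧_; ↧ₙ_)
import Data.Rational.Properties as ℚ
open import Data.Rational.Solver using (module +-*-Solver)
import Data.Rational.Unnormalised as ℚᵘ
import Data.Rational.Unnormalised.Properties as ℚᵘ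
open import Data.Sum using (_⊎_; inj₁; inj₂; [_,_]′)
open import Data.Vec.Functional using (insertAt)
open import Data.Vec.Functional.Properties using (insertAt-lookup; insertAt-punchIn)
open import Function.Base using (_∘_; _$_; id)
open import Function.Bundles using (Bijection)
open import Induction.WellFounded using (Acc; acc)
open import Level using (Level; _⊔_; lift)
open import Relation.Binary.Bundles using (module DecTotalOrder; module Setoid)
open import Relation.Binary.PropositionalEquality
  using (_≡_; refl; sym; trans; cong; cong₂; subst; module ≡-Reasoning)
import Relation.Binary.Reasoning.Setoid as SetoidReasoning
open import Relation.Nullary using (¬_; ¬?; Dec; yes; no; contradiction)
open import Relation.Nullary.Decidable using (decidable-stable; map′; toWitness)
open import Relation.Unary using (_≐_)

open import Data.List.Extrema (DecTotalOrder.totalOrder ℚ.≤-decTotalOrder) using (max; argmax-sel)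
open +-*-Solver using (solve; _:+_; _:*_; _:-_; :-_; _:=_; con)
open ℤ-Solver using ()
  renaming (solve to ℤ-solve; _:+_ to _⊹ᶻ_; _:*_ to _⊛ᶻ_; :-_ to ⊖ᶻ_; _:=_ to _⊜ᶻ_; con to ℤ-con)
open ℕ-Solver using ()
  renaming (solve to ℕ-solve; _:+_ to _⊹ᴺ_; _:*_ to _⊛ᴺ_; _:=_ to _⊜ᴺ_; con to ℕ-con)

-- Rational integers

-- The exponents 1 and 2 of P are chosen for multiplicative closure: P𝒪 times P𝒪 lies in P²𝒪, where
-- both congruences hold trivially, so every A is admissible. Over real d, with t = n - 1, the
-- quotient d (t - d)/(t + d) is largest at d = (√2 - 1) t, with value (3 - 2√2) t. This is the
-- origin of the constant in the second part; d = t/2 already gives t/6. The trace is there because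
-- a coordinate functional of K might a priori have unbounded denominators on 𝒪, and then no least
-- positive value. Every functional is a rational multiple of x ↦ trace (z x), and the trace is
-- integral on 𝒪: x acts by an integral matrix on a full subgroup that it stabilises, and the trace
-- does not depend on the basis. Least values are sought in subgroups whose membership is not
-- decided, hence the double negation. Real numbers being sequences, the functional equations of
-- exp, cos and sin hold only in the limit. Each is replaced by an inequality between rational
-- partial sums of one degree, with an error that tends to 0 uniformly on bounded sets.

fromℤ : ℤ → ℚ
fromℤ z = z / 1

IsInt : ℚ → Set
IsInt q = ∃[ z ] q ≡ fromℤ z

fromℤ-+ : ∀ a b → fromℤ (a ℤ.+ b) ≡ fromℤ a + fromℤ b
fromℤ-+ a b = ℚ.toℚᵘ-injective (ℚᵘ.≃-trans (/-toℚᵘ (a ℤ.+ b) 0) (ℚᵘ.≃-sym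
  (ℚᵘ.≃-trans (ℚ.toℚᵘ-homo-+ (fromℤ a) (fromℤ b))
    (ℚᵘ.≃-trans (ℚᵘ.+-cong (/-toℚᵘ a 0) (/-toℚᵘ b 0))
      (ℚᵘ.*≡* (cong (ℤ._* + 1) (cong₂ ℤ._+_ (ℤ.*-identityʳ a) (ℤ.*-identityʳ b))))))))

fromℤ-* : ∀ a b → fromℤ (a ℤ.* b) ≡ fromℤ a * fromℤ b
fromℤ-* a b = ℚ.toℚᵘ-injective (ℚᵘ.≃-trans (/-toℚᵘ (a ℤ.* b) 0) (ℚᵘ.≃-sym
  (ℚᵘ.≃-trans (ℚ.toℚᵘ-homo-* (fromℤ a) (fromℤ b))
    (ℚᵘ.≃-trans (ℚᵘ.*-cong (/-toℚᵘ a 0) (/-toℚᵘ b 0)) (ℚᵘ.*≡* refl)))))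

fromℤ-neg : ∀ a → fromℤ (ℤ.- a) ≡ - fromℤ a
fromℤ-neg a = ℚ.toℚᵘ-injective (ℚᵘ.≃-trans (/-toℚᵘ (ℤ.- a) 0) (ℚᵘ.≃-sym
  (ℚᵘ.≃-trans (ℚ.toℚᵘ-homo‿- (fromℤ a)) (ℚᵘ.-‿cong (/-toℚᵘ a 0)))))

fromℤ-injective : ∀ {a b} → fromℤ a ≡ fromℤ b → a ≡ b
fromℤ-injective {a} {b} eq = trans (sym (ℤ.*-identityʳ a)) (trans
  (ℚᵘ.drop-*≡* (ℚᵘ.≃-trans (ℚᵘ.≃-sym (/-toℚᵘ a 0))
    (ℚᵘ.≃-trans (ℚᵘ.≃-reflexive (cong ℚ.toℚᵘ eq)) (/-toℚᵘ b 0))))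
  (ℤ.*-identityʳ b))

fromℤ-mono : ∀ {a b} → a ℤ.≤ b → fromℤ a ≤ fromℤ b
fromℤ-mono {a} {b} a≤b = ℚ.toℚᵘ-cancel-≤ (ℚᵘ.≤-respˡ-≃ (ℚᵘ.≃-sym (/-toℚᵘ a 0))
  (ℚᵘ.≤-respʳ-≃ (ℚᵘ.≃-sym (/-toℚᵘ b 0)) (ℚᵘ.*≤* (ℤ.*-monoʳ-≤-nonNeg (+ 1) a≤b))))

int : ∀ z → IsInt (fromℤ z)
int z = z , refl

int-+ : ∀ {p q} → IsInt p → IsInt q → IsInt (p + q)
int-+ (a , refl) (b , refl) = a ℤ.+ b , sym (fromℤ-+ a b)

int-* : ∀ {p q} → IsInt p → IsInt q → IsInt (p * q)
int-* (a , refl) (b , refl) = a ℤ.* b , sym (fromℤ-* a b)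

int-neg : ∀ {p} → IsInt p → IsInt (- p)
int-neg (a , refl) = ℤ.- a , sym (fromℤ-neg a)

int-sub : ∀ {p q} → IsInt p → IsInt q → IsInt (p - q)
int-sub p q = int-+ p (int-neg q)

int-resp : ∀ {p q} → p ≡ q → IsInt p → IsInt q
int-resp refl i = i

int-*ʳ : ∀ r {p q} → p ≡ q → IsInt (r * p) → IsInt (r * q)
int-*ʳ r refl i = i

module Σℚ where
  open import Algebra.Properties.Semiring.Sum
    (CommutativeRing.semiring ℚ.+-*-commutativeRing) public

Σℚ-int : ∀ {n} (q : Fin n → ℚ) → (∀ i → IsInt (q i)) → IsInt (Σℚ.sum q)
Σℚ-int {zero}  q h = int 0ℤ
Σℚ-int {suc n} q h = int-+ (h zero) (Σℚ-int (q ∘ suc) (h ∘ suc))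

↧*≡↥ : ∀ q → fromℤ (↧ q) * q ≡ fromℤ (↥ q)
↧*≡↥ q@record{} = ℚ.toℚᵘ-injective (ℚᵘ.≃-trans (ℚ.toℚᵘ-homo-* (fromℤ (↧ q)) q)
  (ℚᵘ.≃-trans (ℚᵘ.*-congʳ (/-toℚᵘ (↧ q) 0)) (ℚᵘ.≃-trans
    (ℚᵘ.*≡* (trans (ℤ.*-identityʳ _) (trans (ℤ.*-comm (↧ q) (↥ q))
      (cong (λ d → ↥ q ℤ.* + d) (sym (ℕ.*-identityˡ (↧ₙ q)))))))
    (ℚᵘ.≃-sym (/-toℚᵘ (↥ q) 0)))))

ℕ→ℚ-≢0 : ∀ d .{{_ : ℕ.NonZero d}} → ¬ ℕ→ℚ d ≡ 0ℚ
ℕ→ℚ-≢0 (suc d) eq with () ← fromℤ-injective {+ suc d} {0ℤ} eq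

opaque
  -- Common denominators are passed around as `suc d`, which makes them non-zero by form. Opacity
  -- keeps the rational behind `ℕ⁺` from being unfolded; the facts in this block are its interface.
  ℕ⁺ : ℕ → ℚ
  ℕ⁺ d = ℕ→ℚ (suc d)

  int-ℕ⁺ : ∀ d → IsInt (ℕ⁺ d)
  int-ℕ⁺ d = int (+ suc d)

  ℕ⁺-* : ∀ c d → ∃[ e ] ℕ⁺ e ≡ ℕ⁺ c * ℕ⁺ d
  ℕ⁺-* c d = d ℕ.+ c ℕ.* suc d , trans (cong fromℤ (ℤ.pos-* (suc c) (suc d)))
    (fromℤ-* (+ suc c) (+ suc d))

  ℕ⁺-≢0 : ∀ d → ¬ ℕ⁺ d ≡ 0ℚ
  ℕ⁺-≢0 d = ℕ→ℚ-≢0 (suc d)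

  ℕ⁺-denominator : ∀ q → ℕ⁺ (ℚ.denominator-1 q) ≡ fromℤ (↧ q)
  ℕ⁺-denominator q = refl

zero-product : ∀ p q → p * q ≡ 0ℚ → ¬ p ≡ 0ℚ → q ≡ 0ℚ
zero-product p q pq≡0 p≢0 = begin
  q                   ≡⟨ ℚ.*-identityˡ q ⟨
  1ℚ * q              ≡⟨ cong (_* q) (ℚ.*-inverseˡ p) ⟨
  (ℚ.1/ p) * p * q    ≡⟨ ℚ.*-assoc (ℚ.1/ p) p q ⟩
  ℚ.1/ p * (p * q)    ≡⟨ cong (ℚ.1/ p *_) pq≡0 ⟩
  ℚ.1/ p * 0ℚ         ≡⟨ ℚ.*-zeroʳ (ℚ.1/ p) ⟩
  0ℚ                  ∎
  where
  open ≡-Reasoning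
  instance
    _ = ℚ.≢-nonZero p≢0

opaque
  inverse : ∀ q → ¬ q ≡ 0ℚ → ∃[ r ] r * q ≡ 1ℚ
  inverse q q≢0 = ℚ.1/_ q {{ℚ.≢-nonZero q≢0}} , ℚ.*-inverseˡ q {{ℚ.≢-nonZero q≢0}}

p-q≡0⇒p≡q : ∀ p q → p - q ≡ 0ℚ → p ≡ q
p-q≡0⇒p≡q p q eq = trans (solve 2 (λ p q → p := (p :- q) :+ q) refl p q)
  (trans (cong (_+ q) eq) (ℚ.+-identityˡ q))

*-cancelˡ : ∀ r {p q} → ¬ r ≡ 0ℚ → r * p ≡ r * q → p ≡ q
*-cancelˡ r {p} {q} r≢0 eq = p-q≡0⇒p≡q p q (zero-product r (p - q)
  (trans (solve 3 (λ r p q → r :* (p :- q) := r :* p :- r :* q) refl r p q)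
    (trans (cong (_- r * q) eq) (ℚ.+-inverseʳ (r * q)))) r≢0)

common-denominator : ∀ {n} (q : Fin n → ℚ) → ∃[ d ] ∀ i → IsInt (ℕ⁺ d * q i)
common-denominator {zero}  q = 0 , λ ()
common-denominator {suc n} q = go (common-denominator (q ∘ suc))
  where
  go : ∃[ d ] (∀ i → IsInt (ℕ⁺ d * q (suc i))) → ∃[ d ] ∀ i → IsInt (ℕ⁺ d * q i)
  go (d , h) = proj₁ e , λ where
      zero    → int-resp (rearrange (ℕ⁺ d) (ℕ⁺ c) (q zero) (ℚ.*-comm (ℕ⁺ c) (ℕ⁺ d)))
                  (int-* (int-ℕ⁺ d) (↥ q zero , trans (cong (_* q zero) (ℕ⁺-denominator (q zero)))
                    (↧*≡↥ (q zero))))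
      (suc i) → int-resp (rearrange (ℕ⁺ c) (ℕ⁺ d) (q (suc i)) refl) (int-* (int-ℕ⁺ c) (h i))
    where
    c : ℕ
    c = ℚ.denominator-1 (q zero)
    e : ∃[ e ] ℕ⁺ e ≡ ℕ⁺ c * ℕ⁺ d
    e = ℕ⁺-* c d
    rearrange : ∀ a b x → ℕ⁺ c * ℕ⁺ d ≡ a * b → a * (b * x) ≡ ℕ⁺ (proj₁ e) * x
    rearrange a b x eq = trans (sym (ℚ.*-assoc a b x))
      (cong (_* x) (trans (sym eq) (sym (proj₂ e))))

common-denominator₂ : ∀ {m n} (q : Fin m → Fin n → ℚ) → ∃[ d ] ∀ i j → IsInt (ℕ⁺ d * q i j)
common-denominator₂ {m} {n} q = proj₁ D , λ i j → subst (λ (a , b) → IsInt (ℕ⁺ (proj₁ D) * q a b))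
    (Fin.remQuot-combine i j) (proj₂ D (Fin.combine i j))
  where
  D = common-denominator (λ k → let (i , j) = Fin.remQuot {m} n k in q i j)

-- If b is the denominator of q then every d qᵏ, and in particular d, is
-- divisible by b, and d may be replaced by d/b.
bounded-powers⇒int : ∀ (q : ℚ) (pow : ℕ → ℚ) → (∀ k → pow (suc k) ≡ q * pow k) →
  ¬ pow 0 ≡ 0ℚ → (∀ k → IsInt (pow k)) → IsInt q
bounded-powers⇒int q pow step pow≢0 pow-int =
  go q pow step pow≢0 pow-int (<-wellFounded ℤ.∣ proj₁ (pow-int 0) ∣)
  where
  go : ∀ (q : ℚ) (pow : ℕ → ℚ) → (∀ k → pow (suc k) ≡ q * pow k) →
    ¬ pow 0 ≡ 0ℚ → (int : ∀ k → IsInt (pow k)) → Acc ℕ._<_ ℤ.∣ proj₁ (int 0) ∣ → IsInt q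
  go q@(mkℚ a zero _) _ _ _ _ _ = a , trans (sym (ℚ.*-identityˡ q)) (↧*≡↥ q)
  go q@(mkℚ a b-1@(suc _) coprime) pow step pow≢0 pow-int (acc rec) =
      go q (fromℤ ∘ v) v-step v≢0 (int ∘ v) (rec v<u)
    where
    u v : ℕ → ℤ
    u k = proj₁ (pow-int k)
    b : ℤ
    b = + suc b-1
    b≢0 : ¬ fromℤ b ≡ 0ℚ
    b≢0 = ℕ→ℚ-≢0 (suc b-1)
    bu≡au : ∀ k → b ℤ.* u (suc k) ≡ a ℤ.* u k
    bu≡au k = fromℤ-injective (begin
      fromℤ (b ℤ.* u (suc k))       ≡⟨ fromℤ-* b (u (suc k)) ⟩
      fromℤ b * fromℤ (u (suc k))   ≡⟨ cong (fromℤ b *_) (trans (sym (proj₂ (pow-int (suc k))))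
        (step k)) ⟩
      fromℤ b * (q * pow k)         ≡⟨ ℚ.*-assoc (fromℤ b) q (pow k) ⟨
      fromℤ b * q * pow k           ≡⟨ cong₂ _*_ (↧*≡↥ q) (proj₂ (pow-int k)) ⟩
      fromℤ a * fromℤ (u k)         ≡⟨ fromℤ-* a (u k) ⟨
      fromℤ (a ℤ.* u k)             ∎)
      where open ≡-Reasoning
    b∣u : ∀ k → b ∣ u k
    b∣u k = ∣ᵤ⇒∣ (ℕ.coprime-divisor (ℕ.sym (ℕ.recompute coprime))
      (subst (suc b-1 ℕ.∣_) (ℤ.abs-* a (u k)) (∣⇒∣ᵤ (divides (u (suc k))
        (trans (sym (bu≡au k)) (ℤ.*-comm b (u (suc k))))))))
    v k = quotient (b∣u k)
    u≡v*b : ∀ k → pow k ≡ fromℤ b * fromℤ (v k)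
    u≡v*b k = trans (proj₂ (pow-int k))
      (trans (cong fromℤ (trans (_∣_.equality (b∣u k)) (ℤ.*-comm (v k) b)))
      (fromℤ-* b (v k)))
    v-step : ∀ k → fromℤ (v (suc k)) ≡ q * fromℤ (v k)
    v-step k = *-cancelˡ (fromℤ b) b≢0 (trans (sym (u≡v*b (suc k))) (trans (step k)
      (trans (cong (q *_) (u≡v*b k)) (solve 3 (λ q b v → q :* (b :* v) := b :* (q :* v)) refl q
        (fromℤ b) (fromℤ (v k))))))
    v≢0 : ¬ fromℤ (v 0) ≡ 0ℚ
    v≢0 eq = pow≢0 (trans (u≡v*b 0) (trans (cong (fromℤ b *_) eq) (ℚ.*-zeroʳ (fromℤ b))))
    ∣v∣≢0 : ℕ.NonZero ℤ.∣ v 0 ∣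
    ∣v∣≢0 = ℕ.≢-nonZero (λ eq → v≢0 (cong fromℤ (ℤ.∣i∣≡0⇒i≡0 {v 0} eq)))
    v<u : ℤ.∣ v 0 ∣ ℕ.< ℤ.∣ u 0 ∣
    v<u = subst (ℤ.∣ v 0 ∣ ℕ.<_) (sym (trans (cong ℤ.∣_∣ (_∣_.equality (b∣u 0))) (ℤ.abs-* (v 0) b)))
      (ℕ.m<m*n ℤ.∣ v 0 ∣ (suc b-1) {{∣v∣≢0}} (ℕ.s≤s (ℕ.s≤s ℕ.z≤n)))

-- The ascending chain condition on subgroups of ℤⁿ, in Richman's form.  For the
-- step, w ∈ S s has the least first coordinate g found so far, and the v k are
-- reduced by w to lie in 0 × ℤⁿ; divisibility by g is needed only of the v k at
-- which the chain in ℤⁿ stops, and when it fails there then the remainder is a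
-- smaller g.
record Chain (ℓ : Level) (n : ℕ) : Set (Level.suc ℓ) where
  field
    S     : ℕ → (Fin n → ℤ) → Set ℓ
    resp  : ∀ {m u v} → (∀ i → u i ≡ v i) → S m u → S m v
    zero∈ : ∀ m → S m (λ _ → 0ℤ)
    comb  : ∀ {m u v} c → S m u → S m v → S m (λ i → u i ℤ.+ c ℤ.* v i)
    grow  : ∀ {m u} → S m u → S (suc m) u
    next  : ℕ → Fin n → ℤ
    next∈ : ∀ m → S (suc m) (next m)

  grows : ∀ j {m u} → S m u → S (j ℕ.+ m) u
  grows zero    h = h
  grows (suc j) h = grow (grows j h)

cons : ∀ {n} → ℤ → (Fin n → ℤ) → Fin (suc n) → ℤ
cons a u zero    = a
cons a u (suc i) = u i

module Reduce {ℓ n} (C : Chain ℓ (suc n)) (s : ℕ) (w : Fin (suc n) → ℤ) (w∈ : Chain.S C s w) where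
  open Chain C

  Good : ℕ → Set
  Good k = w zero ∣ next (k ℕ.+ s) zero

  -- The zero vector in the first clause is only a default that makes the reduced chain total. If
  -- that chain stops at such a k, nothing is learnt about `next`, and `search` turns to the
  -- remainder instead.
  reduced : ∀ k → Dec (Good k) → Fin n → ℤ
  reduced k (no _)  i = 0ℤ
  reduced k (yes g) i = next (k ℕ.+ s) (suc i) ℤ.+ (ℤ.- quotient g) ℤ.* w (suc i)

  -- Carries a stop of the reduced chain back to the given one by adding the multiple of w that was
  -- subtracted; `s ≤ m` ensures that w is present at stage m.
  undo : ∀ k (g : Good k) {m} → s ℕ.≤ m → S m (cons 0ℤ (reduced k (yes g))) → S m (next (k ℕ.+ s))
  undo k g s≤m h = resp eq (comb (quotient g) h (subst (λ m → S m w) (ℕ.m∸n+n≡m s≤m) (grows _ w∈)))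
    where
    eq : ∀ i → cons 0ℤ (reduced k (yes g)) i ℤ.+ quotient g ℤ.* w i ≡ next (k ℕ.+ s) i
    eq zero    = trans (ℤ.+-identityˡ _) (sym (_∣_.equality g))
    eq (suc i) = ℤ-solve 3 (λ a q w → a ⊹ᶻ (⊖ᶻ q) ⊛ᶻ w ⊹ᶻ q ⊛ᶻ w ⊜ᶻ a) refl
      (next (k ℕ.+ s) (suc i)) (quotient g) (w (suc i))

  reduced∈ : ∀ k d → S (suc (k ℕ.+ s)) (cons 0ℤ (reduced k d))
  reduced∈ k (no _)  = resp (λ { zero → refl ; (suc i) → refl }) (zero∈ _)
  reduced∈ k (yes g) = resp eq (comb (ℤ.- quotient g) (next∈ (k ℕ.+ s)) (grows (suc k) w∈))
    where
    eq : ∀ i → next (k ℕ.+ s) i ℤ.+ (ℤ.- quotient g) ℤ.* w i ≡ cons 0ℤ (reduced k (yes g)) i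
    eq zero    = trans (cong (ℤ._+ (ℤ.- quotient g) ℤ.* w zero) (_∣_.equality g))
      (ℤ-solve 2 (λ q w → q ⊛ᶻ w ⊹ᶻ (⊖ᶻ q) ⊛ᶻ w ⊜ᶻ ℤ-con 0ℤ) refl (quotient g) (w zero))
    eq (suc i) = refl

  chain : Chain ℓ n
  chain = record
    { S     = λ m u → S (m ℕ.+ s) (cons 0ℤ u)
    ; resp  = λ eq → resp λ { zero → refl ; (suc i) → eq i }
    ; zero∈ = λ m → resp (λ { zero → refl ; (suc i) → refl }) (zero∈ _)
    ; comb  = λ c p q → resp (λ { zero → trans (ℤ.+-identityˡ _) (ℤ.*-zeroʳ c) ; (suc i) → refl })
      (comb c p q)
    ; grow  = grow
    ; next  = λ k → reduced k (w zero ∣? next (k ℕ.+ s) zero)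
    ; next∈ = λ k → reduced∈ k (w zero ∣? next (k ℕ.+ s) zero)
    }

-- One stage that already contains its next vector is all that can be found constructively; eventual
-- stabilisation is not asserted. One such stage is also all that a monic equation requires.
noetherian : ∀ {ℓ n} (C : Chain ℓ n) → let open Chain C in ∃[ m ] S m (next m)
noetherian {n = zero}  C = 0 , Chain.resp C (λ ()) (Chain.zero∈ C 0)
-- The first reduction is by w = 0: divisibility by 0 says that the first coordinate vanishes.
-- Either the chain stops among such vectors, or a non-zero first coordinate turns up and `search`
-- can start from it.
noetherian {n = suc n} C = start (noetherian (Reduce.chain C 0 (λ _ → 0ℤ) (zero∈ 0)))
  where
  open Chain C

  search : ∀ s w → S s w → .{{_ : ℤ.NonZero (w zero)}} → Acc ℕ._<_ ℤ.∣ w zero ∣ → ∃[ m ] S m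
    (next m)
  search s w w∈ (acc rec) = finish (noetherian chain)
    where
    open Reduce C s w w∈
    finish : ∃[ k ] Chain.S chain k (Chain.next chain k) → ∃[ m ] S m (next m)
    finish (k , h) with w zero ∣? next (k ℕ.+ s) zero
    ... | yes g = k ℕ.+ s , undo k g (ℕ.m≤n+m s k) h
    ... | no ¬g = search (suc k ℕ.+ s) r r∈ {{r≢0}} (rec (ℤ.n%d<d a (w zero)))
      where
      a : ℤ
      a = next (k ℕ.+ s) zero
      q : ℤ
      q = a ℤ./ w zero
      r : Fin (suc n) → ℤ
      r = cons (+ (a ℤ.% w zero)) (λ i → next (k ℕ.+ s) (suc i) ℤ.+ (ℤ.- q) ℤ.* w (suc i))
      r∈ : S (suc k ℕ.+ s) r
      r∈ = resp eq (comb (ℤ.- q) (next∈ (k ℕ.+ s)) (grows (suc k) w∈))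
        where
        eq : ∀ i → next (k ℕ.+ s) i ℤ.+ (ℤ.- q) ℤ.* w i ≡ r i
        eq zero    = trans (cong (ℤ._+ (ℤ.- q) ℤ.* w zero) (ℤ.a≡a%n+[a/n]*n a (w zero)))
          (ℤ-solve 3 (λ r q w → r ⊹ᶻ q ⊛ᶻ w ⊹ᶻ (⊖ᶻ q) ⊛ᶻ w ⊜ᶻ r) refl (+ (a ℤ.% w zero)) q (w zero))
        eq (suc i) = refl
      r≢0 : ℤ.NonZero (r zero)
      r≢0 = ℤ.≢-nonZero {r zero} λ eq → ¬g (divides q (trans (ℤ.a≡a%n+[a/n]*n a (w zero))
        (trans (cong (ℤ._+ q ℤ.* w zero) {+ (a ℤ.% w zero)} {0ℤ} eq)
          (ℤ.+-identityˡ (q ℤ.* w zero)))))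

  start : ∃[ k ] Chain.S (Reduce.chain C 0 (λ _ → 0ℤ) (zero∈ 0)) k
    (Chain.next (Reduce.chain C 0 (λ _ → 0ℤ) (zero∈ 0)) k) →
    ∃[ m ] S m (next m)
  start (k , h) with 0ℤ ∣? next (k ℕ.+ 0) zero
  ... | yes g = k ℕ.+ 0 , Reduce.undo C 0 (λ _ → 0ℤ) (zero∈ 0) k g ℕ.z≤n h
  ... | no ¬g = search _ (next (k ℕ.+ 0)) (next∈ (k ℕ.+ 0))
    {{ℤ.≢-nonZero λ eq → ¬g (divides 0ℤ eq)}} (<-wellFounded _)

-- Linear algebra over ℚ.

δ : ∀ {n} → Fin n → Fin n → ℚ
δ zero    zero    = 1ℚ
δ zero    (suc _) = 0ℚ
δ (suc _) zero    = 0ℚ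
δ (suc i) (suc j) = δ i j

-- This decision lets `trace-int` leave the double negation under which bases exist.
int? : ∀ q → Dec (IsInt q)
int? q = map′ to from (↧ q ∣? ↥ q)
  where
  to : ↧ q ∣ ↥ q → IsInt q
  to (divides z eq) = z , *-cancelˡ (fromℤ (↧ q)) (ℕ→ℚ-≢0 (↧ₙ q))
    (trans (↧*≡↥ q) (trans (cong fromℤ eq) (trans (fromℤ-* z (↧ q))
      (ℚ.*-comm (fromℤ z) (fromℤ (↧ q))))))
  from : IsInt q → ↧ q ∣ ↥ q
  from (z , eq) = divides z (fromℤ-injective (trans (sym (↧*≡↥ q)) (trans (cong (fromℤ (↧ q) *_) eq)
    (trans (ℚ.*-comm (fromℤ (↧ q)) (fromℤ z)) (sym (fromℤ-* z (↧ q)))))))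

δ-refl : ∀ {n} (i : Fin n) → δ i i ≡ 1ℚ
δ-refl zero    = refl
δ-refl (suc i) = δ-refl i

δ-≢ : ∀ {n} {i j : Fin n} → ¬ i ≡ j → δ i j ≡ 0ℚ
δ-≢ {i = zero}  {zero}  i≢j = contradiction refl i≢j
δ-≢ {i = zero}  {suc j} i≢j = refl
δ-≢ {i = suc i} {zero}  i≢j = refl
δ-≢ {i = suc i} {suc j} i≢j = δ-≢ (i≢j ∘ cong suc)

δ-int : ∀ {n} (i j : Fin n) → IsInt (δ i j)
δ-int zero    zero    = int 1ℤ
δ-int zero    (suc _) = int 0ℤ
δ-int (suc _) zero    = int 0ℤ
δ-int (suc i) (suc j) = δ-int i j

Σℚ-0 : ∀ {n} {q : Fin n → ℚ} → (∀ i → q i ≡ 0ℚ) → Σℚ.sum q ≡ 0ℚ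
Σℚ-0 {n} h = trans (Σℚ.sum-cong-≗ h) (Σℚ.sum-replicate-zero n)

Σℚ-δ : ∀ {n} (q : Fin n → ℚ) i → Σℚ.sum (λ j → q j * δ j i) ≡ q i
Σℚ-δ {suc n} q zero    = trans (cong₂ _+_ (ℚ.*-identityʳ (q zero))
  (Σℚ-0 (λ j → ℚ.*-zeroʳ (q (suc j))))) (ℚ.+-identityʳ (q zero))
Σℚ-δ {suc n} q (suc i) = trans (cong₂ _+_ (ℚ.*-zeroʳ (q zero)) (Σℚ-δ (q ∘ suc) i))
  (ℚ.+-identityˡ (q (suc i)))

Σℚ-1 : ∀ n → Σℚ.sum {n} (λ _ → 1ℚ) ≡ ℕ→ℚ n
Σℚ-1 zero    = refl
Σℚ-1 (suc n) = trans (cong (λ z → 1ℚ + z) (Σℚ-1 n)) (sym (ℕ→ℚ-suc n))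

-- Elimination of the first column. If it vanishes, one row is dropped with coefficient 0. Otherwise
-- a pivot row p clears the other rows without division, and a relation between the cleared rows is
-- lifted to one between all rows.
linear-relation : ∀ {m} (v : Fin (suc m) → Fin m → ℚ) →
  Σ[ a ∈ (Fin (suc m) → ℚ) ] (∃[ i ] ¬ a i ≡ 0ℚ) × (∀ j → Σℚ.sum (λ i → a i * v i j) ≡ 0ℚ)
linear-relation {zero}  v = (λ _ → 1ℚ) , (zero , λ ()) , λ ()
linear-relation {suc m} v with Fin.any? (λ i → ¬? (v i zero ℚ.≟ 0ℚ))
... | no none = cons′ (linear-relation (λ i j → v (suc i) (suc j)))
  where
  v≡0 : ∀ i → v i zero ≡ 0ℚ
  v≡0 i = decidable-stable (v i zero ℚ.≟ 0ℚ) (λ h → none (i , h))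
  cons′ : Σ[ a ∈ (Fin (suc m) → ℚ) ] (∃[ i ] ¬ a i ≡ 0ℚ) ×
    (∀ j → Σℚ.sum (λ i → a i * v (suc i) (suc j)) ≡ 0ℚ) → _
  cons′ (a , (k , a≢0) , rel) = b , (suc k , a≢0) , rel′
    where
    b : Fin (suc (suc m)) → ℚ
    b zero    = 0ℚ
    b (suc i) = a i
    rel′ : ∀ j → Σℚ.sum (λ i → b i * v i j) ≡ 0ℚ
    rel′ zero    = Σℚ-0 λ i → trans (cong (b i *_) (v≡0 i)) (ℚ.*-zeroʳ (b i))
    rel′ (suc j) = trans (cong₂ _+_ (ℚ.*-zeroˡ (v zero (suc j))) (rel j)) (ℚ.+-identityˡ 0ℚ)
... | yes (p , v≢0) = combine′ (linear-relation (λ k j → r * v (Fin.punchIn p k) (suc j) - v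
  (Fin.punchIn p k) zero * v p (suc j)))
  where
  r : ℚ
  r = v p zero
  u : Fin (suc m) → Fin (suc m) → ℚ
  u k j = r * v (Fin.punchIn p k) j - v (Fin.punchIn p k) zero * v p j
  combine′ : Σ[ a ∈ (Fin (suc m) → ℚ) ] (∃[ i ] ¬ a i ≡ 0ℚ) ×
    (∀ j → Σℚ.sum (λ k → a k * u k (suc j)) ≡ 0ℚ) → _
  combine′ (a , (k , a≢0) , rel) = b , (Fin.punchIn p k , b≢0) , λ j → trans (b-rel j) (rel′ j)
    where
    s : ℚ
    s = Σℚ.sum (λ k → a k * v (Fin.punchIn p k) zero)
    b : Fin (suc (suc m)) → ℚ
    -- In Σ aₖ (r vₖ - vₖ₀ vₚ) the row vₚ occurs with the coefficient -Σ aₖ vₖ₀ = -s.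
    b = insertAt (λ k → r * a k) p (- s)
    b≢0 : ¬ b (Fin.punchIn p k) ≡ 0ℚ
    b≢0 eq = a≢0 (zero-product r (a k) (trans (sym (insertAt-punchIn (λ k → r * a k) p (- s) k)) eq)
      v≢0)
    rel′ : ∀ j → Σℚ.sum (λ k → a k * u k j) ≡ 0ℚ
    rel′ zero    = Σℚ-0 λ k → trans (cong (a k *_) (solve 2 (λ r x → r :* x :- x :* r := con 0ℚ)
      refl r (v (Fin.punchIn p k) zero))) (ℚ.*-zeroʳ (a k))
    rel′ (suc j) = rel j
    t : Fin (suc m) → ℚ
    t j = Σℚ.sum (λ k → r * a k * v (Fin.punchIn p k) j)
    b-rel : ∀ j → Σℚ.sum (λ i → b i * v i j) ≡ Σℚ.sum (λ k → a k * u k j)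
    b-rel j = begin
      Σℚ.sum (λ i → b i * v i j)
        ≡⟨ Σℚ.sum-remove {i = p} (λ i → b i * v i j) ⟩
      b p * v p j + Σℚ.sum (λ k → b (Fin.punchIn p k) * v (Fin.punchIn p k) j)
        ≡⟨ cong₂ _+_ (cong (_* v p j) (insertAt-lookup (λ k → r * a k) p (- s)))
             (Σℚ.sum-cong-≗ λ k → cong (_* v (Fin.punchIn p k) j) (insertAt-punchIn (λ k → r * a k)
               p (- s) k)) ⟩
      - s * v p j + t j
        ≡⟨ cong (_+ t j) (solve 2 (λ s x → (:- s) :* x := (:- x) :* s) refl s (v p j)) ⟩
      - v p j * s + t j
        ≡⟨ cong (_+ t j) (Σℚ.*-distribˡ-sum (- v p j) (λ k → a k * v (Fin.punchIn p k) zero)) ⟩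
      Σℚ.sum (λ k → - v p j * (a k * v (Fin.punchIn p k) zero)) + t j
        ≡⟨ Σℚ.∑-distrib-+ (λ k → - v p j * (a k * v (Fin.punchIn p k) zero))
          (λ k → r * a k * v (Fin.punchIn p k) j) ⟨
      Σℚ.sum (λ k → - v p j * (a k * v (Fin.punchIn p k) zero) + r * a k * v (Fin.punchIn p k) j)
        ≡⟨ Σℚ.sum-cong-≗ (λ k → solve 5 (λ x a y r z → (:- x) :* (a :* y) :+ r :* a :* z := a :*
          (r :* z :- y :* x)) refl
             (v p j) (a k) (v (Fin.punchIn p k) zero) r (v (Fin.punchIn p k) j)) ⟩
      Σℚ.sum (λ k → a k * u k j) ∎
      where open ≡-Reasoning

-- Number fields

module Field {c ℓ₁ ℓ₂ n} (K : NumberField c ℓ₁ ℓ₂ n) where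
  open NumberField K public
  open CommutativeRing commutativeRing public
    using (setoid; commutativeSemiring; +-cong; +-congˡ; +-congʳ; *-cong; *-congˡ; *-congʳ; zeroˡ; zeroʳ;
      *-identityˡ; *-identityʳ; +-identityˡ; +-identityʳ; -‿inverseʳ; -‿cong;
      *-comm; *-assoc; distribˡ; distribʳ)
    renaming (refl to ≈-refl; sym to ≈-sym; trans to ≈-trans; -_ to -ᴷ_)
  open RingMorphisms.IsRingHomomorphism ι-isRingHomomorphism public
    using () renaming (+-homo to ι-+; *-homo to ι-*; 1#-homo to ι-1; 0#-homo to ι-0; -‿homo to ι-neg; ⟦⟧-cong to ι-cong)
  open SemiringSum semiring public
    using (sum-cong-≋; ∑-distrib-+; *-distribˡ-sum)
  open Exp semiring public using (^-homo-*)
  open CExp commutativeSemiring public using (^-distrib-*)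

  ι-morphism : ℚ.+-*-rawRing -Raw-AlmostCommutative⟶ fromCommutativeRing commutativeRing
  ι-morphism = record { ⟦_⟧ = ι ; +-homo = ι-+ ; *-homo = ι-* ; -‿homo = ι-neg ; 0-homo = ι-0 ;
    1-homo = ι-1 }

  ι-≟ : ∀ p q → Maybe (ι p ≈ ι q)
  ι-≟ p q with p ℚ.≟ q
  ... | yes eq = just (ι-cong eq)
  ... | no  _  = nothing

  open RingSolver ℚ.+-*-rawRing (fromCommutativeRing commutativeRing) ι-morphism ι-≟ public
    using () renaming (solve to K-solve; _:+_ to _⊕_; _:*_ to _⊗_; :-_ to ⊝_; _:=_ to _⊜_; con to K-con)
  open SetoidReasoning setoid
  private module EQ = ≡-Reasoning

  infixr 7 _·_
  _·_ : ℚ → Carrier → Carrier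
  q · x = ι q *ᴷ x

  record Functional : Set (c ⊔ ℓ₁) where
    field
      on      : Carrier → ℚ
      on-cong : ∀ {x y} → x ≈ y → on x ≡ on y
      on-+    : ∀ x y → on (x +ᴷ y) ≡ on x + on y
      on-·    : ∀ q x → on (q · x) ≡ q * on x
  open Functional public

  on-0 : ∀ f → on f 0ᴷ ≡ 0ℚ
  on-0 f = trans (on-cong f (≈-sym (zeroʳ (ι 0ℚ)))) (trans (on-· f 0ℚ 0ᴷ) (ℚ.*-zeroˡ (on f 0ᴷ)))

  -x≈-1·x : ∀ x → (-ᴷ x) ≈ (- 1ℚ) · x
  -x≈-1·x x = begin
    -ᴷ x               ≈⟨ -‿cong (*-identityˡ x) ⟨
    -ᴷ (1ᴷ *ᴷ x)       ≈⟨ -‿cong (*-congʳ ι-1) ⟨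
    -ᴷ (ι 1ℚ *ᴷ x)     ≈⟨ K-solve 2 (λ a x → ⊝ (a ⊗ x) ⊜ (⊝ a) ⊗ x) ≈-refl (ι 1ℚ) x ⟩
    (-ᴷ ι 1ℚ) *ᴷ x     ≈⟨ *-congʳ (ι-neg 1ℚ) ⟨
    (- 1ℚ) · x         ∎

  on-sub : ∀ f x y → on f (x -ᴷ y) ≡ on f x - on f y
  on-sub f x y = trans (on-+ f x (-ᴷ y)) (cong (λ z → on f x + z)
    (trans (on-cong f (-x≈-1·x y)) (trans (on-· f (- 1ℚ) y)
      (solve 1 (λ a → (:- con 1ℚ) :* a := :- a) refl (on f y)))))

  on-combine : ∀ f {m} q (v : Fin m → Carrier) → on f (combine q v) ≡ Σℚ.sum
    (λ i → q i * on f (v i))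
  on-combine f {zero}  q v = on-0 f
  on-combine f {suc m} q v = trans (on-+ f _ _) (cong₂ _+_ (on-· f (q zero) (v zero))
    (on-combine f (q ∘ suc) (v ∘ suc)))

  combine-cong : ∀ {m} {q r : Fin m → ℚ} v → (∀ i → q i ≡ r i) → combine q v ≈ combine r v
  combine-cong v h = sum-cong-≋ (λ i → *-congʳ (ι-cong (h i)))

  combine-+ : ∀ {m} (q r : Fin m → ℚ) v → combine (λ i → q i + r i) v ≈ combine q v +ᴷ combine r v
  combine-+ q r v = ≈-trans (sum-cong-≋ (λ i → ≈-trans (*-congʳ (ι-+ (q i) (r i)))
    (distribʳ (v i) _ _)))
    (∑-distrib-+ (λ i → q i · v i) (λ i → r i · v i))

  combine-· : ∀ {m} a (q : Fin m → ℚ) v → combine (λ i → a * q i) v ≈ a · combine q v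
  combine-· a q v = ≈-trans (sum-cong-≋ (λ i → ≈-trans (*-congʳ (ι-* a (q i))) (*-assoc _ _ _)))
    (≈-sym (*-distribˡ-sum (ι a) (λ i → q i · v i)))

  combine-0 : ∀ {m} {q : Fin m → ℚ} v → (∀ i → q i ≡ 0ℚ) → combine q v ≈ 0ᴷ
  combine-0 {zero}  v h = ≈-refl
  combine-0 {suc m} v h = ≈-trans (+-cong
    (≈-trans (*-congʳ (≈-trans (ι-cong (h zero)) ι-0)) (zeroˡ (v zero))) (combine-0 (v ∘ suc)
      (h ∘ suc))) (+-identityˡ 0ᴷ)

  combine-δ : ∀ {m} (v : Fin m → Carrier) j → combine (δ j) v ≈ v j
  combine-δ {suc m} v zero = begin
    1ℚ · v zero +ᴷ combine (λ _ → 0ℚ) (v ∘ suc)   ≈⟨ +-cong (≈-trans (*-congʳ ι-1)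
      (*-identityˡ (v zero))) (combine-0 (v ∘ suc) (λ _ → refl)) ⟩
    v zero +ᴷ 0ᴷ                                  ≈⟨ +-identityʳ (v zero) ⟩
    v zero                                        ∎
  combine-δ {suc m} v (suc j) = begin
    0ℚ · v zero +ᴷ combine (δ j) (v ∘ suc)   ≈⟨ +-cong (≈-trans (*-congʳ ι-0) (zeroˡ (v zero)))
      (combine-δ (v ∘ suc) j) ⟩
    0ᴷ +ᴷ v (suc j)                          ≈⟨ +-identityˡ (v (suc j)) ⟩
    v (suc j)                                ∎

  x-y≈0⇒x≈y : ∀ {x y} → x -ᴷ y ≈ 0ᴷ → x ≈ y
  x-y≈0⇒x≈y {x} {y} h = begin
    x               ≈⟨ +-identityʳ x ⟨
    x +ᴷ 0ᴷ         ≈⟨ +-congˡ (-‿inverseʳ y) ⟨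
    x +ᴷ (y -ᴷ y)   ≈⟨ K-solve 2 (λ x y → x ⊕ (y ⊕ ⊝ y) ⊜ (x ⊕ ⊝ y) ⊕ y) ≈-refl x y ⟩
    (x -ᴷ y) +ᴷ y   ≈⟨ +-congʳ h ⟩
    0ᴷ +ᴷ y         ≈⟨ +-identityˡ y ⟩
    y               ∎

  -- Coordinates and their denominators.

  coords : Carrier → Fin n → ℚ
  coords x = proj₁ (spanning x)

  expand : ∀ x → x ≈ combine (coords x) basis
  expand x = proj₂ (spanning x)

  coords-unique : ∀ {x} q → x ≈ combine q basis → ∀ i → coords x i ≡ q i
  coords-unique {x} q eq i = p-q≡0⇒p≡q (coords x i) (q i) (trans
    (solve 2 (λ a b → a :- b := a :+ (:- con 1ℚ) :* b) refl (coords x i) (q i))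
    (independent _ (begin
      combine (λ i → coords x i + (- 1ℚ) * q i) basis       ≈⟨ combine-+ _ _ basis ⟩
      combine (coords x) basis +ᴷ combine (λ i → (- 1ℚ) * q i) basis
        ≈⟨ +-cong (≈-sym (expand x)) (≈-trans (combine-· (- 1ℚ) q basis) (*-congˡ (≈-sym eq))) ⟩
      x +ᴷ (- 1ℚ) · x                                       ≈⟨ +-congˡ (-x≈-1·x x) ⟨
      x -ᴷ x                                                ≈⟨ -‿inverseʳ x ⟩
      0ᴷ                                                    ∎) i))

  coord : Fin n → Functional
  coord i = record
    { on      = λ x → coords x i
    ; on-cong = λ {x} {y} eq → coords-unique (coords y) (≈-trans eq (expand y)) i
    ; on-+    = λ x y → coords-unique _ (≈-trans (+-cong (expand x) (expand y))
      (≈-sym (combine-+ _ _ basis))) i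
    ; on-·    = λ q x → coords-unique _ (≈-trans (*-congˡ (expand x)) (≈-sym (combine-· q _ basis)))
      i
    }

  coord-basis : ∀ i j → on (coord i) (basis j) ≡ δ j i
  coord-basis i j = coords-unique (δ j) (≈-sym (combine-δ basis j)) i

  coords≡0⇒≈0 : ∀ {x} → (∀ i → coords x i ≡ 0ℚ) → x ≈ 0ᴷ
  coords≡0⇒≈0 {x} h = ≈-trans (expand x) (combine-0 basis h)

  coords-≡⇒≈ : ∀ {x y} → (∀ i → coords x i ≡ coords y i) → x ≈ y
  coords-≡⇒≈ {x} {y} h = ≈-trans (expand x) (≈-trans (combine-cong basis h) (≈-sym (expand y)))

  infixl 8 _∘*_
  _∘*_ : Functional → Carrier → Functional
  f ∘* y = record
    { on      = λ x → on f (y *ᴷ x)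
    ; on-cong = λ eq → on-cong f (*-congˡ eq)
    ; on-+    = λ u v → trans (on-cong f (distribˡ y u v)) (on-+ f (y *ᴷ u) (y *ᴷ v))
    ; on-·    = λ q x → trans (on-cong f (K-solve 3 (λ a b c → a ⊗ (b ⊗ c) ⊜ b ⊗ (a ⊗ c)) ≈-refl y
      (ι q) x))
                         (on-· f q (y *ᴷ x))
    }

  on-expand : ∀ f x → on f x ≡ Σℚ.sum (λ i → coords x i * on f (basis i))
  on-expand f x = trans (on-cong f (expand x)) (on-combine f (coords x) basis)

  -- D x is an integral combination of the basis.
  record Lattice (D : ℚ) (x : Carrier) : Set where
    constructor lattice
    field
      at : ∀ i → IsInt (D * coords x i)
  open Lattice public

  lattice-resp : ∀ {D x y} → x ≈ y → Lattice D x → Lattice D y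
  lattice-resp {D} eq h = lattice λ i → int-*ʳ D (on-cong (coord i) eq) (at h i)

  lattice-sub : ∀ {D x y} → Lattice D x → Lattice D y → Lattice D (x -ᴷ y)
  lattice-sub {D} {x} {y} h k = lattice λ i → int-resp
    (trans (solve 3 (λ d a b → d :* a :- d :* b := d :* (a :- b)) refl D (coords x i) (coords y i))
      (cong (D *_) (sym (on-sub (coord i) x y)))) (int-sub (at h i) (at k i))

  lattice-combine : ∀ {D m} (a : Fin m → ℤ) v → (∀ j → Lattice D (v j)) → Lattice D
    (combine (fromℤ ∘ a) v)
  lattice-combine {D} a v h = lattice λ i → int-resp
    (sym (trans (cong (D *_) (on-combine (coord i) (fromℤ ∘ a) v))
      (trans (Σℚ.*-distribˡ-sum D (λ j → fromℤ (a j) * coords (v j) i)) (Σℚ.sum-cong-≗ λ j →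
        solve 3 (λ d a b → d :* (a :* b) := a :* (d :* b)) refl D (fromℤ (a j)) (coords (v j) i)))))
    (Σℚ-int _ λ j → int-* (int (a j)) (at (h j) i))

  functional-int : ∀ f {C D x} → (∀ i → IsInt (C * on f (basis i))) → Lattice D x → IsInt
    (C * D * on f x)
  functional-int f {C} {D} {x} h k = int-resp (sym (trans (cong (C * D *_) (on-expand f x))
      (trans (Σℚ.*-distribˡ-sum (C * D) (λ i → coords x i * on f (basis i))) (Σℚ.sum-cong-≗ λ i →
        solve 4 (λ c d a b → c :* d :* (a :* b) := (d :* a) :* (c :* b)) refl C D (coords x i)
          (on f (basis i))))))
    (Σℚ-int _ λ i → int-* (at k i) (h i))

  -- Clears the structure constants of K, so that multiplication enlarges denominators by no more
  -- than one fixed factor besides those of the two arguments.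
  structure-denominator : ∃[ γ ] ∀ i j → Lattice (ℕ⁺ γ) (basis i *ᴷ basis j)
  structure-denominator = γ , λ i j → subst (λ (i , j) → Lattice (ℕ⁺ γ) (basis i *ᴷ basis j))
    (Fin.remQuot-combine i j)
      (lattice (proj₂ D (Fin.combine i j)))
    where
    D = common-denominator₂ {n ℕ.* n} {n} (λ ij l → let (i , j) = Fin.remQuot {n} n ij in coords (basis i *ᴷ basis j) l)
    γ = proj₁ D

  lattice-* : ∀ {D E x y} → Lattice D x → Lattice E y → Lattice (ℕ⁺ (proj₁ structure-denominator) *
    E * D) (x *ᴷ y)
  lattice-* {D} {E} {x} {y} hx hy = lattice λ l → int-*ʳ (γ * E * D)
    (on-cong (coord l) (*-comm y x))
    (functional-int (coord l ∘* y) {γ * E} {D} {x} (λ i → int-*ʳ (γ * E)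
      (on-cong (coord l) (*-comm (basis i) y))
      (functional-int (coord l ∘* basis i) {γ} {E} {y} (λ j → at (proj₂ structure-denominator i j)
        l) hy)) hx)
    where
    γ : ℚ
    γ = ℕ⁺ (proj₁ structure-denominator)

  -- Integrality and bounded denominators of powers.

  Bounded : Carrier → Set
  Bounded x = ∃[ d ] ∀ k → Lattice (ℕ⁺ d) (x ^ᴷ k)

  bounded-resp : ∀ {x y} → x ≈ y → Bounded x → Bounded y
  bounded-resp {x} {y} eq (d , h) = d , λ k → lattice-resp (Exp.^-congˡ semiring k eq) (h k)

  module Product {x y} (bx : Bounded x) (by : Bounded y) where
    private
      γ = proj₁ structure-denominator
      E = ℕ⁺-* γ (proj₁ by)
      F = ℕ⁺-* (proj₁ E) (proj₁ bx)

    monomials : ∃[ d ] ∀ i j → Lattice (ℕ⁺ d) (x ^ᴷ i *ᴷ y ^ᴷ j)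
    monomials = proj₁ F , λ i j → subst (λ d → Lattice d (x ^ᴷ i *ᴷ y ^ᴷ j))
      (trans (cong (_* ℕ⁺ (proj₁ bx)) (sym (proj₂ E))) (sym (proj₂ F))) (lattice-* (proj₂ bx i)
        (proj₂ by j))

  bounded-* : ∀ {x y} → Bounded x → Bounded y → Bounded (x *ᴷ y)
  bounded-* {x} {y} bx by = proj₁ monomials , λ k → lattice-resp (≈-sym (^-distrib-* x y k))
    (proj₂ monomials k k)
    where open Product bx by

  bounded-sub : ∀ {x y} → Bounded x → Bounded y → Bounded (x -ᴷ y)
  bounded-sub {x} {y} bx by = proj₁ monomials , λ k → lattice-resp
      (≈-trans (*-congʳ (*-identityˡ 1ᴷ)) (*-identityˡ _)) (go k 0 0)
    where
    open Product bx by
    -- Expanding one factor `x -ᴷ y` raises i or j by one. Carrying the monomial along replaces the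
    -- binomial theorem: only differences of monomials occur, and all of these share one
    -- denominator.
    go : ∀ k i j → Lattice (ℕ⁺ (proj₁ monomials)) (x ^ᴷ i *ᴷ y ^ᴷ j *ᴷ (x -ᴷ y) ^ᴷ k)
    go zero    i j = lattice-resp (≈-sym (*-identityʳ _)) (proj₂ monomials i j)
    go (suc k) i j = lattice-resp
      (K-solve 5 (λ x y a b c → (x ⊗ a) ⊗ b ⊗ c ⊕ ⊝ (a ⊗ (y ⊗ b) ⊗ c) ⊜ a ⊗ b ⊗ ((x ⊕ ⊝ y) ⊗ c))
        ≈-refl
        x y (x ^ᴷ i) (y ^ᴷ j) ((x -ᴷ y) ^ᴷ k))
      (lattice-sub (go k (suc i) j) (go k i (suc j)))

  -- The monic equation makes xʲ⁺ᵐ an integral combination of xʲ, ..., xʲ⁺ᵐ⁻¹, so a common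
  -- denominator of the first m powers serves all of them.
  𝒪⇒bounded : ∀ {x} → 𝒪 K x → Bounded x
  𝒪⇒bounded {x} (m , a , eq) = proj₁ D , λ k → go k (<-wellFounded k)
    where
    D = common-denominator₂ (λ (j : Fin m) i → coords (x ^ᴷ Fin.toℕ j) i)
    go : ∀ k → Acc ℕ._<_ k → Lattice (ℕ⁺ (proj₁ D)) (x ^ᴷ k)
    go k (acc rec) with k ℕ.<? m
    ... | yes k<m = subst (λ j → Lattice (ℕ⁺ (proj₁ D)) (x ^ᴷ j)) (Fin.toℕ-fromℕ< k<m)
      (lattice (proj₂ D (Fin.fromℕ< k<m)))
    ... | no  k≮m = high (ℕ.m∸n+n≡m (ℕ.≮⇒≥ k≮m))
      where
      high : ∀ {j} → j ℕ.+ m ≡ k → Lattice (ℕ⁺ (proj₁ D)) (x ^ᴷ k)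
      high {j} refl = lattice-resp (begin
          combine (fromℤ ∘ (ℤ.-_ ∘ a)) (λ i → x ^ᴷ (j ℕ.+ Fin.toℕ i))
            ≈⟨ sum-cong-≋ (λ i → ≈-trans (*-cong (≈-trans (ι-cong (fromℤ-neg (a i)))
              (ι-neg (fromℤ (a i)))) (^-homo-* x j (Fin.toℕ i)))
                 (K-solve 3 (λ a p q → (⊝ a) ⊗ (p ⊗ q) ⊜ (⊝ p) ⊗ (a ⊗ q)) ≈-refl (ι (fromℤ (a i)))
                   (x ^ᴷ j) (x ^ᴷ Fin.toℕ i))) ⟩
          sum (λ i → (-ᴷ (x ^ᴷ j)) *ᴷ (fromℤ (a i) · x ^ᴷ Fin.toℕ i))
            ≈⟨ *-distribˡ-sum (-ᴷ (x ^ᴷ j)) (λ i → fromℤ (a i) · x ^ᴷ Fin.toℕ i) ⟨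
          (-ᴷ (x ^ᴷ j)) *ᴷ s
            ≈⟨ K-solve 3 (λ p q s → (⊝ p) ⊗ s ⊜ p ⊗ q ⊕ ⊝ (p ⊗ (q ⊕ s))) ≈-refl (x ^ᴷ j) (x ^ᴷ m) s
              ⟩
          x ^ᴷ j *ᴷ x ^ᴷ m -ᴷ x ^ᴷ j *ᴷ (x ^ᴷ m +ᴷ s)
            ≈⟨ +-cong (≈-sym (^-homo-* x j m)) (-‿cong (≈-trans (*-congˡ eq) (zeroʳ _))) ⟩
          x ^ᴷ (j ℕ.+ m) -ᴷ 0ᴷ
            ≈⟨ x-0≈x _ ⟩
          x ^ᴷ (j ℕ.+ m) ∎)
        (lattice-combine (ℤ.-_ ∘ a) _ (λ i → go (j ℕ.+ Fin.toℕ i)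
          (rec (ℕ.+-monoʳ-< j (Fin.toℕ<n i)))))
        where
        s : Carrier
        s = combine (fromℤ ∘ a) (λ i → x ^ᴷ Fin.toℕ i)
        x-0≈x : ∀ z → z -ᴷ 0ᴷ ≈ z
        x-0≈x z = ≈-trans (+-congˡ (≈-trans (≈-sym (+-identityˡ (-ᴷ 0ᴷ))) (-‿inverseʳ 0ᴷ)))
          (+-identityʳ z)

  -- The subgroup generated by 1, x, ..., xᵐ⁻¹, in Horner form, so that its closure properties
  -- follow by recursion on m.
  Span : Carrier → ℕ → Carrier → Set (c ⊔ ℓ₁)
  Span x zero    y = Level.Lift c (y ≈ 0ᴷ)
  Span x (suc m) y = Σ[ a ∈ ℤ ] Σ[ z ∈ Carrier ] Span x m z × y ≈ ι (fromℤ a) +ᴷ x *ᴷ z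

  span-resp : ∀ {x} m {y z} → y ≈ z → Span x m y → Span x m z
  span-resp zero    eq (lift h)        = lift (≈-trans (≈-sym eq) h)
  span-resp (suc m) eq (a , w , s , h) = a , w , s , ≈-trans (≈-sym eq) h

  span-0 : ∀ x m → Span x m 0ᴷ
  span-0 x zero    = lift ≈-refl
  span-0 x (suc m) = 0ℤ , 0ᴷ , span-0 x m , ≈-sym (≈-trans (+-cong ι-0 (zeroʳ x)) (+-identityˡ 0ᴷ))

  span-comb : ∀ {x} m b {y z} → Span x m y → Span x m z → Span x m (y +ᴷ fromℤ b · z)
  span-comb zero    b (lift h) (lift k) =
    lift (≈-trans (+-cong h (≈-trans (*-congˡ k) (zeroʳ _))) (+-identityˡ 0ᴷ))
  span-comb {x} (suc m) b {y} {z} (a₁ , y′ , s₁ , h₁) (a₂ , z′ , s₂ , h₂) =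
    a₁ ℤ.+ b ℤ.* a₂ , y′ +ᴷ fromℤ b · z′ , span-comb m b s₁ s₂ , (begin
      y +ᴷ fromℤ b · z
        ≈⟨ +-cong h₁ (*-congˡ h₂) ⟩
      (ι (fromℤ a₁) +ᴷ x *ᴷ y′) +ᴷ fromℤ b · (ι (fromℤ a₂) +ᴷ x *ᴷ z′)
        ≈⟨ K-solve 6 (λ x y z a b c → (a ⊕ x ⊗ y) ⊕ b ⊗ (c ⊕ x ⊗ z) ⊜ (a ⊕ b ⊗ c) ⊕ x ⊗ (y ⊕ b ⊗ z))
          ≈-refl
             x y′ z′ (ι (fromℤ a₁)) (ι (fromℤ b)) (ι (fromℤ a₂)) ⟩
      (ι (fromℤ a₁) +ᴷ ι (fromℤ b) *ᴷ ι (fromℤ a₂)) +ᴷ x *ᴷ (y′ +ᴷ fromℤ b · z′)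
        ≈⟨ +-congʳ (≈-trans (+-congˡ (≈-sym (ι-* (fromℤ b) (fromℤ a₂)))) (≈-sym (ι-+ _ _))) ⟩
      ι (fromℤ a₁ + fromℤ b * fromℤ a₂) +ᴷ x *ᴷ (y′ +ᴷ fromℤ b · z′)
        ≈⟨ +-congʳ (ι-cong (sym (trans (fromℤ-+ a₁ (b ℤ.* a₂)) (cong (λ z → fromℤ a₁ + z)
          (fromℤ-* b a₂))))) ⟩
      ι (fromℤ (a₁ ℤ.+ b ℤ.* a₂)) +ᴷ x *ᴷ (y′ +ᴷ fromℤ b · z′) ∎)

  span-grow : ∀ {x} m {y} → Span x m y → Span x (suc m) y
  span-grow {x} zero    (lift h)        = span-resp 1 (≈-sym h) (span-0 x 1)
  span-grow     (suc m) (a , z , s , h) = a , z , span-grow m s , h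

  span-power : ∀ x m → Span x (suc m) (x ^ᴷ m)
  span-power x zero    = 1ℤ , 0ᴷ , lift ≈-refl , ≈-sym (≈-trans (+-cong ι-1 (zeroʳ x))
    (+-identityʳ 1ᴷ))
  span-power x (suc m) = 0ℤ , x ^ᴷ m , span-power x m , ≈-sym (≈-trans (+-congʳ ι-0)
    (+-identityˡ _))

  span-combine : ∀ {x} m {y} → Span x m y → ∃[ a ] y ≈ combine (fromℤ ∘ a) (λ (i : Fin m) → x ^ᴷ
    Fin.toℕ i)
  span-combine {x} zero    (lift h)            = (λ ()) , h
  span-combine {x} (suc m) {y} (a , z , s , h) = go (span-combine m s)
    where
    go : ∃[ b ] z ≈ combine (fromℤ ∘ b) (λ (i : Fin m) → x ^ᴷ Fin.toℕ i) →
      ∃[ b ] y ≈ combine (fromℤ ∘ b) (λ (i : Fin (suc m)) → x ^ᴷ Fin.toℕ i)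
    go (b , eq) = cons a b , ≈-trans h (+-cong (≈-sym (*-identityʳ _)) (begin
      x *ᴷ z                                                   ≈⟨ *-congˡ eq ⟩
      x *ᴷ combine (fromℤ ∘ b) (λ i → x ^ᴷ Fin.toℕ i)          ≈⟨ *-distribˡ-sum x
        (λ i → fromℤ (b i) · x ^ᴷ Fin.toℕ i) ⟩
      sum (λ i → x *ᴷ (fromℤ (b i) · x ^ᴷ Fin.toℕ i))
        ≈⟨ sum-cong-≋ (λ i → K-solve 3 (λ x b p → x ⊗ (b ⊗ p) ⊜ b ⊗ (x ⊗ p)) ≈-refl x
          (ι (fromℤ (b i))) (x ^ᴷ Fin.toℕ i)) ⟩
      sum (λ i → fromℤ (b i) · x ^ᴷ suc (Fin.toℕ i))           ∎))

  -- After multiplication by the common denominator, coordinate vectors of elements of `Span x m`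
  -- that are integral form an ascending chain in ℤⁿ, with xᵐ as the new vector at stage m. Where
  -- the chain stops, xᵐ is an integral combination of lower powers.
  bounded⇒𝒪 : ∀ {x} → Bounded x → 𝒪 K x
  bounded⇒𝒪 {x} (d , h) = finish (noetherian chain)
    where
    S : ℕ → (Fin n → ℤ) → Set (c ⊔ ℓ₁)
    S m u = Σ[ y ∈ Carrier ] Span x m y × (∀ i → ℕ⁺ d * coords y i ≡ fromℤ (u i))
    power : ℕ → Fin n → ℤ
    power k i = proj₁ (at (h k) i)
    chain : Chain (c ⊔ ℓ₁) n
    chain = record
      { S     = S
      ; resp  = λ eq (y , s , e) → y , s , λ i → trans (e i) (cong fromℤ (eq i))
      ; zero∈ = λ m → 0ᴷ , span-0 x m , λ i → trans (cong (ℕ⁺ d *_) (on-0 (coord i)))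
        (ℚ.*-zeroʳ (ℕ⁺ d))
      ; comb  = λ {m} {u} {v} b (y , s , e) (z , t , f) → y +ᴷ fromℤ b · z , span-comb m b s t , λ i
        →
          trans (cong (ℕ⁺ d *_) (trans (on-+ (coord i) y (fromℤ b · z)) (cong (λ w → coords y i + w)
            (on-· (coord i) (fromℤ b) z))))
            (trans (solve 4 (λ d b p q → d :* (p :+ b :* q) := d :* p :+ b :* (d :* q)) refl (ℕ⁺ d)
              (fromℤ b) (coords y i) (coords z i))
              (trans (cong₂ (λ p q → p + fromℤ b * q) (e i) (f i))
                (sym (trans (fromℤ-+ (u i) (b ℤ.* v i)) (cong (λ w → fromℤ (u i) + w)
                  (fromℤ-* b (v i)))))))
      ; grow  = λ {m} (y , s , e) → y , span-grow m s , e
      ; next  = power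
      ; next∈ = λ k → x ^ᴷ k , span-power x k , λ i → proj₂ (at (h k) i)
      }
    finish : ∃[ m ] S m (power m) → 𝒪 K x
    finish (m , y , s , e) = m , (ℤ.-_ ∘ a) , (begin
        x ^ᴷ m +ᴷ combine (fromℤ ∘ (ℤ.-_ ∘ a)) powers
          ≈⟨ +-cong x^m≈y (≈-trans (combine-cong powers (λ i → trans (fromℤ-neg (a i))
            (solve 1 (λ a → :- a := (:- con 1ℚ) :* a) refl (fromℤ (a i)))))
               (combine-· (- 1ℚ) (fromℤ ∘ a) powers)) ⟩
        y +ᴷ (- 1ℚ) · combine (fromℤ ∘ a) powers   ≈⟨ +-congˡ (*-congˡ (≈-sym y≈)) ⟩
        y +ᴷ (- 1ℚ) · y                            ≈⟨ +-congˡ (-x≈-1·x y) ⟨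
        y -ᴷ y                                     ≈⟨ -‿inverseʳ y ⟩
        0ᴷ                                         ∎)
      where
      powers : Fin m → Carrier
      powers i = x ^ᴷ Fin.toℕ i
      a : Fin m → ℤ
      a = proj₁ (span-combine m s)
      y≈ : y ≈ combine (fromℤ ∘ a) powers
      y≈ = proj₂ (span-combine m s)
      x^m≈y : x ^ᴷ m ≈ y
      x^m≈y = coords-≡⇒≈ λ i → *-cancelˡ (ℕ⁺ d) (ℕ⁺-≢0 d) (trans (proj₂ (at (h m) i)) (sym (e i)))

  𝒪-resp : ∀ {x y} → x ≈ y → 𝒪 K x → 𝒪 K y
  𝒪-resp eq h = bounded⇒𝒪 (bounded-resp eq (𝒪⇒bounded h))

  𝒪-sub : ∀ {x y} → 𝒪 K x → 𝒪 K y → 𝒪 K (x -ᴷ y)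
  𝒪-sub h k = bounded⇒𝒪 (bounded-sub (𝒪⇒bounded h) (𝒪⇒bounded k))

  𝒪-* : ∀ {x y} → 𝒪 K x → 𝒪 K y → 𝒪 K (x *ᴷ y)
  𝒪-* h k = bounded⇒𝒪 (bounded-* (𝒪⇒bounded h) (𝒪⇒bounded k))

  𝒪-ℤ : ∀ a → 𝒪 K (ι (fromℤ a))
  𝒪-ℤ a = 1 , (λ _ → ℤ.- a) , (begin
    ι q *ᴷ 1ᴷ +ᴷ (ι (fromℤ (ℤ.- a)) *ᴷ 1ᴷ +ᴷ 0ᴷ)
      ≈⟨ +-cong (*-identityʳ _) (≈-trans (+-identityʳ _) (≈-trans (*-identityʳ _)
        (≈-trans (ι-cong (fromℤ-neg a)) (ι-neg q)))) ⟩
    ι q -ᴷ ι q   ≈⟨ -‿inverseʳ (ι q) ⟩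
    0ᴷ           ∎)
    where
    q : ℚ
    q = fromℤ a

  𝒪-1 : 𝒪 K 1ᴷ
  𝒪-1 = 𝒪-resp ι-1 (𝒪-ℤ 1ℤ)

  𝒪-0 : 𝒪 K 0ᴷ
  𝒪-0 = 𝒪-resp ι-0 (𝒪-ℤ 0ℤ)

  1≉0 : ¬ 1ᴷ ≈ 0ᴷ
  1≉0 eq = proj₂ (HF.tight 1ᴷ 0ᴷ) eq (HF.invertible⇒# (1ᴷ ,
      ≈-trans (*-identityˡ _) 1-0 , ≈-trans (*-identityʳ _) 1-0))
    where
    module HF = HeytingField heytingField
    1-0 : 1ᴷ -ᴷ 0ᴷ ≈ 1ᴷ
    1-0 = ≈-trans (+-congˡ (≈-trans (≈-sym (+-identityˡ (-ᴷ 0ᴷ))) (-‿inverseʳ 0ᴷ))) (+-identityʳ 1ᴷ)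

  -- Tightness refutes `¬ x # 0ᴷ` but does not produce the apartness itself; the double negation is
  -- harmless where a contradiction is the goal.
  invertible : ∀ {x} → ¬ x ≈ 0ᴷ → ¬ ¬ (∃[ y ] x *ᴷ y ≈ 1ᴷ)
  invertible {x} x≉0 none = x≉0 (proj₁ (HF.tight x 0ᴷ) λ x#0 →
      let (y , _ , eq) = HF.#⇒invertible x#0 in none (y , ≈-trans (*-congʳ x≈x-0) eq))
    where
    module HF = HeytingField heytingField
    x≈x-0 : x ≈ x -ᴷ 0ᴷ
    x≈x-0 = ≈-sym (≈-trans (+-congˡ (≈-trans (≈-sym (+-identityˡ (-ᴷ 0ᴷ))) (-‿inverseʳ 0ᴷ)))
      (+-identityʳ x))

  1-coord : ∃[ i ] ¬ coords 1ᴷ i ≡ 0ℚ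
  1-coord = Fin.¬∀⟶∃¬ n _ (λ i → coords 1ᴷ i ℚ.≟ 0ℚ) (λ h → 1≉0 (coords≡0⇒≈0 h))

  -- Powers of q are multiples of 1ᴷ, so a coordinate in which 1ᴷ does not vanish displays them as a
  -- geometric progression of integers, up to the common denominator.
  rational-integer : ∀ q → 𝒪 K (ι q) → IsInt q
  rational-integer q h = bounded-powers⇒int q (λ k → ℕ⁺ d * coords (ι q ^ᴷ k) i)
      (λ k → trans (cong (ℕ⁺ d *_) (on-· (coord i) q (ι q ^ᴷ k)))
        (solve 3 (λ d q x → d :* (q :* x) := q :* (d :* x)) refl (ℕ⁺ d) q (coords (ι q ^ᴷ k) i)))
      (λ eq → proj₂ 1-coord (zero-product (ℕ⁺ d) _ eq (ℕ⁺-≢0 d)))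
      (λ k → at (proj₂ (𝒪⇒bounded h) k) i)
    where
    d : ℕ
    d = proj₁ (𝒪⇒bounded h)
    i : Fin n
    i = proj₁ 1-coord

  -- Once D clears the matrix of multiplication by x, the element D x maps the lattice of the basis
  -- to itself. Its powers, applied to 1ᴷ, then need only the denominator E of 1ᴷ.
  𝒪-multiple : ∀ x → ∃[ d ] 𝒪 K (ℕ⁺ d · x)
  𝒪-multiple x = proj₁ D , bounded⇒𝒪 (proj₁ E , power)
    where
    D = common-denominator₂ (λ i j → coords (x *ᴷ basis i) j)
    E = common-denominator (coords 1ᴷ)
    power : ∀ k → Lattice (ℕ⁺ (proj₁ E)) ((ℕ⁺ (proj₁ D) · x) ^ᴷ k)
    power zero    = lattice (proj₂ E)
    power (suc k) = lattice λ l → int-resp (cong (_* coords ((ℕ⁺ (proj₁ D) · x) ^ᴷ suc k) l)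
      (ℚ.*-identityˡ (ℕ⁺ (proj₁ E))))
      (functional-int (coord l ∘* (ℕ⁺ (proj₁ D) · x)) {1ℚ} {ℕ⁺ (proj₁ E)} (λ i → int-resp
        (sym (trans (ℚ.*-identityˡ _) (trans (on-cong (coord l) (*-assoc _ x (basis i)))
          (on-· (coord l) (ℕ⁺ (proj₁ D)) (x *ᴷ basis i)))))
        (proj₂ D i l)) (power k))

  -- Functionals, subgroups and dual bases.

  _⊟[_]_ : Functional → ℚ → Functional → Functional
  f ⊟[ q ] g = record
    { on      = λ x → on f x - q * on g x
    ; on-cong = λ eq → cong₂ (λ a b → a - q * b) (on-cong f eq) (on-cong g eq)
    ; on-+    = λ x y → trans (cong₂ (λ a b → a - q * b) (on-+ f x y) (on-+ g x y))
        (solve 5 (λ a b c d q → (a :+ b) :- q :* (c :+ d) := (a :- q :* c) :+ (b :- q :* d)) refl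
          (on f x) (on f y) (on g x) (on g y) q)
    ; on-·    = λ r x → trans (cong₂ (λ a b → a - q * b) (on-· f r x) (on-· g r x))
        (solve 4 (λ a b r q → r :* a :- q :* (r :* b) := r :* (a :- q :* b)) refl (on f x) (on g x)
          r q)
    }

  scale : ℚ → Functional → Functional
  scale q f = record
    { on      = λ x → q * on f x
    ; on-cong = λ eq → cong (q *_) (on-cong f eq)
    ; on-+    = λ x y → trans (cong (q *_) (on-+ f x y)) (ℚ.*-distribˡ-+ q (on f x) (on f y))
    ; on-·    = λ r x → trans (cong (q *_) (on-· f r x)) (solve 3 (λ q r a → q :* (r :* a) := r :*
      (q :* a)) refl q r (on f x))
    }

  ⨁ : ∀ {m} → (Fin m → Functional) → Functional
  ⨁ f = record
    { on      = λ x → Σℚ.sum (λ i → on (f i) x)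
    ; on-cong = λ eq → Σℚ.sum-cong-≗ (λ i → on-cong (f i) eq)
    ; on-+    = λ x y → trans (Σℚ.sum-cong-≗ (λ i → on-+ (f i) x y))
      (Σℚ.∑-distrib-+ (λ i → on (f i) x) (λ i → on (f i) y))
    ; on-·    = λ q x → trans (Σℚ.sum-cong-≗ (λ i → on-· (f i) q x))
      (sym (Σℚ.*-distribˡ-sum q (λ i → on (f i) x)))
    }

  record Subgroup ℓ : Set (c ⊔ ℓ₁ ⊔ Level.suc ℓ) where
    field
      Mem   : Carrier → Set ℓ
      zero∈ : Mem 0ᴷ
      comb∈ : ∀ a {x y} → Mem x → Mem y → Mem (x -ᴷ fromℤ a · y)

  -- A basis of P modulo the common kernel of φ, together with its coordinate functionals. The last
  -- two fields say that π and φ have the same common kernel in all of K, which is how properties of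
  -- φ reach π.
  record Coordinates {ℓ m} (P : Subgroup ℓ) (φ : Fin m → Functional) : Set (c ⊔ ℓ₁ ⊔ ℓ) where
    open Subgroup P
    field
      π        : Fin m → Functional
      π-int    : ∀ {x} → Mem x → ∀ i → IsInt (on (π i) x)
      dual     : Fin m → Carrier
      dual∈    : ∀ j → Mem (dual j)
      π-dual   : ∀ i j → on (π i) (dual j) ≡ δ j i
      π≡0⇒φ≡0 : ∀ {x} → (∀ i → on (π i) x ≡ 0ℚ) → ∀ i → on (φ i) x ≡ 0ℚ
      φ≡0⇒π≡0 : ∀ {x} → (∀ i → on (φ i) x ≡ 0ℚ) → ∀ i → on (π i) x ≡ 0ℚ

  comb-value : ∀ f q x y → on f (x -ᴷ q · y) ≡ on f x - q * on f y
  comb-value f q x y = trans (on-sub f x (q · y)) (cong (λ z → on f x - z) (on-· f q y))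

  -- Full rank, in a form that passes to the kernel of `φ zero` unchanged: the elements for the
  -- other indices already lie in it.
  Independent : ∀ {ℓ m} → Subgroup ℓ → (Fin m → Functional) → Set (c ⊔ ℓ)
  Independent P φ = ∀ i → ∃[ x ] Subgroup.Mem P x × ¬ on (φ i) x ≡ 0ℚ × (∀ j → ¬ j ≡ i → on (φ j) x
    ≡ 0ℚ)

  module LeastValue {ℓ} (P : Subgroup ℓ) (f : Functional) (f-int : ∀ {x} → Subgroup.Mem P x → IsInt
    (on f x)) where
    open Subgroup P

    Value : ℕ → Set (c ⊔ ℓ)
    Value k = ∃[ w ] Mem w × on f w ≡ fromℤ (+ suc k)

    Least : Set (c ⊔ ℓ)
    Least = ∃[ k ] Value k × (∀ j → j ℕ.< k → ¬ Value j)

    -- Infinite descent: if no value were least then no positive integer would be a value.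
    -- Membership in P is not decided, so a search is not possible and the double negation stays.
    least : ∀ {x} → Mem x → ¬ on f x ≡ 0ℚ → ¬ ¬ Least
    least {x} x∈ fx≢0 none = positive (f-int x∈)
      where
      no-value : ∀ k → Acc ℕ._<_ k → ¬ Value k
      no-value k (acc rec) v = none (k , v , λ j j<k → no-value j (rec j<k))
      positive : IsInt (on f x) → ⊥
      positive (+ zero , eq)      = fx≢0 eq
      positive (+ suc k , eq)     = no-value k (<-wellFounded k) (x , x∈ , eq)
      positive (ℤ.-[1+ k ] , eq)  = no-value k (<-wellFounded k) (0ᴷ -ᴷ fromℤ 1ℤ · x , comb∈ 1ℤ
        zero∈ x∈ ,
        trans (comb-value f 1ℚ 0ᴷ x) (trans (cong₂ (λ a b → a - 1ℚ * b) (on-0 f) eq)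
          (trans (solve 1 (λ a → con 0ℚ :- con 1ℚ :* a := :- a) refl (fromℤ ℤ.-[1+ k ]))
            (sym (fromℤ-neg ℤ.-[1+ k ])))))

    -- The remainder of f x modulo the least positive value is again a value.
    divisible : ∀ ((k , (w , _) , _) : Least) {x} → Mem x → ∃[ q ] on f x ≡ fromℤ q * fromℤ
      (+ suc k) × on f (x -ᴷ fromℤ q · w) ≡ 0ℚ
    divisible (k , (w , w∈ , fw) , min) {x} x∈ = q , trans (solve 2 (λ a b → a := (a :- b) :+ b)
      refl (on f x) (fromℤ q * g))
        (trans (cong (_+ fromℤ q * g) (trans (sym value) y≡0)) (ℚ.+-identityˡ (fromℤ q * g))) , y≡0
      where
      z q : ℤ
      z = proj₁ (f-int x∈)
      q = z ℤ./ℕ suc k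
      g : ℚ
      g = fromℤ (+ suc k)
      r : ℕ
      r = z ℤ.%ℕ suc k
      value : on f (x -ᴷ fromℤ q · w) ≡ on f x - fromℤ q * g
      value = trans (comb-value f (fromℤ q) x w) (cong (λ a → on f x - fromℤ q * a) fw)
      y≡r : on f (x -ᴷ fromℤ q · w) ≡ fromℤ (+ r)
      y≡r = trans value (trans (cong (_- fromℤ q * g) (trans (proj₂ (f-int x∈))
        (trans (cong fromℤ (ℤ.a≡a%ℕn+[a/ℕn]*n z (suc k)))
        (trans (fromℤ-+ (+ r) (q ℤ.* + suc k)) (cong (λ a → fromℤ (+ r) + a)
          (fromℤ-* q (+ suc k)))))))
        (solve 2 (λ a b → (a :+ b) :- b := a) refl (fromℤ (+ r)) (fromℤ q * g)))
      r≡0 : ∀ r′ → r′ ≡ r → r′ ≡ 0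
      r≡0 zero     eq = refl
      r≡0 (suc r′) eq = contradiction (x -ᴷ fromℤ q · w , comb∈ q x∈ w∈ , trans y≡r
        (cong (λ a → fromℤ (+ a)) (sym eq)))
        (min r′ (ℕ.s<s⁻¹ (subst (ℕ._< suc k) (sym eq) (ℤ.n%ℕd<d z (suc k)))))
      y≡0 : on f (x -ᴷ fromℤ q · w) ≡ 0ℚ
      y≡0 = trans y≡r (cong (λ a → fromℤ (+ a)) (r≡0 r refl))

  -- A triangular basis, split off one vector at a time: w attains the least positive value of
  -- `φ zero` on P, so every element of P is an integral multiple of w plus an element of the kernel
  -- of `φ zero` in P, to which the induction applies.
  coordinates : ∀ {ℓ m} (P : Subgroup ℓ) (φ : Fin m → Functional) →
    (∀ {x} → Subgroup.Mem P x → ∀ i → IsInt (on (φ i) x)) → Independent P φ → ¬ ¬ Coordinates P φ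
  coordinates {m = zero}  P φ φ-int indep none = none record
    { π = λ () ; π-int = λ _ () ; dual = λ () ; dual∈ = λ () ; π-dual = λ () ; π≡0⇒φ≡0 = λ _ () ;
      φ≡0⇒π≡0 = λ _ () }
  coordinates {m = suc m} P φ φ-int indep none =
    least (proj₁ (proj₂ (indep zero))) (proj₁ (proj₂ (proj₂ (indep zero)))) λ l@(k , (w , w∈ , φw) ,
      _) →
    let (h , hg≡1) = inverse (fromℤ (+ suc k)) (ℕ→ℚ-≢0 (suc k))
        open Step (fromℤ (+ suc k)) w h w∈ φw hg≡1 (divisible l)
    in coordinates kernel (φ ∘ suc) (λ (x∈ , _) i → φ-int x∈ (suc i)) indep′ (λ C → none (extend C))
    where
    open Subgroup P
    open LeastValue P (φ zero) (λ x∈ → φ-int x∈ zero)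

    module Step (g : ℚ) (w : Carrier) (h : ℚ) (w∈ : Mem w) (φw : on (φ zero) w ≡ g)
      (hg≡1 : h * g ≡ 1ℚ)
      (divisible : ∀ {x} → Mem x → ∃[ q ] on (φ zero) x ≡ fromℤ q * g × on (φ zero)
        (x -ᴷ fromℤ q · w) ≡ 0ℚ) where

      kernel : Subgroup _
      kernel = record
        { Mem   = λ x → Mem x × on (φ zero) x ≡ 0ℚ
        ; zero∈ = zero∈ , on-0 (φ zero)
        ; comb∈ = λ a {x} {y} (x∈ , p) (y∈ , q) → comb∈ a x∈ y∈ ,
            trans (comb-value (φ zero) (fromℤ a) x y) (trans (cong₂ (λ u v → u - fromℤ a * v) p q)
              (solve 1 (λ a → con 0ℚ :- a :* con 0ℚ := con 0ℚ) refl (fromℤ a)))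
        }

      indep′ : Independent kernel (φ ∘ suc)
      indep′ i = let (x , x∈ , φx≢0 , φx≡0) = indep (suc i) in
        x , (x∈ , φx≡0 zero λ ()) , φx≢0 , λ j j≢i → φx≡0 (suc j) (j≢i ∘ Fin.suc-injective)

      π₀ : Functional
      π₀ = scale h (φ zero)

      π₀≡ : ∀ {x q} → on (φ zero) x ≡ q * g → on π₀ x ≡ q
      π₀≡ {x} {q} eq = trans (cong (h *_) eq)
        (trans (solve 3 (λ a q g → a :* (q :* g) := (a :* g) :* q) refl h q g)
        (trans (cong (_* q) hg≡1) (ℚ.*-identityˡ q)))

      π₀w : on π₀ w ≡ 1ℚ
      π₀w = π₀≡ (trans φw (sym (ℚ.*-identityˡ g)))

      π₀≡0 : ∀ {x} → on (φ zero) x ≡ 0ℚ → on π₀ x ≡ 0ℚ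
      π₀≡0 eq = trans (cong (h *_) eq) (ℚ.*-zeroʳ h)

      extend : Coordinates kernel (φ ∘ suc) → Coordinates P φ
      extend C = record
        { π        = π
        ; π-int    = π-int
        ; dual     = λ { zero → w ; (suc j) → C.dual j }
        ; dual∈    = λ { zero → w∈ ; (suc j) → proj₁ (C.dual∈ j) }
        ; π-dual   = λ where
            zero    zero    → π₀w
            zero    (suc j) → π₀≡0 (proj₂ (C.dual∈ j))
            (suc i) zero    → trans (cong (λ a → on (C.π i) w - on (C.π i) w * a) π₀w)
              (solve 1 (λ a → a :- a :* con 1ℚ := con 0ℚ) refl (on (C.π i) w))
            (suc i) (suc j) → trans (drop i (C.dual j) (π₀≡0 (proj₂ (C.dual∈ j)))) (C.π-dual i j)
        ; π≡0⇒φ≡0 = λ {x} πx → λ where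
            zero    → zero-product h (on (φ zero) x) (πx zero)
              (λ eq → 1≢0 (trans (sym hg≡1) (trans (cong (_* g) eq) (ℚ.*-zeroˡ g))))
            (suc i) → C.π≡0⇒φ≡0 (λ j → trans (sym (drop j x (πx zero))) (πx (suc j))) i
        ; φ≡0⇒π≡0 = λ {x} πx → λ where
            zero    → π₀≡0 (πx zero)
            (suc i) → trans (drop i x (π₀≡0 (πx zero))) (C.φ≡0⇒π≡0 (πx ∘ suc) i)
        }
        where
        module C = Coordinates C
        1≢0 : ¬ 1ℚ ≡ 0ℚ
        1≢0 ()
        π : Fin (suc m) → Functional
        π zero    = π₀
        -- The correction makes this functional vanish on w and changes nothing on the kernel of
        -- `π₀`.
        π (suc i) = C.π i ⊟[ on (C.π i) w ] π₀
        drop : ∀ i x → on π₀ x ≡ 0ℚ → on (π (suc i)) x ≡ on (C.π i) x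
        drop i x eq = trans (cong (λ a → on (C.π i) x - on (C.π i) w * a) eq)
          (solve 2 (λ a b → a :- b :* con 0ℚ := a) refl (on (C.π i) x) (on (C.π i) w))
        π-int : ∀ {x} → Mem x → ∀ i → IsInt (on (π i) x)
        π-int {x} x∈ i with divisible x∈
        π-int {x} x∈ zero    | q , eq , y≡0 = q , π₀≡ {x} {fromℤ q} eq
        -- With q the value of `π₀` at x, the corrected functional at x is `C.π i` at x - q w, an
        -- element of the kernel.
        π-int {x} x∈ (suc i) | q , eq , y≡0 = int-resp
          (trans (comb-value (C.π i) (fromℤ q) x w)
            (trans (cong (λ a → on (C.π i) x - a * on (C.π i) w) (sym (π₀≡ {x} {fromℤ q} eq)))
            (solve 3 (λ a b c → a :- b :* c := a :- c :* b) refl (on (C.π i) x) (on π₀ x)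
              (on (C.π i) w))))
          (C.π-int (comb∈ q x∈ w∈ , y≡0) i)

  -- The trace form.

  trace : Functional
  trace = ⨁ (λ i → coord i ∘* basis i)

  dual-expand : ∀ {ℓ m} {P : Subgroup ℓ} {φ : Fin m → Functional} (C : Coordinates P φ) → let open Coordinates C in
    (∀ {x} → (∀ i → on (φ i) x ≡ 0ℚ) → x ≈ 0ᴷ) → ∀ x → x ≈ combine (λ j → on (π j) x) dual
  dual-expand C φ≡0⇒≈0 x = x-y≈0⇒x≈y (φ≡0⇒≈0 (π≡0⇒φ≡0 λ i → trans (on-sub (π i) x _)
      (trans (cong (λ z → on (π i) x - z) (trans (on-combine (π i) (λ j → on (π j) x) dual)
        (trans (Σℚ.sum-cong-≗ (λ j → cong (on (π j) x *_) (π-dual i j))) (Σℚ-δ (λ j → on (π j) x)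
          i))))
      (ℚ.+-inverseʳ (on (π i) x)))))
    where open Coordinates C

  -- Independence of the trace from the basis: expanding `basis i` in ω and exchanging the two sums
  -- is the identity tr (AB) = tr (BA).
  trace-dual : ∀ {m} (π : Fin m → Functional) ω → (∀ x → x ≈ combine (λ j → on (π j) x) ω) →
    ∀ x → on trace x ≡ Σℚ.sum (λ j → on (π j) (x *ᴷ ω j))
  trace-dual π ω expands x = EQ.begin
      Σℚ.sum (λ i → coords (basis i *ᴷ x) i)
        EQ.≡⟨ Σℚ.sum-cong-≗ (λ i → trans (on-cong (coord i) (≈-trans (*-comm (basis i) x)
          (*-congˡ (expands (basis i)))))
             (on-combine (coord i ∘* x) (λ j → on (π j) (basis i)) ω)) ⟩
      Σℚ.sum (λ i → Σℚ.sum (λ j → on (π j) (basis i) * coords (x *ᴷ ω j) i))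
        EQ.≡⟨ Σℚ.∑-comm (λ i j → on (π j) (basis i) * coords (x *ᴷ ω j) i) ⟩
      Σℚ.sum (λ j → Σℚ.sum (λ i → on (π j) (basis i) * coords (x *ᴷ ω j) i))
        EQ.≡⟨ Σℚ.sum-cong-≗ (λ j → trans (Σℚ.sum-cong-≗ (λ i → ℚ.*-comm (on (π j) (basis i))
          (coords (x *ᴷ ω j) i)))
             (sym (on-expand (π j) (x *ᴷ ω j)))) ⟩
      Σℚ.sum (λ j → on (π j) (x *ᴷ ω j)) EQ.∎

  -- The largest subgroup of the lattice of the basis that is stable under x.
  stable : Carrier → Subgroup Level.zero
  stable x = record
    { Mem   = λ y → ∀ k i → IsInt (coords (x ^ᴷ k *ᴷ y) i)
    ; zero∈ = λ k i → int-resp (sym (trans (on-cong (coord i) (zeroʳ (x ^ᴷ k))) (on-0 (coord i))))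
      (int 0ℤ)
    ; comb∈ = λ a {y} {z} y∈ z∈ k i → int-resp (sym (comb-value (coord i ∘* (x ^ᴷ k)) (fromℤ a) y
      z))
        (int-sub (y∈ k i) (int-* (int a) (z∈ k i)))
    }

  -- `stable x` has full rank, because N clears the denominators of all xᵏ times a basis vector. In
  -- a basis of it multiplication by x has an integral matrix, and by `trace-dual` the trace may be
  -- computed there.
  trace-int : ∀ {x} → 𝒪 K x → IsInt (on trace x)
  trace-int {x} x∈𝒪 = decidable-stable (int? (on trace x)) λ ¬int →
      coordinates (stable x) coord (λ {y} y∈ i → int-resp (on-cong (coord i) (*-identityˡ y))
        (y∈ 0 i)) indep λ C → ¬int (integral C)
    where
    D = proj₁ (𝒪⇒bounded x∈𝒪)
    γ = proj₁ structure-denominator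
    N : ℚ
    N = ℕ⁺ γ * 1ℚ * ℕ⁺ D
    N≢0 : ¬ N ≡ 0ℚ
    N≢0 eq = ℕ⁺-≢0 D (zero-product (ℕ⁺ γ * 1ℚ) (ℕ⁺ D) eq
      (λ eq → ℕ⁺-≢0 γ (trans (sym (ℚ.*-identityʳ (ℕ⁺ γ))) eq)))
    basis-lattice : ∀ i → Lattice 1ℚ (basis i)
    basis-lattice i = lattice λ j → int-resp (sym (trans (ℚ.*-identityˡ _) (coord-basis j i)))
      (δ-int i j)
    indep : Independent (stable x) coord
    indep i = N · basis i ,
      (λ k j → int-resp (sym (on-· (coord j ∘* (x ^ᴷ k)) N (basis i)))
        (at (lattice-* (proj₂ (𝒪⇒bounded x∈𝒪) k) (basis-lattice i)) j)) ,
      (λ eq → N≢0 (trans (sym (trans (value i) (trans (cong (N *_) (δ-refl i)) (ℚ.*-identityʳ N))))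
        eq)) ,
      (λ j j≢i → trans (value j) (trans (cong (N *_) (δ-≢ (j≢i ∘ sym))) (ℚ.*-zeroʳ N)))
      where
      value : ∀ j → coords (N · basis i) j ≡ N * δ i j
      value j = trans (on-· (coord j) N (basis i)) (cong (N *_) (coord-basis j i))
    integral : Coordinates (stable x) coord → IsInt (on trace x)
    integral C = int-resp (sym (trace-dual π dual (dual-expand C coords≡0⇒≈0) x))
        (Σℚ-int _ λ j → π-int (λ k i → int-resp (on-cong (coord i) (≈-trans (*-congʳ (^-suc′ k))
          (*-assoc (x ^ᴷ k) x (dual j))))
          (dual∈ j (suc k) i)) j)
      where
      open Coordinates C
      ^-suc′ : ∀ k → x ^ᴷ suc k ≈ x ^ᴷ k *ᴷ x
      ^-suc′ k = *-comm x (x ^ᴷ k)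

  trace-1 : on trace 1ᴷ ≡ ℕ→ℚ n
  trace-1 = trans (Σℚ.sum-cong-≗ (λ i → trans (on-cong (coord i) (*-identityʳ (basis i)))
    (trans (coord-basis i i) (δ-refl i)))) (Σℚ-1 n)

  trace-1≢0 : ¬ on trace 1ᴷ ≡ 0ℚ
  trace-1≢0 eq = ℕ→ℚ-≢0 n {{Fin.nonZeroIndex (proj₁ 1-coord)}} (trans (sym trace-1) eq)

  -- A linear relation between f and the functionals trace (basis i _) must
  -- involve f, because trace (z z⁻¹) = n ≠ 0 for z ≠ 0.
  trace-represents : ∀ f → ∃[ z ] ∃[ a ] ¬ a ≡ 0ℚ × (∀ x → on trace (z *ᴷ x) ≡ a * on f x)
  trace-represents f = z , - a zero ,
    (λ eq → a₀≢0 (trans (solve 1 (λ a → a := :- (:- a)) refl (a zero)) (cong -_ eq))) , value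
    where
    v : Fin (suc n) → Fin n → ℚ
    v zero    j = on f (basis j)
    v (suc i) j = on trace (basis i *ᴷ basis j)
    R = linear-relation v
    a = proj₁ R
    rel = proj₂ (proj₂ R)
    z : Carrier
    z = combine (a ∘ suc) basis
    s : Fin n → ℚ
    s j = Σℚ.sum (λ i → a (suc i) * on trace (basis i *ᴷ basis j))
    on-basis : ∀ j → on trace (z *ᴷ basis j) ≡ - a zero * on f (basis j)
    on-basis j = trans (on-cong trace (*-comm z (basis j)))
      (trans (on-combine (trace ∘* basis j) (a ∘ suc) basis)
      (trans (Σℚ.sum-cong-≗ (λ i → cong (a (suc i) *_)
        (on-cong trace (*-comm (basis j) (basis i)))))
      (p-q≡0⇒p≡q (s j) (- a zero * on f (basis j))
        (trans (solve 3 (λ s a b → s :- (:- a) :* b := a :* b :+ s) refl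
        (s j) (a zero) (on f (basis j))) (rel j)))))
    value : ∀ x → on trace (z *ᴷ x) ≡ - a zero * on f x
    value x = trans (on-expand (trace ∘* z) x)
      (trans (Σℚ.sum-cong-≗ (λ i → trans (cong (coords x i *_) (on-basis i))
        (solve 3 (λ x a b → x :* (a :* b) := a :* (x :* b)) refl (coords x i) (- a zero)
          (on f (basis i)))))
      (trans (sym (Σℚ.*-distribˡ-sum (- a zero) (λ i → coords x i * on f (basis i))))
        (cong (- a zero *_) (sym (on-expand f x)))))
    a₀≢0 : ¬ a zero ≡ 0ℚ
    a₀≢0 a₀≡0 = invertible z≉0 λ (y , zy≈1) → trace-1≢0 (trans (on-cong trace (≈-sym zy≈1))
        (trans (value y) (trans (cong (λ b → - b * on f y) a₀≡0) (ℚ.*-zeroˡ (on f y)))))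
      where
      z≉0 : ¬ z ≈ 0ᴷ
      z≉0 z≈0 = proj₂ (proj₁ (proj₂ R)) (a≡0 (proj₁ (proj₁ (proj₂ R))))
        where
        a≡0 : ∀ i → a i ≡ 0ℚ
        a≡0 zero    = a₀≡0
        a≡0 (suc i) = independent (a ∘ suc) z≈0 i

  -- Bounds the denominators of f on 𝒪: f is a multiple of x ↦ trace (z x), and after scaling z into
  -- 𝒪 this takes integral values there.
  integral-multiple : ∀ f → ∃[ a ] ¬ a ≡ 0ℚ × (∀ {x} → 𝒪 K x → IsInt (a * on f x))
  integral-multiple f = go (trace-represents f)
    where
    go : ∃[ z ] ∃[ a ] ¬ a ≡ 0ℚ × (∀ x → on trace (z *ᴷ x) ≡ a * on f x) → ∃[ a ] ¬ a ≡ 0ℚ ×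
      (∀ {x} → 𝒪 K x → IsInt (a * on f x))
    go (z , a , a≢0 , value) = ℕ⁺ d * a , (λ eq → a≢0 (zero-product (ℕ⁺ d) a eq (ℕ⁺-≢0 d))) , λ {x}
      x∈ → int-resp
        (trans (on-cong trace (*-assoc _ z x)) (trans (on-· trace (ℕ⁺ d) (z *ᴷ x))
          (trans (cong (ℕ⁺ d *_) (value x)) (sym (ℚ.*-assoc (ℕ⁺ d) a (on f x))))))
        (trace-int (𝒪-* (proj₂ (𝒪-multiple z)) x∈))
      where
      d : ℕ
      d = proj₁ (𝒪-multiple z)

  𝒪-subgroup : Subgroup ℓ₁
  𝒪-subgroup = record { Mem = 𝒪 K ; zero∈ = 𝒪-0 ; comb∈ = λ a x∈ y∈ → 𝒪-sub x∈ (𝒪-* (𝒪-ℤ a) y∈) }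

-- An isomorphism 𝒪/ℤ → ℤᵐ.
record IntegralCoordinates {c ℓ₁ ℓ₂ n} (K : NumberField c ℓ₁ ℓ₂ n) (m : ℕ) : Set (c ⊔ ℓ₁) where
  open Field K
  field
    π       : Fin m → Functional
    π-int   : ∀ {x} → 𝒪 K x → ∀ i → IsInt (on (π i) x)
    dual    : Fin m → Carrier
    dual∈   : ∀ j → 𝒪 K (dual j)
    π-dual  : ∀ i j → on (π i) (dual j) ≡ δ j i
    π-1     : ∀ i → on (π i) 1ᴷ ≡ 0ℚ
    π≡0⇒ℤ   : ∀ {x} → 𝒪 K x → (∀ i → on (π i) x ≡ 0ℚ) → ∃[ a ] x ≈ ι (fromℤ a)

-- Coordinates on 𝒪/ℤ.

module _ {c ℓ₁ ℓ₂ m} (K : NumberField c ℓ₁ ℓ₂ (suc m)) where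
  open Field K

  private
    i₀ : Fin (suc m)
    i₀ = proj₁ 1-coord

    e : Fin (suc m) → ℚ
    e = coords 1ᴷ

    h : ℚ
    h = proj₁ (inverse (e i₀) (proj₂ 1-coord))

    he≡1 : h * e i₀ ≡ 1ℚ
    he≡1 = proj₂ (inverse (e i₀) (proj₂ 1-coord))

    -- Coordinates on K/ℚ: 1ᴷ takes the place of `basis i₀` in the basis, where i₀ is a coordinate
    -- in which 1ᴷ does not vanish.
    ψ : Fin m → Functional
    ψ j = coord (Fin.punchIn i₀ j) ⊟[ e (Fin.punchIn i₀ j) * h ] coord i₀

    ψ-1 : ∀ j → on (ψ j) 1ᴷ ≡ 0ℚ
    ψ-1 j = trans (cong (λ z → e (Fin.punchIn i₀ j) - z) (trans (ℚ.*-assoc (e (Fin.punchIn i₀ j)) h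
      (e i₀))
        (trans (cong (e (Fin.punchIn i₀ j) *_) he≡1) (ℚ.*-identityʳ (e (Fin.punchIn i₀ j))))))
      (ℚ.+-inverseʳ (e (Fin.punchIn i₀ j)))

    ψ-basis : ∀ j l → on (ψ j) (basis (Fin.punchIn i₀ l)) ≡ δ l j
    ψ-basis j l = trans (cong₂ (λ a b → a - e (Fin.punchIn i₀ j) * h * b)
      (coord-basis (Fin.punchIn i₀ j) (Fin.punchIn i₀ l))
        (trans (coord-basis i₀ (Fin.punchIn i₀ l)) (δ-≢ (Fin.punchInᵢ≢i i₀ l))))
      (trans (solve 2 (λ a b → a :- b :* con 0ℚ := a) refl (δ (Fin.punchIn i₀ l) (Fin.punchIn i₀ j))
        (e (Fin.punchIn i₀ j) * h))
        (δ-punchIn i₀ l j))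
      where
      δ-punchIn : ∀ {m} (i : Fin (suc m)) j k → δ (Fin.punchIn i j) (Fin.punchIn i k) ≡ δ j k
      δ-punchIn zero    j       k       = refl
      δ-punchIn (suc i) zero    zero    = refl
      δ-punchIn (suc i) zero    (suc k) = refl
      δ-punchIn (suc i) (suc j) zero    = refl
      δ-punchIn (suc i) (suc j) (suc k) = δ-punchIn i j k

    ψ≡0⇒ℚ : ∀ {x} → (∀ j → on (ψ j) x ≡ 0ℚ) → x ≈ ι (coords x i₀ * h)
    ψ≡0⇒ℚ {x} ψx≡0 = coords-≡⇒≈ λ i → trans (all i)
      (sym (trans (on-cong (coord i) (≈-sym (*-identityʳ (ι q)))) (on-· (coord i) q 1ᴷ)))
      where
      q : ℚ
      q = coords x i₀ * h
      pᵢ : ∀ {i} → ¬ i₀ ≡ i → Fin (suc m)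
      pᵢ i₀≢i = Fin.punchIn i₀ (Fin.punchOut i₀≢i)
      all : ∀ i → coords x i ≡ q * e i
      all i with i₀ Fin.≟ i
      ... | yes refl = sym (trans (ℚ.*-assoc (coords x i₀) h (e i₀))
        (trans (cong (coords x i₀ *_) he≡1) (ℚ.*-identityʳ (coords x i₀))))
      ... | no i₀≢i = subst (λ i → coords x i ≡ q * e i) (Fin.punchIn-punchOut i₀≢i)
        (trans (p-q≡0⇒p≡q (coords x (pᵢ i₀≢i)) (e (pᵢ i₀≢i) * h * coords x i₀)
          (ψx≡0 (Fin.punchOut i₀≢i)))
          (solve 3 (λ a b c → a :* b :* c := c :* b :* a) refl (e (pᵢ i₀≢i)) h (coords x i₀)))

    a : Fin m → ℚ
    a j = proj₁ (integral-multiple (ψ j))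

    φ : Fin m → Functional
    φ j = scale (a j) (ψ j)

    φ≡0⇒ψ≡0 : ∀ {x} j → on (φ j) x ≡ 0ℚ → on (ψ j) x ≡ 0ℚ
    φ≡0⇒ψ≡0 {x} j eq = zero-product (a j) (on (ψ j) x) eq (proj₁ (proj₂ (integral-multiple (ψ j))))

    φ-independent : Independent 𝒪-subgroup φ
    φ-independent i = ℕ⁺ d · b , proj₂ (𝒪-multiple b) ,
        (λ eq → ℕ⁺-≢0 d (trans (sym (trans (cong (ℕ⁺ d *_) (δ-refl i)) (ℚ.*-identityʳ (ℕ⁺ d))))
          (trans (sym (value i)) (φ≡0⇒ψ≡0 i eq)))) ,
        λ j j≢i → trans (cong (a j *_) (trans (value j) (trans (cong (ℕ⁺ d *_) (δ-≢ (j≢i ∘ sym)))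
          (ℚ.*-zeroʳ (ℕ⁺ d))))) (ℚ.*-zeroʳ (a j))
      where
      b : Carrier
      b = basis (Fin.punchIn i₀ i)
      d : ℕ
      d = proj₁ (𝒪-multiple b)
      value : ∀ j → on (ψ j) (ℕ⁺ d · b) ≡ ℕ⁺ d * δ i j
      value j = trans (on-· (ψ j) (ℕ⁺ d) b) (cong (ℕ⁺ d *_) (ψ-basis j i))

  -- `φ` is `ψ` rescaled to be integral on 𝒪, which makes `coordinates` applicable. The common
  -- kernel is ℚ, and rational elements of 𝒪 are integers by `rational-integer`.
  integral-coordinates : ¬ ¬ IntegralCoordinates K m
  integral-coordinates none = coordinates 𝒪-subgroup φ
    (λ x∈ i → proj₂ (proj₂ (integral-multiple (ψ i))) x∈) φ-independent λ C →
    let open Coordinates C in none record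
      { π = π ; π-int = π-int ; dual = dual ; dual∈ = dual∈ ; π-dual = π-dual
      ; π-1 = φ≡0⇒π≡0 λ i → trans (cong (a i *_) (ψ-1 i)) (ℚ.*-zeroʳ (a i))
      ; π≡0⇒ℤ = λ {x} x∈ πx≡0 →
          let eq = ψ≡0⇒ℚ (λ j → φ≡0⇒ψ≡0 j (π≡0⇒φ≡0 πx≡0 j))
              (z , q≡z) = rational-integer (coords x i₀ * h) (𝒪-resp eq x∈)
          in z , ≈-trans eq (ι-cong q≡z)
      }

-- Orders between ℤ + P²𝒪 and ℤ + P𝒪

infix 4 _∣ℚ_
record _∣ℚ_ (d : ℕ) (q : ℚ) : Set where
  constructor mk∣ℚ
  field
    ratioℤ   : ℤ
    equation : q ≡ ℕ→ℚ d * fromℤ ratioℤ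

∣ℚ-resp : ∀ {d p q} → p ≡ q → d ∣ℚ p → d ∣ℚ q
∣ℚ-resp refl h = h

∣ℚ-0 : ∀ {d} → d ∣ℚ 0ℚ
∣ℚ-0 {d} = mk∣ℚ 0ℤ $ sym (ℚ.*-zeroʳ (ℕ→ℚ d))

∣ℚ-+ : ∀ {d p q} → d ∣ℚ p → d ∣ℚ q → d ∣ℚ p + q
∣ℚ-+ {d} (mk∣ℚ s refl) (mk∣ℚ t refl) = mk∣ℚ (s ℤ.+ t) $ trans
  (sym (ℚ.*-distribˡ-+ (ℕ→ℚ d) (fromℤ s) (fromℤ t))) (cong (ℕ→ℚ d *_) (sym (fromℤ-+ s t)))

∣ℚ-*ˡ : ∀ {d p q} → IsInt p → d ∣ℚ q → d ∣ℚ p * q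
∣ℚ-*ˡ {d} (s , refl) (mk∣ℚ t refl) = mk∣ℚ (s ℤ.* t) $ trans
  (solve 3 (λ s d t → s :* (d :* t) := d :* (s :* t)) refl (fromℤ s) (ℕ→ℚ d) (fromℤ t))
    (cong (ℕ→ℚ d *_) (sym (fromℤ-* s t)))

∣ℚ-neg : ∀ {d q} → d ∣ℚ q → d ∣ℚ - q
∣ℚ-neg {d} (mk∣ℚ t refl) = mk∣ℚ (ℤ.- t) $ trans (ℚ.neg-distribʳ-* (ℕ→ℚ d) (fromℤ t))
  (cong (ℕ→ℚ d *_) (sym (fromℤ-neg t)))

∣ℚ-sub : ∀ {d p q} → d ∣ℚ p → d ∣ℚ q → d ∣ℚ p - q
∣ℚ-sub h k = ∣ℚ-+ h (∣ℚ-neg k)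

∣ℚ-Σ : ∀ {d n} (q : Fin n → ℚ) → (∀ i → d ∣ℚ q i) → d ∣ℚ Σℚ.sum q
∣ℚ-Σ {n = zero}  q h = ∣ℚ-0
∣ℚ-Σ {n = suc n} q h = ∣ℚ-+ (h zero) (∣ℚ-Σ (q ∘ suc) (h ∘ suc))

ℕ→ℚ-* : ∀ a b → ℕ→ℚ (a ℕ.* b) ≡ ℕ→ℚ a * ℕ→ℚ b
ℕ→ℚ-* a b = trans (cong fromℤ (ℤ.pos-* a b)) (fromℤ-* (+ a) (+ b))

residue : ∀ d .{{_ : ℕ.NonZero d}} {q} → IsInt q → Fin d
residue d (z , _) = Fin.fromℕ< (ℤ.n%ℕd<d z d)

residue-∣ : ∀ d .{{_ : ℕ.NonZero d}} {q} (h : IsInt q) → d ∣ℚ q - ℕ→ℚ (Fin.toℕ (residue d h))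
residue-∣ d (z , refl) = mk∣ℚ (z ℤ./ℕ d) $ trans
  (cong₂ _-_ (trans (cong fromℤ (ℤ.a≡a%ℕn+[a/ℕn]*n z d))
    (trans (fromℤ-+ (+ (z ℤ.%ℕ d)) ((z ℤ./ℕ d) ℤ.* + d)) (cong (λ a → ℕ→ℚ (z ℤ.%ℕ d) + a)
      (fromℤ-* (z ℤ./ℕ d) (+ d)))))
    (cong ℕ→ℚ (Fin.toℕ-fromℕ< (ℤ.n%ℕd<d z d))))
  (solve 3 (λ r q d → (r :+ q :* d) :- r := d :* q) refl (ℕ→ℚ (z ℤ.%ℕ d)) (fromℤ (z ℤ./ℕ d))
    (ℕ→ℚ d))

residue-unique : ∀ {d} (r s : Fin d) → d ∣ℚ ℕ→ℚ (Fin.toℕ r) - ℕ→ℚ (Fin.toℕ s) → r ≡ s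
residue-unique {d} r s (mk∣ℚ t eq) = Fin.toℕ-injective ([ ordered r s d∣r⊖s ,
  (λ s≤r → sym (ordered s r (subst (d ℕ.∣_) (ℤ.∣m⊖n∣≡∣n⊖m∣ (Fin.toℕ r) (Fin.toℕ s)) d∣r⊖s) s≤r)) ]′
    (ℕ.≤-total (Fin.toℕ r) (Fin.toℕ s)))
  where
  d∣r⊖s : d ℕ.∣ ℤ.∣ Fin.toℕ r ℤ.⊖ Fin.toℕ s ∣
  d∣r⊖s = ∣⇒∣ᵤ (divides t (trans (sym (ℤ.m-n≡m⊖n (Fin.toℕ r) (Fin.toℕ s))) (fromℤ-injective (begin
    fromℤ (+ Fin.toℕ r ℤ.- + Fin.toℕ s)              ≡⟨ fromℤ-+ (+ Fin.toℕ r) (ℤ.- + Fin.toℕ s) ⟩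
    ℕ→ℚ (Fin.toℕ r) + fromℤ (ℤ.- + Fin.toℕ s)        ≡⟨ cong (λ a → ℕ→ℚ (Fin.toℕ r) + a)
      (fromℤ-neg (+ Fin.toℕ s)) ⟩
    ℕ→ℚ (Fin.toℕ r) - ℕ→ℚ (Fin.toℕ s)                ≡⟨ trans eq (ℚ.*-comm (ℕ→ℚ d) (fromℤ t)) ⟩
    fromℤ t * ℕ→ℚ d                                  ≡⟨ fromℤ-* t (+ d) ⟨
    fromℤ (t ℤ.* + d)                                ∎))))
    where open ≡-Reasoning
  ordered : ∀ (r s : Fin d) → d ℕ.∣ ℤ.∣ Fin.toℕ r ℤ.⊖ Fin.toℕ s ∣ → Fin.toℕ r ℕ.≤ Fin.toℕ s →
    Fin.toℕ r ≡ Fin.toℕ s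
  ordered r s h r≤s = ℕ.≤-antisym r≤s (ℕ.m∸n≡0⇒m≤n (small (subst (d ℕ.∣_) (ℤ.∣⊖∣-≤ r≤s) h)
      (ℕ.≤-<-trans (ℕ.m∸n≤m (Fin.toℕ s) (Fin.toℕ r)) (Fin.toℕ<n s))))
    where
    small : ∀ {m} → d ℕ.∣ m → m ℕ.< d → m ≡ 0
    small {zero}  _ _   = refl
    small {suc m} h m<d = contradiction h (ℕ.>⇒∤ m<d)

funToFin-cong : ∀ {m n} {f g : Fin m → Fin n} → (∀ i → f i ≡ g i) → Fin.funToFin f ≡ Fin.funToFin g
funToFin-cong {zero}  h = refl
funToFin-cong {suc m} h = cong₂ Fin.combine (h zero) (funToFin-cong (h ∘ suc))

finToFun-injective : ∀ {m n} (k l : Fin (m ℕ.^ n)) → (∀ i → Fin.finToFun {m} {n} k i ≡ Fin.finToFun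
  {m} {n} l i) → k ≡ l
finToFun-injective {m} {n} k l h = trans (sym (Fin.funToFin-finToFin {n} {m} k))
  (trans (funToFin-cong h) (Fin.funToFin-finToFin {n} {m} l))

module Orders {c ℓ₁ ℓ₂ n} (K : NumberField c ℓ₁ ℓ₂ n) {e d} (IC : IntegralCoordinates K (e ℕ.+ d))
  (P : ℕ) .{{_ : ℕ.NonZero P}} where
  open Field K
  open IntegralCoordinates IC
  open SetoidReasoning setoid

  Q : ℕ
  Q = P ℕ.* P

  instance
    Q≢0 : ℕ.NonZero Q
    Q≢0 = ℕ.m*n≢0 P P

  𝒪-+ : ∀ {x y} → 𝒪 K x → 𝒪 K y → 𝒪 K (x +ᴷ y)
  𝒪-+ {x} {y} x∈ y∈ = 𝒪-resp (K-solve 2 (λ x y → x ⊕ ⊝ (K-con 0ℚ ⊕ ⊝ y) ⊜ x ⊕ y) ≈-refl x y)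
    (𝒪-sub x∈ (𝒪-sub (𝒪-ℤ 0ℤ) y∈))

  𝒪-combine : ∀ {m} (a : Fin m → ℚ) (v : Fin m → Carrier) → (∀ i → IsInt (a i)) → (∀ i → 𝒪 K (v i))
    → 𝒪 K (combine a v)
  𝒪-combine {zero}  a v a-int v∈ = 𝒪-0
  𝒪-combine {suc m} a v a-int v∈ = 𝒪-+
    (𝒪-* (𝒪-resp (ι-cong (sym (proj₂ (a-int zero)))) (𝒪-ℤ (proj₁ (a-int zero)))) (v∈ zero))
    (𝒪-combine (a ∘ suc) (v ∘ suc) (a-int ∘ suc) (v∈ ∘ suc))

  -- The element of 𝒪, unique modulo ℤ, with given coordinates.
  point : (Fin (e ℕ.+ d) → ℚ) → Carrier
  point v = combine v dual

  π-point : ∀ v i → on (π i) (point v) ≡ v i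
  π-point v i = trans (on-combine (π i) v dual)
    (trans (Σℚ.sum-cong-≗ (λ j → cong (v j *_) (π-dual i j))) (Σℚ-δ v i))

  -- The inclusion in ℤ + P𝒪: dividing the coordinates by P yields x′, and x - P x′ has all
  -- coordinates zero, so it is an integer.
  decompose : ∀ {x} → 𝒪 K x → (∀ i → P ∣ℚ on (π i) x) → ∃[ a ] ∃[ x′ ] 𝒪 K x′ × x ≈ ι (fromℤ a) +ᴷ
    ℕ→ℚ P · x′
  decompose {x} x∈ P∣π = proj₁ rest , x′ , x′∈ , (begin
      x                                 ≈⟨ K-solve 2 (λ x y → x ⊜ (x ⊕ ⊝ y) ⊕ y) ≈-refl x
        (ℕ→ℚ P · x′) ⟩
      (x -ᴷ ℕ→ℚ P · x′) +ᴷ ℕ→ℚ P · x′   ≈⟨ +-congʳ (proj₂ rest) ⟩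
      ι (fromℤ (proj₁ rest)) +ᴷ ℕ→ℚ P · x′ ∎)
    where
    v : Fin (e ℕ.+ d) → ℚ
    v i = fromℤ (_∣ℚ_.ratioℤ (P∣π i))
    x′ : Carrier
    x′ = point v
    x′∈ : 𝒪 K x′
    x′∈ = 𝒪-combine v dual (λ i → int (_∣ℚ_.ratioℤ (P∣π i))) dual∈
    rest : ∃[ a ] x -ᴷ ℕ→ℚ P · x′ ≈ ι (fromℤ a)
    rest = π≡0⇒ℤ (𝒪-sub x∈ (𝒪-* (𝒪-ℤ (+ P)) x′∈)) λ i → trans (comb-value (π i) (ℕ→ℚ P) x x′)
      (trans (cong₂ (λ a b → a - ℕ→ℚ P * b) (_∣ℚ_.equation (P∣π i)) (π-point v i))
        (ℚ.+-inverseʳ (ℕ→ℚ P * v i)))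

  η : Fin e → Functional
  η j = π (j Fin.↑ˡ d)

  -- The order {x ∈ 𝒪 : y ≡ 0 mod P, z ≡ A y mod P²}, where the coordinates of x
  -- in 𝒪/ℤ are split as (y, z).
  module _ (A : Fin e → Fin d → Fin P) where

    entry : Fin e → Fin d → ℚ
    entry j i = ℕ→ℚ (Fin.toℕ (A j i))

    entry-int : ∀ j i → IsInt (entry j i)
    entry-int j i = int (+ Fin.toℕ (A j i))

    -- The defect z - A y. With η it again forms integral coordinates on 𝒪/ℤ, in which the two
    -- congruences are independent; `Point` inverts this change of coordinates by adding A y back.
    ζ : Fin d → Functional
    ζ i = π (e Fin.↑ʳ i) ⊟[ 1ℚ ] ⨁ (λ j → scale (entry j i) (η j))

    π-ζ : ∀ i x → on (π (e Fin.↑ʳ i)) x ≡ on (ζ i) x + Σℚ.sum (λ j → entry j i * on (η j) x)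
    π-ζ i x = solve 2 (λ p s → p := (p :- con 1ℚ :* s) :+ s) refl (on (π (e Fin.↑ʳ i)) x)
      (Σℚ.sum (λ j → entry j i * on (η j) x))

    ζ-int : ∀ {x} → 𝒪 K x → ∀ i → IsInt (on (ζ i) x)
    ζ-int {x} x∈ i = int-sub (π-int x∈ _) (int-* (int 1ℤ) (Σℚ-int (λ j → entry j i * on (η j) x) λ j
      → int-* (entry-int j i) (π-int x∈ _)))

    ζ-1 : ∀ i → on (ζ i) 1ᴷ ≡ 0ℚ
    ζ-1 i = cong₂ (λ a b → a - 1ℚ * b) (π-1 (e Fin.↑ʳ i))
      (Σℚ-0 λ j → trans (cong (entry j i *_) (π-1 (j Fin.↑ˡ d))) (ℚ.*-zeroʳ (entry j i)))

    member : Carrier → Set ℓ₁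
    member x = 𝒪 K x × (∀ j → P ∣ℚ on (η j) x) × (∀ i → Q ∣ℚ on (ζ i) x)

    Q∣⇒P∣ : ∀ {q} → Q ∣ℚ q → P ∣ℚ q
    Q∣⇒P∣ (mk∣ℚ t refl) = mk∣ℚ (+ P ℤ.* t) $ trans (cong (_* fromℤ t) (ℕ→ℚ-* P P))
      (trans (ℚ.*-assoc (ℕ→ℚ P) (ℕ→ℚ P) (fromℤ t)) (cong (ℕ→ℚ P *_) (sym (fromℤ-* (+ P) t))))

    member⇒P∣π : ∀ {x} → member x → ∀ i → P ∣ℚ on (π i) x
    member⇒P∣π {x} (x∈ , P∣η , Q∣ζ) i with Fin.splitAt e i in eq
    ... | inj₁ j = subst (λ i → P ∣ℚ on (π i) x) (Fin.splitAt⁻¹-↑ˡ eq) (P∣η j)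
    ... | inj₂ k = subst (λ i → P ∣ℚ on (π i) x) (Fin.splitAt⁻¹-↑ʳ {e} {d} eq)
      (∣ℚ-resp (sym (π-ζ k x))
      (∣ℚ-+ (Q∣⇒P∣ (Q∣ζ k)) (∣ℚ-Σ (λ j → entry j k * on (η j) x) (λ j → ∣ℚ-*ˡ (entry-int j k)
        (P∣η j)))))

    -- (a + P x′)(b + P y′) = a(b + P y′) + b(a + P x′) − ab + P² x′ y′
    product-value : ∀ f → on f 1ᴷ ≡ 0ℚ → ∀ {x y x′ y′} a b →
      x ≈ ι a +ᴷ ℕ→ℚ P · x′ → y ≈ ι b +ᴷ ℕ→ℚ P · y′ →
      on f (x *ᴷ y) ≡ (a * on f y + b * on f x) + ℕ→ℚ Q * on f (x′ *ᴷ y′)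
    product-value f f1 {x} {y} {x′} {y′} a b ex ey = trans (on-cong f eq)
      (trans (on-+ f _ _) (cong₂ _+_
        (trans (on-+ f _ _) (trans
        (cong₂ _+_ (trans (on-+ f _ _) (cong₂ _+_ (on-· f a y) (on-· f b x)))
          (trans (on-· f (- (a * b)) 1ᴷ) (trans (cong (- (a * b) *_) f1) (ℚ.*-zeroʳ (- (a * b))))))
        (ℚ.+-identityʳ (a * on f y + b * on f x)))) (on-· f (ℕ→ℚ Q) (x′ *ᴷ y′))))
      where
      r : ℚ
      r = ℕ→ℚ P
      eq : x *ᴷ y ≈ ((a · y +ᴷ b · x) +ᴷ (- (a * b)) · 1ᴷ) +ᴷ ℕ→ℚ Q · (x′ *ᴷ y′)
      eq = begin
        x *ᴷ y
          ≈⟨ *-cong ex ey ⟩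
        (ι a +ᴷ r · x′) *ᴷ (ι b +ᴷ r · y′)
          ≈⟨ K-solve 5 (λ a b r x y → (a ⊕ r ⊗ x) ⊗ (b ⊕ r ⊗ y) ⊜
            ((a ⊗ (b ⊕ r ⊗ y) ⊕ b ⊗ (a ⊕ r ⊗ x)) ⊕ ⊝ (a ⊗ b)) ⊕ (r ⊗ r) ⊗ (x ⊗ y))
               ≈-refl (ι a) (ι b) (ι r) x′ y′ ⟩
        ((a · (ι b +ᴷ r · y′) +ᴷ b · (ι a +ᴷ r · x′)) +ᴷ (-ᴷ (ι a *ᴷ ι b))) +ᴷ (ι r *ᴷ ι r) *ᴷ
          (x′ *ᴷ y′)
          ≈⟨ +-cong (+-cong (+-cong (*-congˡ (≈-sym ey)) (*-congˡ (≈-sym ex)))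
               (≈-trans (-‿cong (≈-sym (ι-* a b))) (≈-trans (≈-sym (ι-neg (a * b)))
                 (≈-sym (*-identityʳ _)))))
               (*-congʳ (≈-trans (≈-sym (ι-* r r)) (ι-cong (sym (ℕ→ℚ-* P P))))) ⟩
        ((a · y +ᴷ b · x) +ᴷ (- (a * b)) · 1ᴷ) +ᴷ ℕ→ℚ Q · (x′ *ᴷ y′) ∎

    isUnitalSubring : IsUnitalSubring K member
    isUnitalSubring = record
      { resp = λ eq (x∈ , P∣η , Q∣ζ) → 𝒪-resp eq x∈ , (λ j → ∣ℚ-resp (on-cong (η j) eq) (P∣η j)) ,
        (λ i → ∣ℚ-resp (on-cong (ζ i) eq) (Q∣ζ i))
      ; ⊆𝒪   = proj₁
      ; 1∈   = 𝒪-1 , (λ j → ∣ℚ-resp (sym (π-1 _)) ∣ℚ-0) , (λ i → ∣ℚ-resp (sym (ζ-1 i)) ∣ℚ-0)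
      ; -∈   = λ {x} {y} (x∈ , P∣ηx , Q∣ζx) (y∈ , P∣ηy , Q∣ζy) → 𝒪-sub x∈ y∈ ,
          (λ j → ∣ℚ-resp (sym (on-sub (η j) x y)) (∣ℚ-sub (P∣ηx j) (P∣ηy j))) ,
          (λ i → ∣ℚ-resp (sym (on-sub (ζ i) x y)) (∣ℚ-sub (Q∣ζx i) (Q∣ζy i)))
      ; *∈   = *∈
      }
      where
      *∈ : ∀ {x y} → member x → member y → member (x *ᴷ y)
      *∈ {x} {y} mx@(x∈ , P∣ηx , Q∣ζx) my@(y∈ , P∣ηy , Q∣ζy) = go (decompose x∈ (member⇒P∣π mx))
        (decompose y∈ (member⇒P∣π my))
        where
        go : ∃[ a ] ∃[ x′ ] 𝒪 K x′ × x ≈ ι (fromℤ a) +ᴷ ℕ→ℚ P · x′ →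
          ∃[ b ] ∃[ y′ ] 𝒪 K y′ × y ≈ ι (fromℤ b) +ᴷ ℕ→ℚ P · y′ → member (x *ᴷ y)
        go (a , x′ , x′∈ , ex) (b , y′ , y′∈ , ey) = 𝒪-* x∈ y∈ ,
            (λ j → closed (η j) (π-1 _) (π-int (𝒪-* x′∈ y′∈) _) (P∣ηx j) (P∣ηy j) Q∣⇒P∣) ,
            (λ i → closed (ζ i) (ζ-1 i) (ζ-int (𝒪-* x′∈ y′∈) i) (Q∣ζx i) (Q∣ζy i) (λ h → h))
          where
          -- One argument for both congruences, with D equal to P for η and to Q for ζ: the mixed
          -- terms inherit divisibility by D from x and y, and the term with x′ y′ carries the
          -- factor Q.
          closed : ∀ f {D} → on f 1ᴷ ≡ 0ℚ → IsInt (on f (x′ *ᴷ y′)) → D ∣ℚ on f x → D ∣ℚ on f y →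
            (∀ {q} → Q ∣ℚ q → D ∣ℚ q) → D ∣ℚ on f (x *ᴷ y)
          closed f f1 (t , ft) D∣x D∣y weaken = ∣ℚ-resp (sym (product-value f f1 (fromℤ a) (fromℤ b)
            ex ey))
            (∣ℚ-+ (∣ℚ-+ (∣ℚ-*ˡ (int a) D∣y) (∣ℚ-*ˡ (int b) D∣x))
              (weaken (mk∣ℚ t (cong (ℕ→ℚ Q *_) ft))))

    module Point (y : Fin e → ℚ) (z : Fin d → ℚ) (y-int : ∀ j → IsInt (y j)) (z-int : ∀ i → IsInt
      (z i)) where

      shift : Fin d → ℚ
      shift i = z i + Σℚ.sum (λ j → entry j i * y j)

      vector : Fin (e ℕ.+ d) → ℚ
      vector k = [ y , shift ]′ (Fin.splitAt e k)

      vector-int : ∀ k → IsInt (vector k)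
      vector-int k with Fin.splitAt e k
      ... | inj₁ j = y-int j
      ... | inj₂ i = int-+ (z-int i) (Σℚ-int (λ j → entry j i * y j) λ j → int-* (entry-int j i)
        (y-int j))

      x : Carrier
      x = point vector

      x∈ : 𝒪 K x
      x∈ = 𝒪-combine vector dual vector-int dual∈

      ηx : ∀ j → on (η j) x ≡ y j
      ηx j = trans (π-point vector (j Fin.↑ˡ d)) (cong [ y , shift ]′ (Fin.splitAt-↑ˡ e j d))

      ζx : ∀ i → on (ζ i) x ≡ z i
      ζx i = trans (cong₂ (λ a b → a - 1ℚ * b) (trans (π-point vector (e Fin.↑ʳ i))
        (cong [ y , shift ]′ (Fin.splitAt-↑ʳ e d i)))
          (Σℚ.sum-cong-≗ (λ j → cong (entry j i *_) (ηx j))))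
        (solve 2 (λ z s → (z :+ s) :- con 1ℚ :* s := z) refl (z i) (Σℚ.sum (λ j → entry j i * y j)))

    index : ℕ
    index = P ℕ.^ e ℕ.* Q ℕ.^ d

    private
      module Rep (k : Fin index) where
        u : Fin e → Fin P
        u = Fin.finToFun (proj₁ (Fin.remQuot {P ℕ.^ e} (Q ℕ.^ d) k))
        v : Fin d → Fin Q
        v = Fin.finToFun (proj₂ (Fin.remQuot {P ℕ.^ e} (Q ℕ.^ d) k))
        open Point (λ j → ℕ→ℚ (Fin.toℕ (u j))) (λ i → ℕ→ℚ (Fin.toℕ (v i))) (λ j → int (+ Fin.toℕ (u j))) (λ i → int (+ Fin.toℕ (v i))) public

    -- (η, ζ) identifies 𝒪/ℤ with ℤᵉ × ℤᵈ, so a coset is given by the residues of η modulo P and of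
    -- ζ modulo Q. Its representative is the `Point` that has these residues as coordinates.
    hasIndex : HasIndex K member index
    hasIndex = Rep.x , Rep.x∈ , λ x x∈ → code x x∈ , (𝒪-sub x∈ (Rep.x∈ (code x x∈)) ,
        (λ j → ∣ℚ-resp (η-diff x x∈ j) (residue-∣ P (π-int x∈ (j Fin.↑ˡ d)))) ,
        (λ i → ∣ℚ-resp (ζ-diff x x∈ i) (residue-∣ Q (ζ-int x∈ i)))) ,
        λ {k} (_ , P∣η , Q∣ζ) → trans (cong₂ Fin.combine
            (trans (funToFin-cong (λ j → residue-unique _ (Rep.u k j)
              (∣ℚ-resp (difference (on (η j) x) (trans (on-sub (η j) x (Rep.x k))
              (cong (λ b → on (η j) x - b) (Rep.ηx k j))))
              (∣ℚ-sub (P∣η j) (residue-∣ P (π-int x∈ (j Fin.↑ˡ d)))))))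
              (Fin.funToFin-finToFin {e} {P} _))
            (trans (funToFin-cong (λ i → residue-unique _ (Rep.v k i)
              (∣ℚ-resp (difference (on (ζ i) x) (trans (on-sub (ζ i) x (Rep.x k))
              (cong (λ b → on (ζ i) x - b) (Rep.ζx k i))))
              (∣ℚ-sub (Q∣ζ i) (residue-∣ Q (ζ-int x∈ i))))))
              (Fin.funToFin-finToFin {d} {Q} _)))
          (Fin.combine-remQuot {P ℕ.^ e} (Q ℕ.^ d) k)
      where
      code : ∀ x → 𝒪 K x → Fin index
      code x x∈ = Fin.combine (Fin.funToFin (λ j → residue P (π-int x∈ (j Fin.↑ˡ d))))
        (Fin.funToFin (λ i → residue Q (ζ-int x∈ i)))
      u-code : ∀ x x∈ j → Rep.u (code x x∈) j ≡ residue P (π-int x∈ (j Fin.↑ˡ d))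
      u-code x x∈ j = trans (cong (λ k → Fin.finToFun (proj₁ k) j) (Fin.remQuot-combine {P ℕ.^ e}
        {Q ℕ.^ d} _ _)) (Fin.finToFun-funToFin _ j)
      v-code : ∀ x x∈ i → Rep.v (code x x∈) i ≡ residue Q (ζ-int x∈ i)
      v-code x x∈ i = trans (cong (λ k → Fin.finToFun (proj₂ k) i) (Fin.remQuot-combine {P ℕ.^ e}
        {Q ℕ.^ d} _ _)) (Fin.finToFun-funToFin _ i)
      η-diff : ∀ x x∈ j → on (η j) x - ℕ→ℚ (Fin.toℕ (residue P (π-int x∈ (j Fin.↑ˡ d)))) ≡ on (η j)
        (x -ᴷ Rep.x (code x x∈))
      η-diff x x∈ j = sym (trans (on-sub (η j) x (Rep.x (code x x∈))) (cong (λ b → on (η j) x - b)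
        (trans (Rep.ηx (code x x∈) j) (cong (λ r → ℕ→ℚ (Fin.toℕ r)) (u-code x x∈ j)))))
      ζ-diff : ∀ x x∈ i → on (ζ i) x - ℕ→ℚ (Fin.toℕ (residue Q (ζ-int x∈ i))) ≡ on (ζ i)
        (x -ᴷ Rep.x (code x x∈))
      ζ-diff x x∈ i = sym (trans (on-sub (ζ i) x (Rep.x (code x x∈))) (cong (λ b → on (ζ i) x - b)
        (trans (Rep.ζx (code x x∈) i) (cong (λ r → ℕ→ℚ (Fin.toℕ r)) (v-code x x∈ i)))))
      difference : ∀ {a b c} q → a ≡ q - c → a - (q - b) ≡ b - c
      difference {b = b} {c} q refl = solve 3 (λ b c q → (q :- c) :- (q :- b) := b :- c) refl b c q

    order : Order K index
    order = record { ⟦_⟧ = member ; isUnitalSubring = isUnitalSubring ; hasIndex = hasIndex }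

  -- The element with y = P times the j-th unit vector and z = A y belongs to the order of A. Its
  -- defect for B is P (A j i - B j i); divisibility by P² leaves the entries congruent modulo P,
  -- hence equal.
  order-injective : ∀ A B → member A ≐ member B → ∀ j i → A j i ≡ B j i
  order-injective A B (A⊆B , _) j i = residue-unique (A j i) (B j i)
    (quotient′ (proj₂ (proj₂ (A⊆B x∈A)) i))
    where
    y : Fin e → ℚ
    y j′ = ℕ→ℚ P * δ j′ j
    open Point A y (λ _ → 0ℚ) (λ j′ → int-* (int (+ P)) (δ-int j′ j)) (λ _ → int 0ℤ)
    x∈A : member A x
    x∈A = x∈ , (λ j′ → ∣ℚ-resp (sym (ηx j′)) (mk∣ℚ (proj₁ (δ-int j′ j))
      (cong (ℕ→ℚ P *_) (proj₂ (δ-int j′ j))))) ,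
      (λ i → ∣ℚ-resp (sym (ζx i)) ∣ℚ-0)
    Σy : ∀ (C : Fin e → Fin d → Fin P) → Σℚ.sum (λ j′ → entry C j′ i * on (η j′) x) ≡ ℕ→ℚ P * entry
      C j i
    Σy C = trans (Σℚ.sum-cong-≗ (λ j′ → trans (cong (entry C j′ i *_) (ηx j′))
        (solve 3 (λ a p t → a :* (p :* t) := p :* a :* t) refl (entry C j′ i) (ℕ→ℚ P) (δ j′ j))))
      (Σℚ-δ (λ j′ → ℕ→ℚ P * entry C j′ i) j)
    ζB : on (ζ B i) x ≡ ℕ→ℚ P * (entry A j i - entry B j i)
    ζB = trans (cong₂ (λ a b → a - 1ℚ * b) (trans (π-ζ A i x) (cong₂ _+_ (ζx i) (Σy A))) (Σy B))
      (solve 3 (λ p a b → (con 0ℚ :+ p :* a) :- con 1ℚ :* (p :* b) := p :* (a :- b)) refl (ℕ→ℚ P)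
        (entry A j i) (entry B j i))
    quotient′ : Q ∣ℚ on (ζ B i) x → P ∣ℚ entry A j i - entry B j i
    quotient′ (mk∣ℚ t eq) = mk∣ℚ t $ *-cancelˡ (ℕ→ℚ P) (ℕ→ℚ-≢0 P) (trans (sym ζB) (trans eq
      (trans (cong (_* fromℤ t) (ℕ→ℚ-* P P)) (ℚ.*-assoc (ℕ→ℚ P) (ℕ→ℚ P) (fromℤ t)))))

  -- Matrices are coded by numbers below (Pᵈ)ᵉ. As the enumeration of the orders is onto, each
  -- matrix receives the number of its order, and equal numbers mean equal orders, hence equal
  -- matrices.
  order-count : ∀ N → IsOrderCount K N → (P ℕ.^ d) ℕ.^ e ℕ.≤ N (P ℕ.^ e ℕ.* Q ℕ.^ d)
  order-count N counts = Fin.injective⇒≤ {f = λ k → proj₁ (surj k)} λ {k} {l} eq →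
      finToFun-injective {P ℕ.^ d} {e} k l λ j → finToFun-injective {P} {d} (Fin.finToFun k j)
        (Fin.finToFun l j) λ i → order-injective (matrix k) (matrix l) (same k l eq) j i
    where
    M : ℕ
    M = P ℕ.^ e ℕ.* Q ℕ.^ d
    module B = Bijection (counts M)
    matrix : Fin ((P ℕ.^ d) ℕ.^ e) → Fin e → Fin d → Fin P
    matrix k j = Fin.finToFun (Fin.finToFun k j)
    surj : ∀ k → ∃[ a ] _
    surj k = B.surjective (order (matrix k))
    module S = Setoid (orderSetoid K M)
    same : ∀ k l → proj₁ (surj k) ≡ proj₁ (surj l) → member (matrix k) ≐ member (matrix l)
    same k l eq = S.trans {order (matrix k)} {B.to (proj₁ (surj k))} {order (matrix l)}
      (S.sym {B.to (proj₁ (surj k))} {order (matrix k)} (proj₂ (surj k) refl)) (proj₂ (surj l) eq)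

-- Exponential and trigonometric series

Σ≤ : ℕ → (ℕ → ℚ) → ℚ
Σ≤ zero    a = a 0
Σ≤ (suc k) a = Σ≤ k a + a (suc k)

-- Σ_{i + j = n} f i j
antidiagonal : (ℕ → ℕ → ℚ) → ℕ → ℚ
antidiagonal f zero    = f 0 0
antidiagonal f (suc n) = f 0 (suc n) + antidiagonal (f ∘ suc) n

-- Σ_{i + j ≤ n} f i j
triangle : (ℕ → ℕ → ℚ) → ℕ → ℚ
triangle f zero    = f 0 0
triangle f (suc n) = Σ≤ (suc n) (f 0) + triangle (f ∘ suc) n

-- Σ_{i ≤ m, j ≤ n} f i j
rectangle : (ℕ → ℕ → ℚ) → ℕ → ℕ → ℚ
rectangle f zero    n = Σ≤ n (f 0)
rectangle f (suc m) n = Σ≤ n (f 0) + rectangle (f ∘ suc) m n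

Σ≤-cong : ∀ {a b} → (∀ k → a k ≡ b k) → ∀ n → Σ≤ n a ≡ Σ≤ n b
Σ≤-cong h zero    = h 0
Σ≤-cong h (suc n) = cong₂ _+_ (Σ≤-cong h n) (h (suc n))

Σ≤-suc : ∀ a n → Σ≤ (suc n) a ≡ a 0 + Σ≤ n (a ∘ suc)
Σ≤-suc a zero    = refl
Σ≤-suc a (suc n) = trans (cong (_+ a (suc (suc n))) (Σ≤-suc a n)) (ℚ.+-assoc (a 0) (Σ≤ n (a ∘ suc))
  (a (suc (suc n))))

Σ≤-+ : ∀ a b n → Σ≤ n (λ k → a k + b k) ≡ Σ≤ n a + Σ≤ n b
Σ≤-+ a b zero    = refl
Σ≤-+ a b (suc n) = trans (cong (_+ (a (suc n) + b (suc n))) (Σ≤-+ a b n))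
  (solve 4 (λ a b c d → (a :+ b) :+ (c :+ d) := (a :+ c) :+ (b :+ d)) refl (Σ≤ n a) (Σ≤ n b)
    (a (suc n)) (b (suc n)))

Σ≤-*ˡ : ∀ q a n → Σ≤ n (λ k → q * a k) ≡ q * Σ≤ n a
Σ≤-*ˡ q a zero    = refl
Σ≤-*ˡ q a (suc n) = trans (cong (_+ q * a (suc n)) (Σ≤-*ˡ q a n))
  (sym (ℚ.*-distribˡ-+ q (Σ≤ n a) (a (suc n))))

Σ≤-grow : ∀ {a} → (∀ k → 0ℚ ≤ a k) → ∀ n → Σ≤ n a ≤ Σ≤ (suc n) a
Σ≤-grow h n = ≤-+ʳ (h (suc n))

Σ≤-≥0 : ∀ {a} → (∀ k → 0ℚ ≤ a k) → ∀ n → 0ℚ ≤ Σ≤ n a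
Σ≤-≥0 h zero    = h 0
Σ≤-≥0 h (suc n) = 0≤+ (Σ≤-≥0 h n) (h (suc n))

antidiagonal-cong : ∀ {f g} → (∀ i j → f i j ≡ g i j) → ∀ n → antidiagonal f n ≡ antidiagonal g n
antidiagonal-cong h zero    = h 0 0
antidiagonal-cong h (suc n) = cong₂ _+_ (h 0 (suc n)) (antidiagonal-cong (h ∘ suc) n)

antidiagonal-+ : ∀ (f g : ℕ → ℕ → ℚ) n → antidiagonal (λ i j → f i j + g i j) n ≡ antidiagonal f n +
  antidiagonal g n
antidiagonal-+ f g zero    = refl
antidiagonal-+ f g (suc n) = trans (cong (λ z → f 0 (suc n) + g 0 (suc n) + z)
  (antidiagonal-+ (f ∘ suc) (g ∘ suc) n))
  (solve 4 (λ a b c d → (a :+ b) :+ (c :+ d) := (a :+ c) :+ (b :+ d)) refl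
    (f 0 (suc n)) (g 0 (suc n)) (antidiagonal (f ∘ suc) n) (antidiagonal (g ∘ suc) n))

antidiagonal-*ˡ : ∀ q (f : ℕ → ℕ → ℚ) n → antidiagonal (λ i j → q * f i j) n ≡ q * antidiagonal f n
antidiagonal-*ˡ q f zero    = refl
antidiagonal-*ˡ q f (suc n) = trans (cong (λ z → q * f 0 (suc n) + z) (antidiagonal-*ˡ q (f ∘ suc)
  n))
  (sym (ℚ.*-distribˡ-+ q (f 0 (suc n)) (antidiagonal (f ∘ suc) n)))

antidiagonal-0 : ∀ {f} → (∀ i j → f i j ≡ 0ℚ) → ∀ n → antidiagonal f n ≡ 0ℚ
antidiagonal-0 h zero    = h 0 0
antidiagonal-0 h (suc n) = trans (cong₂ _+_ (h 0 (suc n)) (antidiagonal-0 (h ∘ suc) n))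
  (ℚ.+-identityˡ 0ℚ)

antidiagonal-last : ∀ (f : ℕ → ℕ → ℚ) n → antidiagonal f (suc n) ≡ antidiagonal
  (λ i j → f i (suc j)) n + f (suc n) 0
antidiagonal-last f zero    = refl
antidiagonal-last f (suc n) = trans (cong (λ z → f 0 (suc (suc n)) + z) (antidiagonal-last (f ∘ suc)
  n))
  (sym (ℚ.+-assoc (f 0 (suc (suc n))) (antidiagonal (λ i j → f (suc i) (suc j)) n)
    (f (suc (suc n)) 0)))

Σ-antidiagonal : ∀ f n → Σ≤ n (antidiagonal f) ≡ triangle f n
Σ-antidiagonal f zero    = refl
Σ-antidiagonal f (suc n) = begin
  Σ≤ (suc n) (antidiagonal f)                                                ≡⟨ Σ≤-suc
    (antidiagonal f) n ⟩
  f 0 0 + Σ≤ n (λ k → f 0 (suc k) + antidiagonal (f ∘ suc) k)                ≡⟨ cong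
    (λ z → f 0 0 + z) (Σ≤-+ (λ k → f 0 (suc k)) (antidiagonal (f ∘ suc)) n) ⟩
  f 0 0 + (Σ≤ n (f 0 ∘ suc) + Σ≤ n (antidiagonal (f ∘ suc)))                 ≡⟨ ℚ.+-assoc (f 0 0)
    (Σ≤ n (f 0 ∘ suc)) (Σ≤ n (antidiagonal (f ∘ suc))) ⟨
  f 0 0 + Σ≤ n (f 0 ∘ suc) + Σ≤ n (antidiagonal (f ∘ suc))                   ≡⟨ cong₂ _+_
    (sym (Σ≤-suc (f 0) n)) (Σ-antidiagonal (f ∘ suc) n) ⟩
  triangle f (suc n)                                                         ∎
  where open ≡-Reasoning

-- The weight i + j = n + 1 on the antidiagonal plays the role of the
-- derivative in the differential equations satisfied by exp, cos and sin.
antidiagonal-derivative : ∀ (f : ℕ → ℕ → ℚ) n → ℕ→ℚ (suc n) * antidiagonal f (suc n) ≡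
  antidiagonal (λ i j → ℕ→ℚ (suc i) * f (suc i) j) n + antidiagonal (λ i j → ℕ→ℚ (suc j) * f i
    (suc j)) n
antidiagonal-derivative f n = begin
  ℕ→ℚ (suc n) * antidiagonal f (suc n)
    ≡⟨ antidiagonal-*ˡ (ℕ→ℚ (suc n)) f (suc n) ⟨
  antidiagonal (λ i j → ℕ→ℚ (suc n) * f i j) (suc n)
    ≡⟨ weighted 0 f (suc n) ⟩
  antidiagonal (λ i j → ℕ→ℚ i * f i j + ℕ→ℚ j * f i j) (suc n)
    ≡⟨ antidiagonal-+ (λ i j → ℕ→ℚ i * f i j) (λ i j → ℕ→ℚ j * f i j) (suc n) ⟩
  antidiagonal (λ i j → ℕ→ℚ i * f i j) (suc n) + antidiagonal (λ i j → ℕ→ℚ j * f i j) (suc n)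
    ≡⟨ cong₂ _+_ (trans (cong (_+ F) (ℚ.*-zeroˡ (f 0 (suc n)))) (ℚ.+-identityˡ F))
         (trans (antidiagonal-last (λ i j → ℕ→ℚ j * f i j) n)
           (trans (cong (λ z → G + z) (ℚ.*-zeroˡ (f (suc n) 0))) (ℚ.+-identityʳ G))) ⟩
  F + G ∎
  where
  open ≡-Reasoning
  F = antidiagonal (λ i j → ℕ→ℚ (suc i) * f (suc i) j) n
  G = antidiagonal (λ i j → ℕ→ℚ (suc j) * f i (suc j)) n
  ℕ→ℚ-+ : ∀ i j → ℕ→ℚ (i ℕ.+ j) ≡ ℕ→ℚ i + ℕ→ℚ j
  ℕ→ℚ-+ i j = fromℤ-+ (+ i) (+ j)
  -- m counts the rows already removed, which the weight of the first index must remember when f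
  -- becomes `f ∘ suc`.
  weighted : ∀ m (f : ℕ → ℕ → ℚ) n → antidiagonal (λ i j → ℕ→ℚ (m ℕ.+ n) * f i j) n ≡ antidiagonal
    (λ i j → ℕ→ℚ (m ℕ.+ i) * f i j + ℕ→ℚ j * f i j) n
  weighted m f zero    = solve 2 (λ a b → a :* b := a :* b :+ con 0ℚ :* b) refl (ℕ→ℚ (m ℕ.+ 0))
    (f 0 0)
  weighted m f (suc n) = cong₂ _+_
    (trans (cong (_* f 0 (suc n)) (ℕ→ℚ-+ m (suc n))) (trans (ℚ.*-distribʳ-+ (f 0 (suc n)) (ℕ→ℚ m)
      (ℕ→ℚ (suc n)))
      (cong (λ k → ℕ→ℚ k * f 0 (suc n) + ℕ→ℚ (suc n) * f 0 (suc n)) (sym (ℕ.+-identityʳ m)))))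
    (trans (cong (λ k → antidiagonal (λ i j → ℕ→ℚ k * f (suc i) j) n) (ℕ.+-suc m n))
      (trans (weighted (suc m) (f ∘ suc) n)
        (antidiagonal-cong {λ i j → ℕ→ℚ (suc m ℕ.+ i) * f (suc i) j + ℕ→ℚ j * f (suc i) j}
          {λ i j → ℕ→ℚ (m ℕ.+ suc i) * f (suc i) j + ℕ→ℚ j * f (suc i) j}
          (λ i j → cong (λ k → ℕ→ℚ k * f (suc i) j + ℕ→ℚ j * f (suc i) j) (sym (ℕ.+-suc m i))) n)))

rectangle-product : ∀ (a b : ℕ → ℚ) m n → rectangle (λ i j → a i * b j) m n ≡ Σ≤ m a * Σ≤ n b
rectangle-product a b zero    n = Σ≤-*ˡ (a 0) b n
rectangle-product a b (suc m) n = trans (cong₂ _+_ (Σ≤-*ˡ (a 0) b n) (rectangle-product (a ∘ suc) b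
  m n))
  (trans (sym (ℚ.*-distribʳ-+ (Σ≤ n b) (a 0) (Σ≤ m (a ∘ suc))))
    (cong (_* Σ≤ n b) (sym (Σ≤-suc a m))))

Σ≤-tail : ∀ {a b} → (∀ k → ∣ a k ∣ ≤ b k) → ∀ {m n} → m ℕ.≤ n → ∣ Σ≤ n a - Σ≤ m a ∣ ≤ Σ≤ n b - Σ≤ m
  b
Σ≤-tail {a} {b} h {m} {n} m≤n = subst (λ n → ∣ Σ≤ n a - Σ≤ m a ∣ ≤ Σ≤ n b - Σ≤ m b) (ℕ.m∸n+n≡m m≤n)
  (go (n ∸ m))
  where
  go : ∀ j → ∣ Σ≤ (j ℕ.+ m) a - Σ≤ m a ∣ ≤ Σ≤ (j ℕ.+ m) b - Σ≤ m b
  go zero    = ℚ.≤-reflexive (trans (cong ∣_∣ (ℚ.+-inverseʳ (Σ≤ m a)))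
    (sym (ℚ.+-inverseʳ (Σ≤ m b))))
  go (suc j) = begin
    ∣ s + x - s₀ ∣     ≡⟨ cong ∣_∣ (solve 3 (λ s x z → s :+ x :- z := (s :- z) :+ x) refl s x s₀) ⟩
    ∣ s - s₀ + x ∣     ≤⟨ ℚ.∣p+q∣≤∣p∣+∣q∣ (s - s₀) x ⟩
    ∣ s - s₀ ∣ + ∣ x ∣ ≤⟨ ℚ.+-mono-≤ (go j) (h (suc (j ℕ.+ m))) ⟩
    t - t₀ + y         ≡⟨ solve 3 (λ s x z → s :- z :+ x := s :+ x :- z) refl t y t₀ ⟩
    t + y - t₀         ∎
    where
    open ℚ.≤-Reasoning
    s = Σ≤ (j ℕ.+ m) a
    s₀ = Σ≤ m a
    x = a (suc (j ℕ.+ m))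
    t = Σ≤ (j ℕ.+ m) b
    t₀ = Σ≤ m b
    y = b (suc (j ℕ.+ m))

-- The triangle is contained in the rectangle, so both differences run over the same remaining index
-- pairs and compare term by term.
rectangle-triangle : ∀ {f g} → (∀ i j → ∣ f i j ∣ ≤ g i j) → ∀ {m n} → m ℕ.≤ n →
  ∣ rectangle f m n - triangle f m ∣ ≤ rectangle g m n - triangle g m
rectangle-triangle h {zero}  {n} m≤n = Σ≤-tail (h 0) m≤n
rectangle-triangle {f} {g} h {suc m} {n} m≤n = begin
  ∣ (s + r) - (s₀ + t) ∣       ≡⟨ cong ∣_∣ (solve 4 (λ a b c d → (a :+ b) :- (c :+ d) := (a :- c) :+
    (b :- d)) refl s r s₀ t) ⟩
  ∣ (s - s₀) + (r - t) ∣       ≤⟨ ℚ.∣p+q∣≤∣p∣+∣q∣ (s - s₀) (r - t) ⟩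
  ∣ s - s₀ ∣ + ∣ r - t ∣       ≤⟨ ℚ.+-mono-≤ (Σ≤-tail (h 0) m≤n) (rectangle-triangle (h ∘ suc)
    (ℕ.≤-trans (ℕ.n≤1+n m) m≤n)) ⟩
  (s′ - s₀′) + (r′ - t′)       ≡⟨ solve 4 (λ a b c d → (a :+ b) :- (c :+ d) := (a :- c) :+ (b :- d))
    refl s′ r′ s₀′ t′ ⟨
  (s′ + r′) - (s₀′ + t′)       ∎
  where
  open ℚ.≤-Reasoning
  s = Σ≤ n (f 0)
  s₀ = Σ≤ (suc m) (f 0)
  r = rectangle (f ∘ suc) m n
  t = triangle (f ∘ suc) m
  s′ = Σ≤ n (g 0)
  s₀′ = Σ≤ (suc m) (g 0)
  r′ = rectangle (g ∘ suc) m n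
  t′ = triangle (g ∘ suc) m

triangle-≥0 : ∀ {g} → (∀ i j → 0ℚ ≤ g i j) → ∀ n → 0ℚ ≤ triangle g n
triangle-≥0 h zero    = h 0 0
triangle-≥0 h (suc n) = 0≤+ (Σ≤-≥0 (h 0) (suc n)) (triangle-≥0 (h ∘ suc) n)

Σ≤-mono-ℕ : ∀ {a} → (∀ k → 0ℚ ≤ a k) → ∀ j m → Σ≤ m a ≤ Σ≤ (j ℕ.+ m) a
Σ≤-mono-ℕ h zero    m = ℚ.≤-refl
Σ≤-mono-ℕ h (suc j) m = ℚ.≤-trans (Σ≤-mono-ℕ h j m) (Σ≤-grow h (j ℕ.+ m))

-- All index pairs of the rectangle satisfy i + j ≤ m + n.
rectangle-≤-triangle : ∀ {g} → (∀ i j → 0ℚ ≤ g i j) → ∀ m n → rectangle g m n ≤ triangle g (m ℕ.+ n)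
rectangle-≤-triangle h zero    zero    = ℚ.≤-refl
rectangle-≤-triangle h zero    (suc n) = ≤-+ʳ (triangle-≥0 (h ∘ suc) n)
rectangle-≤-triangle h (suc m) n = ℚ.+-mono-≤ (Σ≤-mono-ℕ (h 0) (suc m) n) (rectangle-≤-triangle
  (h ∘ suc) m n)

-- Both sides of the Cauchy product differ by at most the tail of the product of
-- the majorants.
cauchy-product : ∀ {a b s t D : ℕ → ℚ} → (∀ k → ∣ a k ∣ ≤ s k) → (∀ k → ∣ b k ∣ ≤ t k) →
  (∀ k → antidiagonal (λ i j → s i * t j) k ≡ D k) → ∀ n →
  ∣ Σ≤ n a * Σ≤ n b - Σ≤ n (antidiagonal (λ i j → a i * b j)) ∣ ≤ Σ≤ (n ℕ.+ n) D - Σ≤ n D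
cauchy-product {a} {b} {s} {t} {D} h k eq n = begin
  ∣ Σ≤ n a * Σ≤ n b - Σ≤ n (antidiagonal f) ∣   ≡⟨ cong₂ (λ x y → ∣ x - y ∣)
    (sym (rectangle-product a b n n)) (Σ-antidiagonal f n) ⟩
  ∣ rectangle f n n - triangle f n ∣            ≤⟨ rectangle-triangle f≤g {n} {n} ℕ.≤-refl ⟩
  rectangle g n n - triangle g n                ≤⟨ ℚ.+-monoˡ-≤ (- triangle g n)
    (rectangle-≤-triangle g≥0 n n) ⟩
  triangle g (n ℕ.+ n) - triangle g n           ≡⟨ cong₂ _-_ (D≡ (n ℕ.+ n)) (D≡ n) ⟩
  Σ≤ (n ℕ.+ n) D - Σ≤ n D                       ∎
  where
  open ℚ.≤-Reasoning
  f g : ℕ → ℕ → ℚ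
  f i j = a i * b j
  g i j = s i * t j
  f≤g : ∀ i j → ∣ f i j ∣ ≤ g i j
  f≤g i j = ℚ.≤-trans (ℚ.≤-reflexive (ℚ.∣p*q∣≡∣p∣*∣q∣ (a i) (b j)))
    (*-mono (ℚ.0≤∣p∣ (b j)) (ℚ.≤-trans (ℚ.0≤∣p∣ (a i)) (h i)) (h i) (k j))
  g≥0 : ∀ i j → 0ℚ ≤ g i j
  g≥0 i j = ℚ.≤-trans (ℚ.0≤∣p∣ (f i j)) (f≤g i j)
  D≡ : ∀ n → triangle g n ≡ Σ≤ n D
  D≡ n = trans (sym (Σ-antidiagonal g n)) (Σ≤-cong eq n)

-- Coefficient identities for exp, cos and sin.

suc*term : ∀ x k → ℕ→ℚ (suc k) * term x (suc k) ≡ x * term x k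
suc*term x k = trans (solve 4 (λ n t x i → n :* (t :* (x :* i)) := (n :* i) :* (x :* t)) refl
  (ℕ→ℚ (suc k)) (term x k) x (1/suc k))
  (trans (cong (_* (x * term x k)) (suc*1/suc k)) (ℚ.*-identityˡ (x * term x k)))

-- Both sides satisfy (n + 1) cₙ₊₁ = (x + y) cₙ, the recurrence behind the differential equation of
-- exp ((x + y) t).
binomial : ∀ x y n → antidiagonal (λ i j → term x i * term y j) n ≡ term (x + y) n
binomial x y zero    = refl
binomial x y (suc n) = begin
    antidiagonal f (suc n)                               ≡⟨ solve-for ⟩
    1/suc n * (ℕ→ℚ (suc n) * antidiagonal f (suc n))     ≡⟨ cong (1/suc n *_) step ⟩
    1/suc n * ((x + y) * term (x + y) n)                 ≡⟨ solve 3 (λ i s t → i :* (s :* t) := t :*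
      (s :* i)) refl (1/suc n) (x + y) (term (x + y) n) ⟩
    term (x + y) (suc n)                                 ∎
  where
  open ≡-Reasoning
  f : ℕ → ℕ → ℚ
  f i j = term x i * term y j
  solve-for : antidiagonal f (suc n) ≡ 1/suc n * (ℕ→ℚ (suc n) * antidiagonal f (suc n))
  solve-for = sym (trans (solve 3 (λ i n a → i :* (n :* a) := (n :* i) :* a) refl (1/suc n)
    (ℕ→ℚ (suc n)) (antidiagonal f (suc n)))
    (trans (cong (_* antidiagonal f (suc n)) (suc*1/suc n))
      (ℚ.*-identityˡ (antidiagonal f (suc n)))))
  step : ℕ→ℚ (suc n) * antidiagonal f (suc n) ≡ (x + y) * term (x + y) n
  step = begin
    ℕ→ℚ (suc n) * antidiagonal f (suc n)
      ≡⟨ antidiagonal-derivative f n ⟩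
    antidiagonal (λ i j → ℕ→ℚ (suc i) * (term x (suc i) * term y j)) n + antidiagonal
      (λ i j → ℕ→ℚ (suc j) * (term x i * term y (suc j))) n
      ≡⟨ cong₂ _+_ (antidiagonal-cong {g = λ i j → x * f i j}
        (λ i j → trans (sym (ℚ.*-assoc (ℕ→ℚ (suc i)) (term x (suc i)) (term y j)))
             (trans (cong (_* term y j) (suc*term x i)) (ℚ.*-assoc x (term x i) (term y j)))) n)
           (antidiagonal-cong {g = λ i j → y * f i j}
             (λ i j → trans (solve 3 (λ n a b → n :* (a :* b) := a :* (n :* b)) refl (ℕ→ℚ (suc j))
             (term x i) (term y (suc j)))
             (trans (cong (term x i *_) (suc*term y j)) (solve 3 (λ a y b → a :* (y :* b) := y :*
               (a :* b)) refl (term x i) y (term y j)))) n) ⟩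
    antidiagonal (λ i j → x * f i j) n + antidiagonal (λ i j → y * f i j) n
      ≡⟨ cong₂ _+_ (antidiagonal-*ˡ x f n) (antidiagonal-*ˡ y f n) ⟩
    x * antidiagonal f n + y * antidiagonal f n
      ≡⟨ ℚ.*-distribʳ-+ (antidiagonal f n) x y ⟨
    (x + y) * antidiagonal f n
      ≡⟨ cong ((x + y) *_) (binomial x y n) ⟩
    (x + y) * term (x + y) n ∎

cosTerm sinTerm : ℚ → ℕ → ℚ
cosTerm x k = cosCoeff k * term x k
sinTerm x k = sinCoeff k * term x k

cosCoeff-suc : ∀ k → cosCoeff (suc k) ≡ - sinCoeff k
cosCoeff-suc zero    = refl
cosCoeff-suc (suc k) = refl

suc*cosTerm : ∀ x k → ℕ→ℚ (suc k) * cosTerm x (suc k) ≡ - x * sinTerm x k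
suc*cosTerm x k = trans (cong (λ c → ℕ→ℚ (suc k) * (c * term x (suc k))) (cosCoeff-suc k))
  (trans (solve 3 (λ n c t → n :* ((:- c) :* t) := (:- c) :* (n :* t)) refl (ℕ→ℚ (suc k))
    (sinCoeff k) (term x (suc k)))
    (trans (cong (- sinCoeff k *_) (suc*term x k)) (solve 3 (λ c x t → (:- c) :* (x :* t) := (:- x)
      :* (c :* t)) refl (sinCoeff k) x (term x k))))

suc*sinTerm : ∀ x k → ℕ→ℚ (suc k) * sinTerm x (suc k) ≡ x * cosTerm x k
suc*sinTerm x k = trans (solve 3 (λ n c t → n :* (c :* t) := c :* (n :* t)) refl (ℕ→ℚ (suc k))
  (cosCoeff k) (term x (suc k)))
  (trans (cong (cosCoeff k *_) (suc*term x k)) (solve 3 (λ c x t → c :* (x :* t) := x :* (c :* t))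
    refl (cosCoeff k) x (term x k)))

-- The derivative of cos² + sin² vanishes coefficient by coefficient, so only the constant term
-- survives.
pythagoras : ∀ x n → antidiagonal (λ i j → cosTerm x i * cosTerm x j + sinTerm x i * sinTerm x j)
  (suc n) ≡ 0ℚ
pythagoras x n = zero-product (ℕ→ℚ (suc n)) (antidiagonal f (suc n))
  (trans (antidiagonal-derivative f n)
    (trans (sym (antidiagonal-+ (λ i j → ℕ→ℚ (suc i) * f (suc i) j) (λ i j → ℕ→ℚ (suc j) * f i
      (suc j)) n))
      (antidiagonal-0 cancel n))) (ℕ→ℚ-≢0 (suc n))
  where
  f : ℕ → ℕ → ℚ
  f i j = cosTerm x i * cosTerm x j + sinTerm x i * sinTerm x j
  cancel : ∀ i j → ℕ→ℚ (suc i) * f (suc i) j + ℕ→ℚ (suc j) * f i (suc j) ≡ 0ℚ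
  cancel i j = begin
    m * (c′ * d + s′ * t) + n′ * (c * d′ + s * t′)
      ≡⟨ solve 10 (λ m n c s d t c′ s′ d′ t′ → m :* (c′ :* d :+ s′ :* t) :+ n :*
        (c :* d′ :+ s :* t′)
           := (m :* c′) :* d :+ (m :* s′) :* t :+ (c :* (n :* d′) :+ s :* (n :* t′))) refl m n′ c s
             d t c′ s′ d′ t′ ⟩
    m * c′ * d + m * s′ * t + (c * (n′ * d′) + s * (n′ * t′))
      ≡⟨ cong₂ _+_ (cong₂ (λ a b → a * d + b * t) (suc*cosTerm x i) (suc*sinTerm x i))
           (cong₂ (λ a b → c * a + s * b) (suc*cosTerm x j) (suc*sinTerm x j)) ⟩
    - x * s * d + x * c * t + (c * (- x * t) + s * (x * d))
      ≡⟨ solve 5 (λ x c s d t → (:- x) :* s :* d :+ x :* c :* t :+ (c :* ((:- x) :* t) :+ s :*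
        (x :* d)) := con 0ℚ) refl x c s d t ⟩
    0ℚ ∎
    where
    open ≡-Reasoning
    m = ℕ→ℚ (suc i)
    n′ = ℕ→ℚ (suc j)
    c = cosTerm x i
    s = sinTerm x i
    d = cosTerm x j
    t = sinTerm x j
    c′ = cosTerm x (suc i)
    s′ = sinTerm x (suc i)
    d′ = cosTerm x (suc j)
    t′ = sinTerm x (suc j)

-- Estimates for partial sums.

Eventually : (ℕ → Set) → Set
Eventually Q = ∃[ N ] ∀ k → N ℕ.≤ k → Q k

infixr 4 _⟨and⟩_
_⟨and⟩_ : ∀ {Q R : ℕ → Set} → Eventually Q → Eventually R → Eventually (λ k → Q k × R k)
(M , q) ⟨and⟩ (N , r) = M ℕ.+ N , λ k h → q k (ℕ.m+n≤o⇒m≤o M h) , r k (ℕ.m+n≤o⇒n≤o M h)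

eventually-map : ∀ {Q R : ℕ → Set} → (∀ k → Q k → R k) → Eventually Q → Eventually R
eventually-map f (N , q) = N , λ k h → f k (q k h)

infix 4 _~_
-- The second index of `Null` is a dummy here: the relation is f - g → 0.
_~_ : (ℕ → ℚ) → (ℕ → ℚ) → Set
f ~ g = Null (λ k _ → f k - g k)

close : ∀ {f g} → f ~ g → ∀ ε → 0ℚ < ε → Eventually (λ k → ∣ f k - g k ∣ ≤ ε)
close h ε ε>0 = proj₁ (h ε ε>0) , λ k p → proj₂ (h ε ε>0) k k p p

≤-of-close : ∀ {x y ε} → ∣ x - y ∣ ≤ ε → x ≤ y + ε
≤-of-close {x} {y} {ε} h = ℚ.≤-trans (ℚ.≤-reflexive (solve 2 (λ x y → x := y :+ (x :- y)) refl x y))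
  (ℚ.+-monoʳ-≤ y (ℚ.≤-trans (x≤∣x∣ (x - y)) h))

≥-of-close : ∀ {x y ε} → ∣ x - y ∣ ≤ ε → y ≤ x + ε
≥-of-close {x} {y} h = ≤-of-close (ℚ.≤-trans (ℚ.≤-reflexive (∣-∣-swap y x)) h)

pos : ∀ q .{{_ : ℚ.Positive q}} → 0ℚ < q
pos q = ℚ.positive⁻¹ q

1≥0 : 0ℚ ≤ 1ℚ
1≥0 = ℚ.<⇒≤ (pos 1ℚ)

expSum cosSum sinSum : ℚ → ℕ → ℚ
expSum x k = series (λ _ → 1ℚ) x (suc k)
cosSum x k = series cosCoeff x (suc k)
sinSum x k = series sinCoeff x (suc k)

series-Σ≤ : ∀ c x n → series c x n ≡ Σ≤ n (λ k → c k * term x k)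
series-Σ≤ c x zero    = refl
series-Σ≤ c x (suc n) = cong (_+ c (suc n) * term x (suc n)) (series-Σ≤ c x n)

square-≥0 : ∀ x → 0ℚ ≤ x * x
square-≥0 x = ℚ.≤-trans (0≤* (ℚ.0≤∣p∣ x) (ℚ.0≤∣p∣ x))
  (ℚ.≤-reflexive (trans (sym (ℚ.∣p*q∣≡∣p∣*∣q∣ x x)) (∣x*x∣ (ℚ.≤-total 0ℚ x))))
  where
  ∣x*x∣ : 0ℚ ≤ x ⊎ x ≤ 0ℚ → ∣ x * x ∣ ≡ x * x
  ∣x*x∣ (inj₁ h) = ℚ.0≤p⇒∣p∣≡p (0≤* h h)
  ∣x*x∣ (inj₂ h) = ℚ.0≤p⇒∣p∣≡p (ℚ.≤-trans (0≤* -x≥0 -x≥0)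
    (ℚ.≤-reflexive (solve 1 (λ x → (:- x) :* (:- x) := x :* x) refl x)))
    where
    -x≥0 : 0ℚ ≤ - x
    -x≥0 = ℚ.≤-trans (diff-≥0 h) (ℚ.≤-reflexive (ℚ.+-identityˡ (- x)))

module Estimates (B : ℚ) (B≥0 : 0ℚ ≤ B) where
  private module Double = Bound (B + B) (0≤+ B≥0 B≥0)
  open Bound B B≥0

  -- The bound of `cauchy-product` at degree k + 1 when both factors are majorised by `term B`: the
  -- terms of exp (2B) from degree k + 2 to 2(k + 1).
  error : ℕ → ℚ
  error k = Σ≤ (suc k ℕ.+ suc k) (term (B + B)) - Σ≤ (suc k) (term (B + B))

  error-null : Null (λ k _ → error k)
  error-null ε ε>0 = proj₁ (Double.T-null ε ε>0) , λ k _ h _ →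
      subst (λ e → ∣ e ∣ ≤ ε) (cong₂ _-_ (T≡ (suc k ℕ.+ suc k)) (T≡ (suc k)))
        (proj₂ (Double.T-null ε ε>0) (k ℕ.+ suc k) k (ℕ.≤-trans h (ℕ.m≤m+n k (suc k))) h)
    where
    T≡ : ∀ n → Double.T n ≡ Σ≤ n (term (B + B))
    T≡ zero    = refl
    T≡ (suc n) = cong (_+ term (B + B) (suc n)) (T≡ n)

  term-majorised : ∀ {c} → (∀ k → ∣ c k ∣ ≤ 1ℚ) → ∀ {x} → ∣ x ∣ ≤ B → ∀ k → ∣ c k * term x k ∣ ≤
    term B k
  term-majorised {c} c≤1 {x} h k = ℚ.≤-trans (Coeffs.c*≤ c c≤1 k (term x k)) (term-bound h k)

  exp-add : ∀ {x y} → ∣ x ∣ ≤ B → ∣ y ∣ ≤ B → ∀ k → ∣ expSum x k * expSum y k - expSum (x + y) k ∣ ≤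
    error k
  exp-add {x} {y} hx hy k = ℚ.≤-trans (ℚ.≤-reflexive (cong₂ (λ a b → ∣ a - b ∣)
      (cong₂ _*_ (series-Σ≤ (λ _ → 1ℚ) x (suc k)) (series-Σ≤ (λ _ → 1ℚ) y (suc k)))
      (trans (series-Σ≤ (λ _ → 1ℚ) (x + y) (suc k)) (Σ≤-cong (λ n → sym (coefficient n)) (suc k)))))
    (cauchy-product (term-majorised (λ _ → ℚ.≤-refl) hx) (term-majorised (λ _ → ℚ.≤-refl) hy)
      (binomial B B) (suc k))
    where
    coefficient : ∀ n → antidiagonal (λ i j → (1ℚ * term x i) * (1ℚ * term y j)) n ≡ 1ℚ * term
      (x + y) n
    coefficient n = trans (antidiagonal-cong {g = λ i j → term x i * term y j}
        (λ i j → cong₂ _*_ (ℚ.*-identityˡ (term x i)) (ℚ.*-identityˡ (term y j))) n)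
      (trans (binomial x y n) (sym (ℚ.*-identityˡ (term (x + y) n))))

  cos²+sin² : ∀ {x} → ∣ x ∣ ≤ B → ∀ k → ∣ (cosSum x k * cosSum x k + sinSum x k * sinSum x k) - 1ℚ ∣
    ≤ error k + error k
  cos²+sin² {x} h k = begin
    ∣ (cosSum x k * cosSum x k + sinSum x k * sinSum x k) - 1ℚ ∣
      ≡⟨ cong₂ (λ a b → ∣ a - b ∣) (cong₂ (λ a b → a * a + b * b) (series-Σ≤ cosCoeff x (suc k))
        (series-Σ≤ sinCoeff x (suc k))) (sym (total (suc k))) ⟩
    ∣ (c * c + s * s) - (cc + ss) ∣
      ≡⟨ cong ∣_∣ (solve 4 (λ a b d e → (a :+ b) :- (d :+ e) := (a :- d) :+ (b :- e)) refl (c * c)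
        (s * s) cc ss) ⟩
    ∣ (c * c - cc) + (s * s - ss) ∣
      ≤⟨ ℚ.∣p+q∣≤∣p∣+∣q∣ (c * c - cc) (s * s - ss) ⟩
    ∣ c * c - cc ∣ + ∣ s * s - ss ∣
      ≤⟨ ℚ.+-mono-≤ (cauchy-product (term-majorised cosCoeff≤1 h) (term-majorised cosCoeff≤1 h)
        (binomial B B) (suc k))
           (cauchy-product (term-majorised sinCoeff≤1 h) (term-majorised sinCoeff≤1 h)
             (binomial B B) (suc k)) ⟩
    error k + error k ∎
    where
    open ℚ.≤-Reasoning
    c² s² : ℕ → ℕ → ℚ
    c² i j = cosTerm x i * cosTerm x j
    s² i j = sinTerm x i * sinTerm x j
    c = Σ≤ (suc k) (cosTerm x)
    s = Σ≤ (suc k) (sinTerm x)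
    cc = Σ≤ (suc k) (antidiagonal c²)
    ss = Σ≤ (suc k) (antidiagonal s²)
    total : ∀ n → Σ≤ n (antidiagonal c²) + Σ≤ n (antidiagonal s²) ≡ 1ℚ
    total zero    = refl
    total (suc n) = trans (solve 4 (λ a b d e → (a :+ b) :+ (d :+ e) := (a :+ d) :+ (b :+ e)) refl
        (Σ≤ n (antidiagonal c²)) (antidiagonal c² (suc n)) (Σ≤ n (antidiagonal s²))
          (antidiagonal s² (suc n)))
      (trans (cong₂ _+_ (total n) (trans (sym (antidiagonal-+ c² s² (suc n))) (pythagoras x n)))
        (ℚ.+-identityʳ 1ℚ))

expSum-0 : ∀ k → expSum 0ℚ k ≡ 1ℚ
expSum-0 k = Log.series-0 1 ℚ.≤-refl (suc k)

expSum≥1 : ∀ {x} → 0ℚ ≤ x → ∀ k → 1ℚ ≤ expSum x k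
expSum≥1 {x} h k = ℚ.≤-trans (go (suc k)) (ℚ.≤-reflexive (sym (series-Σ≤ (λ _ → 1ℚ) x (suc k))))
  where
  t≥0 : ∀ k → 0ℚ ≤ 1ℚ * term x k
  t≥0 k = 0≤* 1≥0 (Log.term≥0 1 ℚ.≤-refl h k)
  go : ∀ n → 1ℚ ≤ Σ≤ n (λ k → 1ℚ * term x k)
  go zero    = ℚ.≤-refl
  go (suc n) = ℚ.≤-trans (go n) (Σ≤-grow t≥0 n)

-- All partial sums share one Lipschitz constant C on [-1, 1] and equal 1 at 0, so any η with C η ≤
-- ½ works for all degrees at once; to the right of 0 they are at least 1.
expSum≥½ : ∃[ η ] 0ℚ < η × (∀ {x} → - η ≤ x → ∀ k → ½ ≤ expSum x k)
expSum≥½ = go (null-scale C null-1/ˡ ½ (pos ½))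
  where
  open Bound 1ℚ 1≥0
  open Coeffs (λ _ → 1ℚ) (λ _ → ℚ.≤-refl)
  go : ∃[ N ] (∀ m n → N ℕ.≤ m → N ℕ.≤ n → ∣ C * 1/suc m ∣ ≤ ½) → ∃[ η ] 0ℚ < η ×
    (∀ {x} → - η ≤ x → ∀ k → ½ ≤ expSum x k)
  go (N , h) = η , η>0 , λ {x} hx k → [ (λ x≥0 → ℚ.≤-trans (ℚ.≤ᵇ⇒≤ {½} {1ℚ} _) (expSum≥1 x≥0 k)) ,
    (λ x≤0 → near x hx x≤0 k) ]′ (ℚ.≤-total 0ℚ x)
    where
    η : ℚ
    η = 1/suc N
    η>0 : 0ℚ < η
    η>0 = pos η {{ℚ.normalize-pos 1 (suc N)}}
    η≤1 : η ≤ 1ℚ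
    η≤1 = ℚ.≤-trans (ℚ.≤-trans (ℚ.≤-reflexive (sym (ℚ.*-identityˡ η))) (*-monoʳ (ℚ.<⇒≤ η>0)
      (1≤ (suc N))))
      (ℚ.≤-reflexive (suc*1/suc N))
    near : ∀ x → - η ≤ x → x ≤ 0ℚ → ∀ k → ½ ≤ expSum x k
    near x hx x≤0 k = ≤-diff (ℚ.≤-trans (diff-≥0 1≤E+½)
      (ℚ.≤-reflexive (solve 1 (λ e → (e :+ con ½) :- con 1ℚ := e :- con ½) refl (expSum x k))))
      where
      ∣x∣≤η : ∣ x ∣ ≤ η
      ∣x∣≤η = ℚ.≤-trans (ℚ.≤-reflexive (trans (sym (ℚ.∣-p∣≡∣p∣ x))
        (ℚ.0≤p⇒∣p∣≡p (ℚ.≤-trans (diff-≥0 x≤0) (ℚ.≤-reflexive (ℚ.+-identityˡ (- x)))))))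
        (ℚ.≤-trans (ℚ.neg-antimono-≤ hx) (ℚ.≤-reflexive (solve 1 (λ a → :- (:- a) := a) refl η)))
      lipschitz : ∣ expSum x k - 1ℚ ∣ ≤ ½
      lipschitz = begin
        ∣ expSum x k - 1ℚ ∣             ≡⟨ cong (λ e → ∣ expSum x k - e ∣) (expSum-0 k) ⟨
        ∣ expSum x k - expSum 0ℚ k ∣    ≤⟨ series-lip (ℚ.≤-trans ∣x∣≤η η≤1) 1≥0 k ⟩
        C * ∣ x - 0ℚ ∣                  ≡⟨ cong (λ a → C * ∣ a ∣) (ℚ.+-identityʳ x) ⟩
        C * ∣ x ∣                       ≤⟨ *-monoˡ C≥0 ∣x∣≤η ⟩
        C * η                           ≤⟨ x≤∣x∣ (C * η) ⟩
        ∣ C * η ∣                       ≤⟨ h N N ℕ.≤-refl ℕ.≤-refl ⟩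
        ½                               ∎
        where open ℚ.≤-Reasoning
      1≤E+½ : 1ℚ ≤ expSum x k + ½
      1≤E+½ = ≥-of-close {expSum x k} {1ℚ} lipschitz

~-* : ∀ {f g x y} → f ~ (λ _ → x) → g ~ (λ _ → y) → (λ k → f k * g k) ~ (λ _ → x * y)
~-* {f} {g} {x} {y} hf hg = null-dom {g = λ k _ → (∣ x ∣ + 1ℚ) * ∣ g k - y ∣ + ∣ y ∣ * ∣ f k - x ∣}
  (null-+ (null-scale (∣ x ∣ + 1ℚ) (null-∣∣ hg)) (null-scale ∣ y ∣ (null-∣∣ hf))) (proj₁ near) λ k _
    N≤k _ → begin
    ∣ f k * g k - x * y ∣
      ≡⟨ cong ∣_∣ (solve 4 (λ f g x y → f :* g :- x :* y := f :* (g :- y) :+ y :* (f :- x)) refl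
        (f k) (g k) x y) ⟩
    ∣ f k * (g k - y) + y * (f k - x) ∣
      ≤⟨ ℚ.∣p+q∣≤∣p∣+∣q∣ (f k * (g k - y)) (y * (f k - x)) ⟩
    ∣ f k * (g k - y) ∣ + ∣ y * (f k - x) ∣
      ≡⟨ cong₂ _+_ (ℚ.∣p*q∣≡∣p∣*∣q∣ (f k) (g k - y)) (ℚ.∣p*q∣≡∣p∣*∣q∣ y (f k - x)) ⟩
    ∣ f k ∣ * ∣ g k - y ∣ + ∣ y ∣ * ∣ f k - x ∣
      ≤⟨ ℚ.+-monoˡ-≤ (∣ y ∣ * ∣ f k - x ∣) (*-monoʳ (ℚ.0≤∣p∣ (g k - y))
        (bound k (proj₂ near k N≤k))) ⟩
    (∣ x ∣ + 1ℚ) * ∣ g k - y ∣ + ∣ y ∣ * ∣ f k - x ∣ ∎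
  where
  open ℚ.≤-Reasoning
  near : Eventually (λ k → ∣ f k - x ∣ ≤ 1ℚ)
  near = close {f} {λ _ → x} hf 1ℚ (pos 1ℚ)
  bound : ∀ k → ∣ f k - x ∣ ≤ 1ℚ → ∣ f k ∣ ≤ ∣ x ∣ + 1ℚ
  bound k h = ℚ.≤-trans (ℚ.≤-reflexive (cong ∣_∣ (solve 2 (λ f x → f := x :+ (f :- x)) refl (f k)
    x)))
    (ℚ.≤-trans (ℚ.∣p+q∣≤∣p∣+∣q∣ x (f k - x)) (ℚ.+-monoʳ-≤ ∣ x ∣ h))

ℕ→ℚ-mono : ∀ {m n} → m ℕ.≤ n → ℕ→ℚ m ≤ ℕ→ℚ n
ℕ→ℚ-mono m≤n = fromℤ-mono (ℤ.+≤+ m≤n)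

∣nonNeg∣≤ : ∀ {x B} → 0ℚ ≤ x → x ≤ B → ∣ x ∣ ≤ B
∣nonNeg∣≤ h x≤B = ℚ.≤-trans (ℚ.≤-reflexive (ℚ.0≤p⇒∣p∣≡p h)) x≤B

-- Powers of p.

module Powers (p : ℕ) .{{_ : ℕ.NonZero p}} where
  open Log p (1≤ p) using (r; r≥0; r≤b; F-null)

  -- Induction from exp (log p) = p. Passing to M + 1 costs the error of the addition formula,
  -- uniformly in k since r k and M r k are bounded by B.
  exp-log-power : ∀ M → (λ k → expSum (ℕ→ℚ M * r k) k) ~ (λ _ → ℕ→ℚ (p ℕ.^ M))
  exp-log-power zero    = null-dom {g = λ _ _ → 0ℚ} (λ ε ε>0 → 0 , λ _ _ _ _ → ℚ.<⇒≤ ε>0) 0 λ k _ _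
    _ → ℚ.≤-reflexive
    (trans (cong (λ e → ∣ e - 1ℚ ∣) (trans (cong (λ x → expSum x k) (ℚ.*-zeroˡ (r k)))
      (expSum-0 k))) refl)
  exp-log-power (suc M) = null-dom {g = λ k _ → ∣ error k ∣ + ∣ expSum (r k) k * expSum
    (ℕ→ℚ M * r k) k - ℕ→ℚ p * ℕ→ℚ (p ℕ.^ M) ∣}
      (null-+ (null-∣∣ error-null) (null-∣∣ (~-* {λ k → expSum (r k) k} F-null (exp-log-power M))))
        0 λ k _ _ _ → begin
        ∣ expSum (ℕ→ℚ (suc M) * r k) k - ℕ→ℚ (p ℕ.^ suc M) ∣
          ≡⟨ cong₂ (λ a b → ∣ expSum a k - b ∣) (trans (cong (_* r k) (ℕ→ℚ-suc M))
               (solve 2 (λ m r → (con 1ℚ :+ m) :* r := r :+ m :* r) refl (ℕ→ℚ M) (r k)))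
               (trans (cong fromℤ (ℤ.pos-* p (p ℕ.^ M))) (fromℤ-* (+ p) (+ (p ℕ.^ M)))) ⟩
        ∣ expSum (r k + ℕ→ℚ M * r k) k - ℕ→ℚ p * ℕ→ℚ (p ℕ.^ M) ∣
          ≤⟨ ∣-∣-tri (expSum (r k + ℕ→ℚ M * r k) k) (expSum (r k) k * expSum (ℕ→ℚ M * r k) k)
            (ℕ→ℚ p * ℕ→ℚ (p ℕ.^ M)) ⟩
        ∣ expSum (r k + ℕ→ℚ M * r k) k - expSum (r k) k * expSum (ℕ→ℚ M * r k) k ∣ + ∣ expSum (r k)
          k * expSum (ℕ→ℚ M * r k) k - ℕ→ℚ p * ℕ→ℚ (p ℕ.^ M) ∣
          ≤⟨ ℚ.+-monoˡ-≤ ∣ expSum (r k) k * expSum (ℕ→ℚ M * r k) k - ℕ→ℚ p * ℕ→ℚ (p ℕ.^ M) ∣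
               (ℚ.≤-trans (ℚ.≤-reflexive (∣-∣-swap (expSum (r k + ℕ→ℚ M * r k) k)
                 (expSum (r k) k * expSum (ℕ→ℚ M * r k) k)))
                 (ℚ.≤-trans (exp-add (∣nonNeg∣≤ (r≥0 k) (ℚ.≤-trans (r≤b k) p≤B))
                   (∣nonNeg∣≤ (0≤* (ℕ→ℚ-nonNeg M) (r≥0 k)) (Mr≤B k)) k) (x≤∣x∣ (error k)))) ⟩
        ∣ error k ∣ + ∣ expSum (r k) k * expSum (ℕ→ℚ M * r k) k - ℕ→ℚ p * ℕ→ℚ (p ℕ.^ M) ∣ ∎
    where
    open ℚ.≤-Reasoning
    B : ℚ
    B = ℕ→ℚ p + ℕ→ℚ M * ℕ→ℚ p
    Mp≥0 : 0ℚ ≤ ℕ→ℚ M * ℕ→ℚ p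
    Mp≥0 = 0≤* (ℕ→ℚ-nonNeg M) (ℕ→ℚ-nonNeg p)
    p≤B : ℕ→ℚ p ≤ B
    p≤B = ≤-+ʳ Mp≥0
    Mr≤B : ∀ k → ℕ→ℚ M * r k ≤ B
    Mr≤B k = ℚ.≤-trans (*-monoˡ (ℕ→ℚ-nonNeg M) (r≤b k)) (≤-+ˡ (ℕ→ℚ-nonNeg p))
    open Estimates B (0≤+ (ℕ→ℚ-nonNeg p) Mp≥0)

  -- With x = −e σ log p, e σ ≤ M + small and F = exp (M log p) ≈ p^M ≤ A, this
  -- bounds A exp x = A exp (x + M log p) / F from below.
  term-lower-bound : (σ : ℝ) (M e A : ℕ) → p ℕ.^ M ℕ.≤ A →
    (∀ ε → 0ℚ < ε → Eventually (λ k → ℕ→ℚ e * seq σ k ≤ ℕ→ℚ M + ε)) →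
    Eventually (λ k → + 1 / 8 ≤ ℕ→ℚ A * expSum (- (ℕ→ℚ e * seq σ k * r k)) k)
  term-lower-bound σ M e A p^M≤A small = go expSum≥½ (eventually-bounded σ)
    where
    x : ℕ → ℚ
    x k = - (ℕ→ℚ e * seq σ k * r k)
    go : ∃[ η ] 0ℚ < η × (∀ {x} → - η ≤ x → ∀ k → ½ ≤ expSum x k) → ∃[ D ] ∃[ N ] (0ℚ ≤ D) ×
      (∀ n → N ℕ.≤ n → ∣ seq σ n ∣ ≤ D) →
      Eventually (λ k → + 1 / 8 ≤ ℕ→ℚ A * expSum (x k) k)
    go (η , η>0 , exp≥½) (D , N , D≥0 , σ≤D) = eventually-map conclude
        (small ε ε>0 ⟨and⟩ (N , σ≤D) ⟨and⟩ close {λ k → expSum (ℕ→ℚ M * r k) k} (exp-log-power M) 1ℚ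
          (pos 1ℚ) ⟨and⟩ close {error} {λ _ → 0ℚ}
          (null-dom {g = λ k _ → ∣ error k ∣} (null-∣∣ error-null) 0 (λ k _ _ _ → ℚ.≤-reflexive
            (cong ∣_∣ (ℚ.+-identityʳ (error k))))) (+ 1 / 4) (pos (+ 1 / 4)))
      where
      ε : ℚ
      -- As r k ≤ p, an excess of at most ε in e σ over M lowers the exponent by at most p ε ≤ η,
      -- which `exp≥½` tolerates.
      ε = η * 1/suc p
      ε>0 : 0ℚ < ε
      ε>0 = pos ε {{ℚ.pos*pos⇒pos η {{ℚ.positive η>0}} (1/suc p) {{ℚ.normalize-pos 1 (suc p)}}}}
      pε≤η : ℕ→ℚ p * ε ≤ η
      pε≤η = begin
        ℕ→ℚ p * (η * 1/suc p)         ≤⟨ *-monoʳ (ℚ.<⇒≤ ε>0) (ℕ→ℚ-mono (ℕ.n≤1+n p)) ⟩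
        ℕ→ℚ (suc p) * (η * 1/suc p)   ≡⟨ solve 3 (λ p e i → p :* (e :* i) := (p :* i) :* e) refl
          (ℕ→ℚ (suc p)) η (1/suc p) ⟩
        ℕ→ℚ (suc p) * 1/suc p * η     ≡⟨ trans (cong (_* η) (suc*1/suc p)) (ℚ.*-identityˡ η) ⟩
        η                             ∎
        where open ℚ.≤-Reasoning
      B₁ B₂ : ℚ
      B₁ = ℕ→ℚ e * D * ℕ→ℚ p
      B₂ = ℕ→ℚ M * ℕ→ℚ p
      B₁≥0 : 0ℚ ≤ B₁
      B₁≥0 = 0≤* (0≤* (ℕ→ℚ-nonNeg e) D≥0) (ℕ→ℚ-nonNeg p)
      B₂≥0 : 0ℚ ≤ B₂
      B₂≥0 = 0≤* (ℕ→ℚ-nonNeg M) (ℕ→ℚ-nonNeg p)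
      open Estimates (B₁ + B₂) (0≤+ B₁≥0 B₂≥0)
      conclude : ∀ k → (ℕ→ℚ e * seq σ k ≤ ℕ→ℚ M + ε) × (∣ seq σ k ∣ ≤ D) × (∣ expSum (ℕ→ℚ M * r k) k
        - ℕ→ℚ (p ℕ.^ M) ∣ ≤ 1ℚ) × (∣ error k - 0ℚ ∣ ≤ + 1 / 4) →
        + 1 / 8 ≤ ℕ→ℚ A * expSum (x k) k
      -- A partial sum of exp at a negative argument may fail to be positive, so X ≤ 0 has to be
      -- excluded before F is replaced by 2A.
      conclude k (eσ≤ , σ≤ , F≈ , error≤) = [
        (λ X≥0 → half (ℚ.≤-trans XF≥¼ (ℚ.≤-trans (*-monoˡ X≥0 F≤2A) (ℚ.≤-reflexive
            (solve 2 (λ x a → x :* (a :+ a) := a :* x :+ a :* x) refl X (ℕ→ℚ A))))))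
          , (λ X≤0 → contradiction (ℚ.≤-trans XF≥¼ (ℚ.≤-trans (*-monoʳ F≥0 X≤0)
            (ℚ.≤-reflexive (ℚ.*-zeroˡ F)))) λ h → ℚ.<-irrefl refl (ℚ.<-≤-trans (pos (+ 1 / 4)) h))
            ]′
          (ℚ.≤-total 0ℚ X)
        where
        X F v : ℚ
        X = expSum (x k) k
        F = expSum (ℕ→ℚ M * r k) k
        v = x k + ℕ→ℚ M * r k
        half : ∀ {y} → + 1 / 4 ≤ y + y → + 1 / 8 ≤ y
        half {y} h = ℚ.≤-trans (*-monoˡ {c = ½} (ℚ.≤ᵇ⇒≤ _) h)
          (ℚ.≤-reflexive (solve 1 (λ y → con ½ :* (y :+ y) := y) refl y))
        F≥1 : 1ℚ ≤ F
        F≥1 = expSum≥1 (0≤* (ℕ→ℚ-nonNeg M) (r≥0 k)) k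
        F≥0 : 0ℚ ≤ F
        F≥0 = ℚ.≤-trans 1≥0 F≥1
        A≥1 : 1ℚ ≤ ℕ→ℚ A
        A≥1 = ℕ→ℚ-mono (ℕ.≤-trans (ℕ.m^n>0 p M) p^M≤A)
        F≤2A : F ≤ ℕ→ℚ A + ℕ→ℚ A
        F≤2A = ℚ.≤-trans (≤-of-close F≈) (ℚ.+-mono-≤ (ℕ→ℚ-mono p^M≤A) A≥1)
        v≥-η : - η ≤ v
        v≥-η = ℚ.≤-trans (ℚ.neg-antimono-≤ (ℚ.≤-trans (*-monoˡ (r≥0 k) excess≤ε)
          (ℚ.≤-trans (*-monoʳ (ℚ.<⇒≤ ε>0) (r≤b k)) pε≤η)))
            (ℚ.≤-reflexive (solve 3 (λ r m s → :- (r :* (s :- m)) := (:- (s :* r)) :+ m :* r) refl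
              (r k) (ℕ→ℚ M) (ℕ→ℚ e * seq σ k)))
          where
          excess≤ε : ℕ→ℚ e * seq σ k - ℕ→ℚ M ≤ ε
          excess≤ε = ℚ.≤-trans (ℚ.+-monoˡ-≤ (- ℕ→ℚ M) eσ≤)
            (ℚ.≤-reflexive (solve 2 (λ m e → (m :+ e) :- m := e) refl (ℕ→ℚ M) ε))
        ∣x∣≤ : ∣ x k ∣ ≤ B₁ + B₂
        ∣x∣≤ = ℚ.≤-trans (ℚ.≤-reflexive (trans (ℚ.∣-p∣≡∣p∣ (ℕ→ℚ e * seq σ k * r k))
          (trans (ℚ.∣p*q∣≡∣p∣*∣q∣ (ℕ→ℚ e * seq σ k) (r k))
            (cong₂ _*_ (trans (ℚ.∣p*q∣≡∣p∣*∣q∣ (ℕ→ℚ e) (seq σ k)) (cong (_* ∣ seq σ k ∣)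
              (ℚ.0≤p⇒∣p∣≡p (ℕ→ℚ-nonNeg e)))) (ℚ.0≤p⇒∣p∣≡p (r≥0 k))))))
          (ℚ.≤-trans (*-mono (r≥0 k) (0≤* (ℕ→ℚ-nonNeg e) D≥0) (*-monoˡ (ℕ→ℚ-nonNeg e) σ≤) (r≤b k))
            (≤-+ʳ B₂≥0))
        ∣Mr∣≤ : ∣ ℕ→ℚ M * r k ∣ ≤ B₁ + B₂
        ∣Mr∣≤ = ∣nonNeg∣≤ (0≤* (ℕ→ℚ-nonNeg M) (r≥0 k)) (ℚ.≤-trans (*-monoˡ (ℕ→ℚ-nonNeg M) (r≤b k))
          (≤-+ˡ B₁≥0))
        XF≈ : ∣ X * F - expSum v k ∣ ≤ + 1 / 4
        XF≈ = ℚ.≤-trans (exp-add ∣x∣≤ ∣Mr∣≤ k) (ℚ.≤-trans (x≤∣x∣ (error k))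
          (ℚ.≤-trans (ℚ.≤-reflexive (cong ∣_∣ (sym (ℚ.+-identityʳ (error k))))) error≤))
        -- exp v ≥ ½ less the error ¼. With F ≤ pᴹ + 1 ≤ 2A this becomes A X ≥ 1/8.
        XF≥¼ : + 1 / 4 ≤ X * F
        XF≥¼ = ≤-diff (ℚ.≤-trans (diff-≥0 (ℚ.≤-trans (exp≥½ v≥-η k) (≥-of-close {X * F} {expSum v k}
          XF≈)))
          (ℚ.≤-reflexive (solve 1 (λ y → (y :+ con (+ 1 / 4)) :- con ½ := y :- con (+ 1 / 4)) refl
            (X * F))))

-- Divergence

_≲_ : ℝ → ℚ → Set
σ ≲ q = ∀ ε → 0ℚ < ε → Eventually (λ k → seq σ k ≤ q + ε)

<⇒≱ : ∀ {x y} → x < y → ¬ y ≤ x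
<⇒≱ x<y y≤x = ℚ.<-irrefl refl (ℚ.<-≤-trans x<y y≤x)

fraction-ε : ∀ n ε → 0ℚ < ε → ∃[ ε′ ] 0ℚ < ε′ × ℕ→ℚ n * ε′ ≤ ε
fraction-ε n ε ε>0 = ε * 1/suc n , ε′>0 , (begin
  ℕ→ℚ n * (ε * 1/suc n)         ≤⟨ *-monoʳ (ℚ.<⇒≤ ε′>0) (ℕ→ℚ-mono (ℕ.n≤1+n n)) ⟩
  ℕ→ℚ (suc n) * (ε * 1/suc n)   ≡⟨ solve 3 (λ p e i → p :* (e :* i) := (p :* i) :* e) refl
    (ℕ→ℚ (suc n)) ε (1/suc n) ⟩
  ℕ→ℚ (suc n) * 1/suc n * ε     ≡⟨ trans (cong (_* ε) (suc*1/suc n)) (ℚ.*-identityˡ ε) ⟩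
  ε                             ∎)
  where
  open ℚ.≤-Reasoning
  ε′>0 : 0ℚ < ε * 1/suc n
  ε′>0 = pos (ε * 1/suc n) {{ℚ.pos*pos⇒pos ε {{ℚ.positive ε>0}} (1/suc n)
    {{ℚ.normalize-pos 1 (suc n)}}}}

≲-scale : ∀ n {σ q} → σ ≲ q → ∀ ε → 0ℚ < ε → Eventually (λ k → ℕ→ℚ n * seq σ k ≤ ℕ→ℚ n * q + ε)
≲-scale n {σ} {q} h ε ε>0 = go (fraction-ε n ε ε>0)
  where
  go : ∃[ ε′ ] 0ℚ < ε′ × ℕ→ℚ n * ε′ ≤ ε → Eventually (λ k → ℕ→ℚ n * seq σ k ≤ ℕ→ℚ n * q + ε)
  go (ε′ , ε′>0 , nε′≤ε) = eventually-map (λ k σ≤ → ℚ.≤-trans (*-monoˡ (ℕ→ℚ-nonNeg n) σ≤)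
    (ℚ.≤-trans (ℚ.≤-reflexive (ℚ.*-distribˡ-+ (ℕ→ℚ n) q ε′)) (ℚ.+-monoʳ-≤ (ℕ→ℚ n * q) nε′≤ε)))
      (h ε′ ε′>0)

difference-square : ∀ x y → (x - y) * (x - y) ≤ (x * x + y * y) + (x * x + y * y)
difference-square x y = ≤-diff (ℚ.≤-trans (square-≥0 (x + y)) (ℚ.≤-reflexive
  (solve 2 (λ x y → (x :+ y) :* (x :+ y) := ((x :* x :+ y :* y) :+ (x :* x :+ y :* y)) :- (x :- y)
    :* (x :- y)) refl x y)))

-- The terms with exponent k b have modulus at least 1/√128, so that the
-- partial sums do not converge.
large-terms⇒diverges : ∀ (p : ℕ) .{{_ : ℕ.NonZero p}} (N : ℕ → ℕ) (s : ℂ) a b .{{_ : ℕ.NonZero b}} →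
  (∀ k → p ℕ.^ (k ℕ.* a) ℕ.≤ N (p ℕ.^ (k ℕ.* b))) →
  (∀ ε → 0ℚ < ε → Eventually (λ k → ℕ→ℚ b * seq (re s) k ≤ ℕ→ℚ a + ε)) →
  Diverges (η̃-term N p s)
large-terms⇒diverges p N s a b large σ-bound (l , converges) =
  impossible (lower ⟨and⟩ angle ⟨and⟩ converges₀ (1/2048) (pos 1/2048) ⟨and⟩ converges₁ 1/2048
    (pos 1/2048))
  where
  open Log p (1≤ p) using (r)
  open Powers p
  ε 1/2048 : ℚ
  -- Two partial sums within ε of the limit allow a squared term of at most 4 (ε² + 1/2048) = 3/512,
  -- below the lower bound 1/128; the 1/2048 is the slack left by the comparison of reals.
  ε = + 1 / 32
  1/2048 = + 1 / 2048
  n₀ k e A : ℕ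
  n₀ = proj₁ (converges ε (pos ε))
  -- Since b ≥ 1, the exponent e = k b is beyond n₀, and the partial sums before and after the term
  -- with exponent e are both close to l.
  k = suc n₀
  e = k ℕ.* b
  A = N (p ℕ.^ e)
  n₀≤e : n₀ ℕ.≤ e
  n₀≤e = ℕ.≤-trans (ℕ.n≤1+n n₀) (ℕ.m≤m*n k b)
  converges₀ = proj₂ (converges ε (pos ε)) e n₀≤e
  converges₁ = proj₂ (converges ε (pos ε)) (suc e) (ℕ.m≤n⇒m≤1+n n₀≤e)
  z : ℂ
  z = (-ᶜ (fromℕᶜ e *ᶜ s)) *ᶜ fromℝ (log p)
  x : ℕ → ℚ
  x i = - (ℕ→ℚ e * seq (re s) i * r i)
  X cosine sine : ℕ → ℚ
  X i = expSum (x i) i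
  cosine i = cosSum (seq (im z) i) i
  sine i = sinSum (seq (im z) i) i

  lower : Eventually (λ i → + 1 / 8 ≤ ℕ→ℚ A * X i)
  lower = term-lower-bound (re s) (k ℕ.* a) e A (large k) λ ε ε>0 → scaled ε (fraction-ε k ε ε>0)
    where
    scaled : ∀ ε → ∃[ ε′ ] 0ℚ < ε′ × ℕ→ℚ k * ε′ ≤ ε → Eventually (λ i → ℕ→ℚ e * seq (re s) i ≤ ℕ→ℚ
      (k ℕ.* a) + ε)
    scaled ε (ε′ , ε′>0 , kε′≤ε) = eventually-map (λ i h → begin
        ℕ→ℚ e * seq (re s) i                 ≡⟨ cong (_* seq (re s) i) (ℕ→ℚ-* k b) ⟩
        ℕ→ℚ k * ℕ→ℚ b * seq (re s) i         ≡⟨ ℚ.*-assoc (ℕ→ℚ k) (ℕ→ℚ b) (seq (re s) i) ⟩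
        ℕ→ℚ k * (ℕ→ℚ b * seq (re s) i)       ≤⟨ *-monoˡ (ℕ→ℚ-nonNeg k) h ⟩
        ℕ→ℚ k * (ℕ→ℚ a + ε′)                 ≡⟨ ℚ.*-distribˡ-+ (ℕ→ℚ k) (ℕ→ℚ a) ε′ ⟩
        ℕ→ℚ k * ℕ→ℚ a + ℕ→ℚ k * ε′           ≤⟨ ℚ.+-mono-≤ (ℚ.≤-reflexive (sym (ℕ→ℚ-* k a))) kε′≤ε ⟩
        ℕ→ℚ (k ℕ.* a) + ε                    ∎) (σ-bound ε′ ε′>0)
      where open ℚ.≤-Reasoning

  -- Here the phase, which depends on im s, drops out: an error of at most ¼ for each of the two
  -- squares leaves ½ of cos² + sin² = 1.
  angle : Eventually (λ i → ½ ≤ cosine i * cosine i + sine i * sine i)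
  angle = go (eventually-bounded (im z))
    where
    go : ∃[ D ] ∃[ M ] (0ℚ ≤ D) × (∀ n → M ℕ.≤ n → ∣ seq (im z) n ∣ ≤ D) → Eventually
      (λ i → ½ ≤ cosine i * cosine i + sine i * sine i)
    go (D , M , D≥0 , bound) = eventually-map (λ i (h , small) → ≤-diff (ℚ.≤-trans
        (diff-≥0 (≥-of-close {cosine i * cosine i + sine i * sine i} {1ℚ} {½}
          (ℚ.≤-trans (cos²+sin² h i) (ℚ.≤-trans
          (ℚ.+-mono-≤ (error≤ i small) (error≤ i small)) (ℚ.≤ᵇ⇒≤ {+ 1 / 4 + + 1 / 4} {½} _)))))
        (ℚ.≤-reflexive (solve 1 (λ y → (y :+ con ½) :- con 1ℚ := y :- con ½) refl
          (cosine i * cosine i + sine i * sine i)))))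
      ((M , bound) ⟨and⟩ (proj₁ null , λ i q → proj₂ null i i q q))
      where
      open Estimates D D≥0
      null : ∃[ M ] ∀ m n → M ℕ.≤ m → M ℕ.≤ n → ∣ error m ∣ ≤ + 1 / 4
      null = error-null (+ 1 / 4) (pos (+ 1 / 4))
      error≤ : ∀ i → ∣ error i ∣ ≤ + 1 / 4 → error i ≤ + 1 / 4
      error≤ i = ℚ.≤-trans (x≤∣x∣ (error i))

  modulus² : ℂ → ℕ → ℚ
  modulus² w i = seq ∣ w ∣² i

  -- An identity of rational sequences, so products with the zero imaginary parts of reals are still
  -- present. The first solver call removes them from the modulus, the second from re z = -e σ log
  -- p.
  value : ∀ i → modulus² (η̃-term N p s e) i ≡ (ℕ→ℚ A * X i) * (ℕ→ℚ A * X i) * (cosine i * cosine i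
    + sine i * sine i)
  value i = trans
    (solve 4 (λ n x c s → (n :* (x :* c) :- con 0ℚ :* (x :* s)) :* (n :* (x :* c) :- con 0ℚ :*
      (x :* s))
                       :+ (n :* (x :* s) :+ con 0ℚ :* (x :* c)) :* (n :* (x :* s) :+ con 0ℚ :*
                         (x :* c))
                       := (n :* x) :* (n :* x) :* (c :* c :+ s :* s))
      refl (ℕ→ℚ A) (expSum (seq (re z) i) i) (cosine i) (sine i))
    (cong (λ y → (ℕ→ℚ A * expSum y i) * (ℕ→ℚ A * expSum y i) * (cosine i * cosine i + sine i * sine
      i))
      (solve 4 (λ e σ τ r → (:- (e :* σ :- con 0ℚ :* τ)) :* r :- (:- (e :* τ :+ con 0ℚ :* σ)) :* con
        0ℚ := :- (e :* σ :* r))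
        refl (ℕ→ℚ e) (seq (re s) i) (seq (im s) i) (r i)))

  -- The term is the difference of two consecutive partial sums, both measured from l, and |a - b|²
  -- ≤ 2 (|a|² + |b|²).
  parallelogram : ∀ i → modulus² (η̃-term N p s e) i ≤
    (modulus² (partialSum (η̃-term N p s) (suc e) -ᶜ l) i + modulus² (partialSum (η̃-term N p s) e
      -ᶜ l) i) +
    (modulus² (partialSum (η̃-term N p s) (suc e) -ᶜ l) i + modulus² (partialSum (η̃-term N p s) e
      -ᶜ l) i)
  parallelogram i = bound (seq (re (partialSum (η̃-term N p s) e)) i) (seq (re (η̃-term N p s e)) i)
    (seq (re l) i)
                          (seq (im (partialSum (η̃-term N p s) e)) i) (seq (im (η̃-term N p s e)) i)
                            (seq (im l) i)
    where
    bound : ∀ u v w u′ v′ w′ → v * v + v′ * v′ ≤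
      (((u + v - w) * (u + v - w) + (u′ + v′ - w′) * (u′ + v′ - w′)) + ((u - w) * (u - w) +
        (u′ - w′) * (u′ - w′))) +
      (((u + v - w) * (u + v - w) + (u′ + v′ - w′) * (u′ + v′ - w′)) + ((u - w) * (u - w) +
        (u′ - w′) * (u′ - w′)))
    bound u v w u′ v′ w′ = ℚ.≤-trans (ℚ.≤-reflexive (cong₂ (λ a b → a * a + b * b) (step u v w)
      (step u′ v′ w′)))
      (ℚ.≤-trans (ℚ.+-mono-≤ (difference-square (u + v - w) (u - w))
        (difference-square (u′ + v′ - w′) (u′ - w′)))
        (ℚ.≤-reflexive (solve 4 (λ a b c d → ((a :+ b) :+ (a :+ b)) :+ ((c :+ d) :+ (c :+ d)) :=
          ((a :+ c) :+ (b :+ d)) :+ ((a :+ c) :+ (b :+ d))) refl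
          ((u + v - w) * (u + v - w)) ((u - w) * (u - w)) ((u′ + v′ - w′) * (u′ + v′ - w′))
            ((u′ - w′) * (u′ - w′)))))
      where
      step : ∀ u v w → v ≡ (u + v - w) - (u - w)
      step = solve 3 (λ u v w → v := (u :+ v :- w) :- (u :- w)) refl

  impossible : Eventually (λ i → (+ 1 / 8 ≤ ℕ→ℚ A * X i) × (½ ≤ cosine i * cosine i + sine i * sine
    i) ×
    (modulus² (partialSum (η̃-term N p s) e -ᶜ l) i ≤ ε * ε + 1/2048) ×
      (modulus² (partialSum (η̃-term N p s) (suc e) -ᶜ l) i ≤ ε * ε + 1/2048)) → ⊥
  impossible (i , h) = go (h i ℕ.≤-refl)
    where
    go : _ → ⊥
    go (AX≥⅛ , c²+s²≥½ , near₀ , near₁) = contradiction (begin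
        (+ 1 / 8) * (+ 1 / 8) * ½
          ≤⟨ *-mono (ℚ.≤ᵇ⇒≤ _) (square-≥0 (ℕ→ℚ A * X i)) (*-mono (ℚ.≤ᵇ⇒≤ _) (ℚ.≤-trans (ℚ.≤ᵇ⇒≤ _)
            AX≥⅛) AX≥⅛ AX≥⅛) c²+s²≥½ ⟩
        (ℕ→ℚ A * X i) * (ℕ→ℚ A * X i) * (cosine i * cosine i + sine i * sine i)
          ≡⟨ value i ⟨
        modulus² (η̃-term N p s e) i
          ≤⟨ parallelogram i ⟩
        _ ≤⟨ ℚ.+-mono-≤ (ℚ.+-mono-≤ near₁ near₀) (ℚ.+-mono-≤ near₁ near₀) ⟩
        ((ε * ε + 1/2048) + (ε * ε + 1/2048)) + ((ε * ε + 1/2048) + (ε * ε + 1/2048)) ∎)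
      (λ h → <⇒≱ (toWitness {a? = _ ℚ.<? _} _) h)
      where open ℚ.≤-Reasoning

*-/ : ∀ a b → ℕ→ℚ (suc b) * (+ a / suc b) ≡ ℕ→ℚ a
*-/ a b = ℚ.toℚᵘ-injective (ℚᵘ.≃-trans (ℚ.toℚᵘ-homo-* (ℕ→ℚ (suc b)) (+ a / suc b))
  (ℚᵘ.≃-trans (ℚᵘ.*-cong (/-toℚᵘ (+ suc b) 0) (/-toℚᵘ (+ a) b))
    (ℚᵘ.≃-trans (ℚᵘ.*≡* (trans (ℤ.*-identityʳ (+ suc b ℤ.* + a)) (trans (ℤ.*-comm (+ suc b) (+ a))
      (cong (λ d → + a ℤ.* + d) (sym (ℕ.*-identityˡ (suc b)))))))
      (ℚᵘ.≃-sym (/-toℚᵘ (+ a) 0)))))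

order-count-powers : ∀ {c ℓ₁ ℓ₂ m} (K : NumberField c ℓ₁ ℓ₂ (suc m)) → IntegralCoordinates K m →
  ∀ N → IsOrderCount K N → ∀ p .{{_ : ℕ.NonZero p}} d → d ℕ.≤ m →
  ∀ k → p ℕ.^ (k ℕ.* (d ℕ.* (m ∸ d))) ℕ.≤ N (p ℕ.^ (k ℕ.* (m ℕ.+ d)))
order-count-powers {m = m} K IC N counts p d d≤m k = subst (ℕ._≤ N (p ℕ.^ (k ℕ.* (m ℕ.+ d)))) number
  (subst (λ i → (P ℕ.^ d) ℕ.^ e ℕ.≤ N i) index
    (Orders.order-count K {e} {d} (subst (IntegralCoordinates K) (sym e+d≡m) IC) P {{P≢0}} N
      counts))
  where
  e P : ℕ
  e = m ∸ d
  P = p ℕ.^ k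
  P≢0 : ℕ.NonZero P
  P≢0 = ℕ.m^n≢0 p k
  e+d≡m : e ℕ.+ d ≡ m
  e+d≡m = ℕ.m∸n+n≡m d≤m
  number : (P ℕ.^ d) ℕ.^ e ≡ p ℕ.^ (k ℕ.* (d ℕ.* e))
  number = trans (ℕ.^-*-assoc P d e) (ℕ.^-*-assoc p k (d ℕ.* e))
  index : P ℕ.^ e ℕ.* (P ℕ.* P) ℕ.^ d ≡ p ℕ.^ (k ℕ.* (m ℕ.+ d))
  index = begin
    P ℕ.^ e ℕ.* (P ℕ.* P) ℕ.^ d               ≡⟨ cong (λ q → P ℕ.^ e ℕ.* q ℕ.^ d)
      (ℕ.^-distribˡ-+-* p k k) ⟨
    P ℕ.^ e ℕ.* (p ℕ.^ (k ℕ.+ k)) ℕ.^ d       ≡⟨ cong₂ ℕ._*_ (ℕ.^-*-assoc p k e)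
      (ℕ.^-*-assoc p (k ℕ.+ k) d) ⟩
    p ℕ.^ (k ℕ.* e) ℕ.* p ℕ.^ ((k ℕ.+ k) ℕ.* d) ≡⟨ ℕ.^-distribˡ-+-* p (k ℕ.* e) ((k ℕ.+ k) ℕ.* d) ⟨
    p ℕ.^ (k ℕ.* e ℕ.+ (k ℕ.+ k) ℕ.* d)       ≡⟨ cong (p ℕ.^_)
      (ℕ-solve 3 (λ k e d → k ⊛ᴺ e ⊹ᴺ (k ⊹ᴺ k) ⊛ᴺ d ⊜ᴺ k ⊛ᴺ ((e ⊹ᴺ d) ⊹ᴺ d)) refl k e d) ⟩
    p ℕ.^ (k ℕ.* (e ℕ.+ d ℕ.+ d))             ≡⟨ cong (λ m → p ℕ.^ (k ℕ.* (m ℕ.+ d))) e+d≡m ⟩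
    p ℕ.^ (k ℕ.* (m ℕ.+ d))                   ∎
    where open ≡-Reasoning

diverges : ∀ {c ℓ₁ ℓ₂ m} (K : NumberField c ℓ₁ ℓ₂ (suc (suc m))) N → IsOrderCount K N →
  ∀ p .{{_ : ℕ.NonZero p}} s d → d ℕ.≤ suc m →
  (∀ ε → 0ℚ < ε → Eventually (λ k → ℕ→ℚ (suc m ℕ.+ d) * seq (re s) k ≤ ℕ→ℚ (d ℕ.* (suc m ∸ d)) + ε))
    →
  Diverges (η̃-term N p s)
diverges {m = m} K N counts p s d d≤m bound converges = integral-coordinates K λ IC →
  large-terms⇒diverges p N s (d ℕ.* (suc m ∸ d)) (suc m ℕ.+ d) (order-count-powers K IC N counts p d
    d≤m) bound converges

-- A suitable d for each of the two bounds.

max-sel : ∀ q qs → max q qs ≡ q ⊎ max q qs ∈ qs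
max-sel = argmax-sel id

ratio-* : ∀ n .{{_ : NonTrivial n}} d → ℕ→ℚ (n ∸ 1 ℕ.+ d) * ratio n d ≡ ℕ→ℚ (d ℕ.* (n ∸ 1 ∸ d))
ratio-* (suc (suc m)) d = *-/ (d ℕ.* (suc m ∸ d)) (m ℕ.+ d)

ratio≥0 : ∀ n .{{_ : NonTrivial n}} d → 0ℚ ≤ ratio n d
ratio≥0 (suc (suc m)) d = ℚ.nonNegative⁻¹ _ {{ℚ.normalize-nonNeg (d ℕ.* (suc m ∸ d)) (suc m ℕ.+ d)}}

-- The quotient for d with its denominator cleared, as `diverges` wants it; 0 ≤ q is kept because it
-- gives ½ q ≤ q.
Attained : ℕ → ℚ → Set
Attained n q = ∃[ d ] d ℕ.≤ n ∸ 1 × 0ℚ ≤ q × ℕ→ℚ (n ∸ 1 ℕ.+ d) * q ≡ ℕ→ℚ (d ℕ.* (n ∸ 1 ∸ d))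

c₇-attained : ∀ n .{{_ : NonTrivial n}} → Attained n (c₇ n)
c₇-attained n = [ (λ eq → at-ratio 0 ℕ.z≤n eq) , (λ max∈ → attained (∈-map⁻ (ratio n) max∈)) ]′
  (max-sel (ratio n 0) (map (ratio n) (upTo n)))
  where
  at-ratio : ∀ d → d ℕ.≤ n ∸ 1 → c₇ n ≡ ratio n d → Attained n (c₇ n)
  at-ratio d d≤ eq = d , d≤ , ℚ.≤-trans (ratio≥0 n d) (ℚ.≤-reflexive (sym eq)) , trans
    (cong (ℕ→ℚ (n ∸ 1 ℕ.+ d) *_) eq) (ratio-* n d)
  attained : ∃[ d ] d ∈ upTo n × c₇ n ≡ ratio n d → Attained n (c₇ n)
  attained (d , d∈ , eq) = at-ratio d (ℕ.∸-monoˡ-≤ 1 (∈-upTo⁻ d∈)) eq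

bound₁ : ∀ {σ} q a b → 0ℚ ≤ q → ℕ→ℚ b * q ≡ ℕ→ℚ a → σ ≤ᴿ fromℚ (½ * q) →
  ∀ ε → 0ℚ < ε → Eventually (λ k → ℕ→ℚ b * seq σ k ≤ ℕ→ℚ a + ε)
bound₁ {σ} q a b q≥0 bq≡a h ε ε>0 = eventually-map (λ k → subst (λ y → ℕ→ℚ b * seq σ k ≤ y + ε)
  bq≡a) (≲-scale b {σ} {q} σ≲q ε ε>0)
  where
  ½q≤q : ½ * q ≤ q
  ½q≤q = ℚ.≤-trans (≤-+ʳ (0≤* {½} {q} (ℚ.≤ᵇ⇒≤ _) q≥0)) (ℚ.≤-reflexive (½-+ q))
  σ≲q : σ ≲ q
  σ≲q ε ε>0 = eventually-map (λ k σ≤ → ℚ.≤-trans σ≤ (ℚ.+-monoˡ-≤ ε ½q≤q)) (h ε ε>0)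

-- A value of at most 4/3 has square at most 16/9, whereas the squares are eventually at least 2 -
-- 1/9 = 17/9. At 4/3 the bound of the second part becomes exactly m/6.
√2≥4/3 : Eventually (λ k → + 4 / 3 ≤ seq √2 k)
√2≥4/3 = eventually-map (λ k near → [ (λ h → h) , (λ v≤ → contradiction
  (ℚ.≤-trans (≥-of-close {seq √2 k * seq √2 k} {ℕ→ℚ 2} near)
      (ℚ.+-monoˡ-≤ (+ 1 / 9) (*-mono (v≥0 k) (ℚ.≤ᵇ⇒≤ _) v≤ v≤)))
        (λ h → <⇒≱ (toWitness {a? = _ ℚ.<? _} _) h)) ]′ (ℚ.≤-total (+ 4 / 3) (seq √2 k)))
    (close {λ k → seq √2 k * seq √2 k} {λ _ → ℕ→ℚ 2} Sqrt2.F-null (+ 1 / 9) (pos (+ 1 / 9)))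
  where
  v≥0 : ∀ k → 0ℚ ≤ seq √2 k
  v≥0 k = 0≤+ 1≥0 (Sqrt2.r≥0 k)

-- √2 ≥ 4/3 already gives ((3 − 2√2)(m + 1) + 1 − √2)/2 ≤ m/6.
bound₂ : ∀ {σ} m a b → m ℕ.* b ℕ.≤ 6 ℕ.* a →
  σ ≤ᴿ fromℚ ½ *ᴿ ((fromℕ 3 -ᴿ fromℕ 2 *ᴿ √2) *ᴿ fromℕ (suc m) +ᴿ fromℕ 1 -ᴿ √2) →
  ∀ ε → 0ℚ < ε → Eventually (λ k → ℕ→ℚ b * seq σ k ≤ ℕ→ℚ a + ε)
bound₂ {σ} m a b mb≤6a h ε ε>0 = eventually-map (λ k bσ≤ → ℚ.≤-trans bσ≤ (ℚ.+-monoˡ-≤ ε bρ≤a))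
  (≲-scale b {σ} {ρ} σ≲ρ ε ε>0)
  where
  ρ : ℚ
  ρ = (+ 1 / 6) * ℕ→ℚ m
  bρ≤a : ℕ→ℚ b * ρ ≤ ℕ→ℚ a
  bρ≤a = begin
    ℕ→ℚ b * ((+ 1 / 6) * ℕ→ℚ m)     ≡⟨ solve 3 (λ b s m → b :* (s :* m) := s :* (m :* b)) refl
      (ℕ→ℚ b) (+ 1 / 6) (ℕ→ℚ m) ⟩
    (+ 1 / 6) * (ℕ→ℚ m * ℕ→ℚ b)     ≡⟨ cong ((+ 1 / 6) *_) (ℕ→ℚ-* m b) ⟨
    (+ 1 / 6) * ℕ→ℚ (m ℕ.* b)       ≤⟨ *-monoˡ {c = + 1 / 6} (ℚ.≤ᵇ⇒≤ _) (ℕ→ℚ-mono mb≤6a) ⟩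
    (+ 1 / 6) * ℕ→ℚ (6 ℕ.* a)       ≡⟨ cong ((+ 1 / 6) *_) (ℕ→ℚ-* 6 a) ⟩
    (+ 1 / 6) * (ℕ→ℚ 6 * ℕ→ℚ a)     ≡⟨ solve 1 (λ a → con (+ 1 / 6) :* (con (ℕ→ℚ 6) :* a) := a) refl
      (ℕ→ℚ a) ⟩
    ℕ→ℚ a                           ∎
    where open ℚ.≤-Reasoning
  σ≲ρ : σ ≲ ρ
  σ≲ρ ε ε>0 = eventually-map (λ k (σ≤ , √2≥) → ℚ.≤-trans σ≤ (ℚ.+-monoˡ-≤ ε (step (seq √2 k) √2≥)))
    (h ε ε>0 ⟨and⟩ √2≥4/3)
    where
    -- The right side minus the left side is (v - 4/3)(m + 3/2).
    step : ∀ v → + 4 / 3 ≤ v → ½ * ((ℕ→ℚ 3 - ℕ→ℚ 2 * v) * ℕ→ℚ (suc m) + ℕ→ℚ 1 - v) ≤ ρ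
    step v v≥ = ≤-diff (ℚ.≤-trans (0≤* (diff-≥0 v≥) (0≤+ (ℕ→ℚ-nonNeg (suc m)) (ℚ.≤ᵇ⇒≤ {0ℚ} {½} _)))
      (ℚ.≤-reflexive
      (trans (cong (λ n → (v - + 4 / 3) * (n + ½)) (ℕ→ℚ-suc m)) (trans
        (solve 2 (λ v m → (v :- con (+ 4 / 3)) :* ((con 1ℚ :+ m) :+ con ½) :=
           con (+ 1 / 6) :* m :- con ½ :* ((con (ℕ→ℚ 3) :- con (ℕ→ℚ 2) :* v) :* (con 1ℚ :+ m) :+ con
             (ℕ→ℚ 1) :- v)) refl v (ℕ→ℚ m))
        (cong (λ n → ρ - ½ * ((ℕ→ℚ 3 - ℕ→ℚ 2 * v) * n + ℕ→ℚ 1 - v)) (sym (ℕ→ℚ-suc m)))))))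

halve : ∀ m → ∃[ h ] (m ≡ h ℕ.+ h ⊎ m ≡ suc (h ℕ.+ h))
halve zero    = 0 , inj₁ refl
halve (suc m) with halve m
... | h , inj₁ refl = h , inj₂ refl
... | h , inj₂ refl = suc h , inj₁ (cong suc (sym (ℕ.+-suc h h)))

-- With n = m + 2 this is m/6 ≤ d (n - 1 - d)/(n - 1 + d), cleared of denominators, for d the half
-- of n - 1 rounded down. The two sides differ by 4h if m = 2h and by 3(h + 1) if m = 2h + 1.
near-half : ∀ m → ∃[ d ] d ℕ.≤ suc m × m ℕ.* (suc m ℕ.+ d) ℕ.≤ 6 ℕ.* (d ℕ.* (suc m ∸ d))
near-half m with halve m
... | h , inj₁ refl = h , ℕ.m≤n⇒m≤1+n (ℕ.m≤m+n h h) , subst (λ e → (h ℕ.+ h) ℕ.*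
  (suc (h ℕ.+ h) ℕ.+ h) ℕ.≤ 6 ℕ.* (h ℕ.* e))
  (sym (ℕ.m+n∸n≡m (suc h) h)) (subst ((h ℕ.+ h) ℕ.* (suc (h ℕ.+ h) ℕ.+ h) ℕ.≤_)
    (ℕ-solve 1 (λ h → (h ⊹ᴺ h) ⊛ᴺ ((ℕ-con 1 ⊹ᴺ (h ⊹ᴺ h)) ⊹ᴺ h) ⊹ᴺ ℕ-con 4 ⊛ᴺ h ⊜ᴺ ℕ-con 6 ⊛ᴺ
      (h ⊛ᴺ (ℕ-con 1 ⊹ᴺ h))) refl h)
    (ℕ.m≤m+n _ (4 ℕ.* h)))
... | h , inj₂ refl = suc h , ℕ.s≤s (ℕ.m≤n⇒m≤1+n (ℕ.m≤m+n h h)) , subst (λ e → suc (h ℕ.+ h) ℕ.*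
  (suc (suc (h ℕ.+ h)) ℕ.+ suc h) ℕ.≤ 6 ℕ.* (suc h ℕ.* e))
  (sym (ℕ.m+n∸n≡m (suc h) h)) (subst (suc (h ℕ.+ h) ℕ.* (suc (suc (h ℕ.+ h)) ℕ.+ suc h) ℕ.≤_)
    (ℕ-solve 1 (λ h → (ℕ-con 1 ⊹ᴺ (h ⊹ᴺ h)) ⊛ᴺ ((ℕ-con 2 ⊹ᴺ (h ⊹ᴺ h)) ⊹ᴺ (ℕ-con 1 ⊹ᴺ h)) ⊹ᴺ ℕ-con 3
      ⊛ᴺ (ℕ-con 1 ⊹ᴺ h) ⊜ᴺ ℕ-con 6 ⊛ᴺ ((ℕ-con 1 ⊹ᴺ h) ⊛ᴺ (ℕ-con 1 ⊹ᴺ h))) refl h)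
    (ℕ.m≤m+n _ (3 ℕ.* suc h)))

diverges₁ : ∀ {c ℓ₁ ℓ₂ m} (K : NumberField c ℓ₁ ℓ₂ (suc (suc m))) N → IsOrderCount K N → ∀ p
  .{{_ : ℕ.NonZero p}} q →
  Attained (suc (suc m)) q → ∀ s → re s ≤ᴿ fromℚ (½ * q) → Diverges (η̃-term N p s)
diverges₁ {m = m} K N counts p q (d , d≤ , q≥0 , eq) s h =
  diverges K N counts p s d d≤ (bound₁ {re s} q (d ℕ.* (suc m ∸ d)) (suc m ℕ.+ d) q≥0 eq h)

diverges₂ : ∀ {c ℓ₁ ℓ₂ m} (K : NumberField c ℓ₁ ℓ₂ (suc (suc m))) N → IsOrderCount K N → ∀ p
  .{{_ : ℕ.NonZero p}} s →
  re s ≤ᴿ fromℚ ½ *ᴿ ((fromℕ 3 -ᴿ fromℕ 2 *ᴿ √2) *ᴿ fromℕ (suc m) +ᴿ fromℕ 1 -ᴿ √2) → Diverges (η̃-term N p s)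
diverges₂ {m = m} K N counts p s h = go (near-half m)
  where
  go : ∃[ d ] d ℕ.≤ suc m × m ℕ.* (suc m ℕ.+ d) ℕ.≤ 6 ℕ.* (d ℕ.* (suc m ∸ d)) → Diverges
    (η̃-term N p s)
  go (d , d≤ , ineq) = diverges K N counts p s d d≤ (bound₂ {re s} m (d ℕ.* (suc m ∸ d))
    (suc m ℕ.+ d) ineq h)

theorem6p3 : ∀ {c ℓ₁ ℓ₂} (n : ℕ) .{{_ : NonTrivial n}} (K : NumberField c ℓ₁ ℓ₂ n) →
    (p : ℕ) (p-prime : Prime p) (N : ℕ → ℕ) → IsOrderCount K N →
    (∀ s → re s ≤ᴿ fromℚ (½ * c₇ n) →
    Diverges (η̃-term N p {{prime⇒nonZero p-prime}} s))
    ×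
    (∀ s → re s ≤ᴿ fromℚ ½ *ᴿ ((fromℕ 3 -ᴿ fromℕ 2 *ᴿ √2) *ᴿ fromℕ (n ∸ 1) +ᴿ fromℕ 1 -ᴿ √2) →
    Diverges (η̃-term N p {{prime⇒nonZero p-prime}} s))
theorem6p3 n@(suc (suc _)) {{nt}} K p p-prime N counts =
  diverges₁ K N counts p {{prime⇒nonZero p-prime}} (c₇ n {{nt}}) (c₇-attained n {{nt}}) ,
  diverges₂ K N counts p {{prime⇒nonZero p-prime}}
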